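{- Let $n,d,h$ be positive integers and let $f(x_1,\ldots,x_n)\in\mathbb{Z}[[x_1,\ldots,x_n]]$ be a power series that is algebraic over $\mathbb{Q}(x_1,\ldots,x_n)$, of degree at most $d$ and height at most $h$. Then there exists an effective constant $A:=A(n,d,h)$, depending only on $n$, $d$ and $h$, such that for every prime number $p$ the power series $\Delta(f)_{\vert p}\in\mathbb{F}_p[[x]]$ is algebraic over $\mathbb{F}_p(x)$ of degree at most $p^{A}$ and height at most $A^2p^{A+1}$.
   Context: For a field $K$ and $g=\sum_{(i_1,\ldots,i_n)\in\mathbb{N}^n}a(i_1,\ldots,i_n)x_1^{i_1}\cdots x_n^{i_n}\in K[[x_1,\ldots,x_n]]$, the diagonal of $g$ is $\Delta(g)(x):=\sum_{m\ge0}a(m,\ldots,m)x^m\in K[[x]]$. A power series $g\in K[[x_1,\ldots,x_n]]$ is algebraic if there are polynomials $A_0,\ldots,A_m\in K[x_1,\ldots,x_n]$, not all zero, with $\sum_{i=0}^m A_i g^i=0$; its degree is the least such $m$. The height of a polynomial $P(Y)\in K[x_1,\ldots,x_n][Y]$ is the maximum of the total degrees of its coefficients, and the height of an algebraic $g$ is the minimum of the heights of the nonzero polynomials $P(Y)\in K[x_1,\ldots,x_n][Y]$ with $P(g)=0$. For $g=\sum a(m)x^m\in\mathbb{Z}[[x]]$ and a prime $p$, $g_{\vert p}:=\sum (a(m)\bmod p)x^m\in\mathbb{F}_p[[x]]$. -}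

module Defs where

open import Level using (0ℓ)
open import Data.Nat as ℕ using (ℕ; zero; suc; _≤_; _<_; _∸_)
open import Data.Vec using (Vec; []; _∷_; replicate; head)
open import Data.Integer as ℤ using (ℤ; +_)
open import Data.Integer.Divisibility as ℤDiv using ()
open import Data.Rational as ℚ using (ℚ)
open import Data.Product using (Σ; ∃; _×_; _,_)
open import Data.Bool using (Bool; true; false; if_then_else_)
open import Relation.Nullary using (¬_)
open import Algebra.Bundles.Raw using (RawSemiring)

totalDeg : ∀ {n} → Vec ℕ n → ℕ
totalDeg []       = 0
totalDeg (i ∷ is) = i ℕ.+ totalDeg is

isZeroIdx : ∀ {n} → Vec ℕ n → Bool
isZeroIdx []             = true
isZeroIdx (zero ∷ is)    = isZeroIdx is
isZeroIdx (suc _ ∷ _)    = false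

module _ (R : RawSemiring 0ℓ 0ℓ) where
  open RawSemiring R

  Series : ℕ → Set
  Series n = Vec ℕ n → Carrier

  sumTo : ℕ → (ℕ → Carrier) → Carrier
  sumTo zero    g = g 0
  sumTo (suc i) g = sumTo i g + g (suc i)

  sumPairs : ∀ {n} → Vec ℕ n → (Vec ℕ n → Vec ℕ n → Carrier) → Carrier
  sumPairs []       F = F [] []
  sumPairs (i ∷ is) F =
    sumTo i (λ a → sumPairs is (λ j k → F (a ∷ j) ((i ∸ a) ∷ k)))

  addS : ∀ {n} → Series n → Series n → Series n
  addS f g v = f v + g v

  mulS : ∀ {n} → Series n → Series n → Series n
  mulS f g v = sumPairs v (λ j k → f j * g k)

  oneS : ∀ {n} → Series n
  oneS v = if isZeroIdx v then 1# else 0#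

  powS : ∀ {n} → Series n → ℕ → Series n
  powS g zero    = oneS
  powS g (suc k) = mulS g (powS g k)

  evalP : ∀ {n} → ℕ → (ℕ → Series n) → Series n → Series n
  evalP m A g v = sumTo m (λ i → mulS (A i) (powS g i) v)

  IsPolyTotDegLe : ∀ {n} → Series n → ℕ → Set
  IsPolyTotDegLe a k = ∀ v → k < totalDeg v → a v ≈ 0#

  Annihilates : ∀ {n} → Series n → ℕ → ℕ → (ℕ → Series n) → Set
  Annihilates g m k A =
      (∀ i → i ≤ m → IsPolyTotDegLe (A i) k)
    × (Σ ℕ λ i → i ≤ m × Σ (Vec ℕ _) λ v → ¬ (A i v ≈ 0#))
    × (∀ v → evalP m A g v ≈ 0#)

  AlgDegLe : ∀ {n} → Series n → ℕ → Set
  AlgDegLe {n} g d =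
    Σ ℕ λ m → Σ ℕ λ k → Σ (ℕ → Series n) λ A → m ≤ d × Annihilates g m k A

  AlgHeightLe : ∀ {n} → Series n → ℕ → Set
  AlgHeightLe {n} g h =
    Σ ℕ λ m → Σ (ℕ → Series n) λ A → Annihilates g m h A

ℚ-raw : RawSemiring 0ℓ 0ℓ
ℚ-raw = ℚ.+-*-rawSemiring

𝔽-raw : ℕ → RawSemiring 0ℓ 0ℓ
𝔽-raw p = record
  { Carrier = ℤ
  ; _≈_ = λ a b → (+ p) ℤDiv.∣ (a ℤ.- b)
  ; _+_ = ℤ._+_
  ; _*_ = ℤ._*_
  ; 0# = + 0
  ; 1# = + 1
  }

toℚSeries : ∀ {n} → (Vec ℕ n → ℤ) → (Vec ℕ n → ℚ)
toℚSeries f v = f v ℚ./ 1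

diag : ∀ {n} {A : Set} → (Vec ℕ n → A) → (Vec ℕ 1 → A)
diag {n} f v = f (replicate n (head v))

{-# OPTIONS --safe #-}
-- Let g be the reduction of f modulo p; a section of a series modulo q = p^k keeps the exponents in given residue
-- classes modulo q and divides them by q.  If A has degree at most d and B has height at most h, and both kill g,
-- then for large q the polynomial A^(q-1) B is divisible by (Y - g)^q = Y^q - g^q, so its sections kill g; they have
-- degree at most d and smaller height than A as long as the height of A exceeds h.  Hence g is killed by some P of
-- degree at most d and height at most h at once.
-- If g is a simple root of P and W = P_Y(g), comparing coefficients of (Y - g)^(q-1) in Y P_Y P^(q-1) shows that
-- W s = Q(g) for every section s of g modulo q, where Q is a section of Y P_Y P^(q-1).  These Q have degree at most d
-- and height at most h whatever q is, so they lie in a space of dimension N = (d+1)(h+1)^n.  Since Δ(g)^(p^j) is a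
-- combination of p^N-th powers of diagonals of sections modulo p^(N-j), counting unknowns and equations gives
-- polynomials c_0, …, c_N of degree at most N p^N, not all zero, with Σ_j c_j Δ(g)^(p^j) = 0.
-- If g is not a simple root of P, then P is replaced by P_Y or, when P_Y = 0, by a section of P.
module Submission where

open import Defs
open import Level using (0ℓ)
open import Algebra.Bundles using (CommutativeRing)
open import Algebra.Bundles.Raw using (RawSemiring)
open import Algebra.Structures using (IsCommutativeRing)
open import Data.Empty using (⊥-elim)
open import Data.Fin as Fin using (Fin; zero; suc; toℕ; fromℕ; inject₁; punchIn)
open import Data.Fin.Properties as Finₚ using (toℕ-fromℕ; toℕ-inject₁; toℕ<n)
open import Data.Integer as ℤ using (ℤ; +_)
import Data.Integer.Divisibility as ℤDiv
open import Data.Integer.Divisibility.Signed as Signed using (∣ᵤ⇒∣; ∣⇒∣ᵤ; ∣m∣n⇒∣m+n; ∣n⇒∣m*n; ∣m⇒∣-m; ∣m⇒∣m*n)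
import Data.Integer.Properties as ℤₚ
open import Data.Integer.Solver using (module +-*-Solver)
open import Data.List as List using (List; upTo; cartesianProductWith; length)
open import Data.List.Membership.Propositional using (_∈_; find; lose)
open import Data.List.Membership.Propositional.Properties using (∈-map⁺; ∈-cartesianProductWith⁺; ∈-cartesianProductWith⁻; ∈-upTo⁺; ∈-upTo⁻)
open import Data.List.Properties using (length-upTo; length-map; length-++)
import Data.List.Relation.Unary.All as ListAll
open import Data.List.Relation.Unary.Any using (Any; any?; here; there)
open import Data.Nat as ℕ using (ℕ; zero; suc; _≤_; _<_; z≤n; s≤s; _!; NonZero)
open import Data.Nat.Combinatorics using (_C_; nCn≡1; nCk≡nC[n∸k]; nCk≡n!/k![n-k]!; k![n∸k]!∣n!)
open import Data.Nat.DivMod using (_/_; _%_; m%n<n; m≡m%n+[m/n]*n; m/n*n≡m; m<n⇒m%n≡m; [m+kn]%n≡m%n; m*n%n≡0)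
open import Data.Nat.Divisibility as ℕDiv using (_∣_; _∤_; _∣?_; divides; ∣⇒≤; ∣1⇒≡1; m∣m*n; ∣m+n∣m⇒∣n; ∣-refl)
open import Data.Nat.Primality using (Prime; euclidsLemma; ¬prime[0]; ¬prime[1]; prime⇒nonZero; prime⇒nonTrivial)
import Data.Nat.Properties as ℕₚ
open import Data.Nat.Solver using () renaming (module +-*-Solver to ℕ-Solver)
open import Data.Product using (_,_; Σ; _×_; proj₁; proj₂)
open import Data.Rational as ℚ using (ℚ)
import Data.Rational.Properties as ℚₚ
import Data.Rational.Unnormalised as ℚᵘ
import Data.Rational.Unnormalised.Properties as ℚᵘₚ
open import Data.Sum using (_⊎_; inj₁; inj₂)
open import Data.Vec as Vec using (Vec; []; _∷_)
open import Data.Vec.Functional using (insertAt)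
open import Data.Vec.Functional.Properties using (insertAt-lookup; insertAt-punchIn)
open import Data.Vec.Properties using (zipWith-replicate)
open import Data.Vec.Relation.Unary.All as All using (All; []; _∷_)
open import Data.Vec.Relation.Unary.All.Properties using (map⁻; fromList⁻)
open import Relation.Binary.Definitions using (tri<; tri≈; tri>)
open import Relation.Binary.PropositionalEquality as ≡ using (_≡_)
open import Relation.Nullary using (yes; no; ¬_; Dec)
open import Relation.Nullary.Decidable using (¬?; map′; decidable-stable)

-- Power series and polynomials in one variable

-- The degree and height bounds come from two different polynomials. They are merged without gcds or
-- factorisation: the descent on the height takes the place of a minimal polynomial, and its result
-- is bounded independently of p. Frobenius fixes the coefficients in `𝔽`, so sections are linear
-- over q-th powers and `Δ(g)^q = Δ(g)(x^q)`. Hence the N + 1 powers `Y^(p^j)` can all be expanded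
-- with the common step `p^N`, and the conditions on the `c_j` concern the finitely many
-- coefficients of the polynomials Q rather than those of infinite series. The obstacle is that
-- equality of power series is stable under double negation but not decidable. All choices are
-- therefore made by inspecting polynomials of bounded degree and height, and vanishing at g enters
-- only as a hypothesis of implications. As it is not known which of the successive candidates has g
-- as a simple root, the relations attached to d of them are multiplied. This gives degree `d p^N`
-- and height `d N p^N`, and `d p^N ≤ p^(d+N)` is the origin of A = d + N.

module PowerSeries (R : CommutativeRing 0ℓ 0ℓ) where
  open CommutativeRing R hiding (zero)
  open import Relation.Binary.Reasoning.Setoid setoid

  open import Algebra.Solver.Ring.NaturalCoefficients.Default commutativeSemiring
    using (solve; _:=_; _:+_; _:*_)

  Seq : Set
  Seq = ℕ → Carrier

  infix 4 _≋_
  record _≋_ (f g : Seq) : Set where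
    constructor pointwise
    field at : ∀ i → f i ≈ g i
  open _≋_ public

  infixr 5 _◂_
  _◂_ : Carrier → Seq → Seq
  (a ◂ f) zero    = a
  (a ◂ f) (suc i) = f i

  tail : Seq → Seq
  tail f i = f (suc i)

  infixl 6 _⊕_
  _⊕_ : Seq → Seq → Seq
  (f ⊕ g) i = f i + g i

  0ₛ : Seq
  0ₛ _ = 0#

  const : Carrier → Seq
  const a = a ◂ 0ₛ

  infixl 7 _·_
  _·_ : Carrier → Seq → Seq
  (a · f) i = a * f i

  conv : Seq → Seq → Seq
  conv f g zero    = f 0 * g 0
  conv f g (suc n) = f 0 * g (suc n) + conv (tail f) g n

  tail-cong : ∀ {f g} → f ≋ g → tail f ≋ tail g
  tail-cong e .at i = at e (suc i)

  conv-cong : ∀ {f f′ g g′} → f ≋ f′ → g ≋ g′ → conv f g ≋ conv f′ g′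
  conv-cong e e′ .at zero    = *-cong (at e 0) (at e′ 0)
  conv-cong e e′ .at (suc n) =
    +-cong (*-cong (at e 0) (at e′ (suc n))) (at (conv-cong (tail-cong e) e′) n)

  conv-zeroˡ : ∀ {f} g → f ≋ 0ₛ → ∀ n → conv f g n ≈ 0#
  conv-zeroˡ g e zero    = trans (*-congʳ (at e 0)) (zeroˡ _)
  conv-zeroˡ g e (suc n) =
    trans (+-cong (trans (*-congʳ (at e 0)) (zeroˡ _)) (conv-zeroˡ g (tail-cong e) n))
          (+-identityˡ 0#)

  conv-·ˡ : ∀ a f g n → conv (a · f) g n ≈ a * conv f g n
  conv-·ˡ a f g zero    = *-assoc a (f 0) (g 0)
  conv-·ˡ a f g (suc n) = begin
    a * f 0 * g (suc n) + conv (a · tail f) g n    ≈⟨ +-congˡ (conv-·ˡ a (tail f) g n) ⟩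
    a * f 0 * g (suc n) + a * conv (tail f) g n    ≈⟨ lemma (f 0) (g (suc n)) (conv (tail f) g n) ⟩
    a * (f 0 * g (suc n) + conv (tail f) g n)      ∎
    where
    lemma : ∀ x y z → a * x * y + a * z ≈ a * (x * y + z)
    lemma = solve 4 (λ a x y z → a :* x :* y :+ a :* z := a :* (x :* y :+ z)) refl a

  conv-⊕ˡ : ∀ f g h n → conv (f ⊕ g) h n ≈ conv f h n + conv g h n
  conv-⊕ˡ f g h zero    = distribʳ (h 0) (f 0) (g 0)
  conv-⊕ˡ f g h (suc n) =
    trans (+-congˡ (conv-⊕ˡ (tail f) (tail g) h n))
          (lemma (f 0) (g 0) (h (suc n)) (conv (tail f) h n) (conv (tail g) h n))
    where
    lemma : ∀ a b c x y → (a + b) * c + (x + y) ≈ (a * c + x) + (b * c + y)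
    lemma = solve 5 (λ a b c x y → (a :+ b) :* c :+ (x :+ y) := (a :* c :+ x) :+ (b :* c :+ y)) refl

  conv-assoc : ∀ f g h n → conv (conv f g) h n ≈ conv f (conv g h) n
  conv-assoc f g h zero    = *-assoc (f 0) (g 0) (h 0)
  conv-assoc f g h (suc n) = begin
    f 0 * g 0 * h (suc n) + conv ((f 0 · tail g) ⊕ conv (tail f) g) h n
      ≈⟨ +-congˡ (conv-⊕ˡ (f 0 · tail g) (conv (tail f) g) h n) ⟩
    f 0 * g 0 * h (suc n) + (conv (f 0 · tail g) h n + conv (conv (tail f) g) h n)
      ≈⟨ +-congˡ (+-cong (conv-·ˡ (f 0) (tail g) h n) (conv-assoc (tail f) g h n)) ⟩
    f 0 * g 0 * h (suc n) + (f 0 * conv (tail g) h n + conv (tail f) (conv g h) n)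
      ≈⟨ lemma (f 0) (g 0) (h (suc n)) (conv (tail g) h n) (conv (tail f) (conv g h) n) ⟩
    f 0 * (g 0 * h (suc n) + conv (tail g) h n) + conv (tail f) (conv g h) n ∎
    where
    lemma : ∀ a b c x y → a * b * c + (a * x + y) ≈ a * (b * c + x) + y
    lemma = solve 5 (λ a b c x y → a :* b :* c :+ (a :* x :+ y) := a :* (b :* c :+ x) :+ y) refl

  -- `conv` peels off coefficients of its left factor; peeling the right factor instead is what
  -- makes commutativity an induction.
  conv-last : ∀ f g n → conv f g (suc n) ≈ f (suc n) * g 0 + conv f (tail g) n
  conv-last f g zero    = +-comm _ _
  conv-last f g (suc n) =
    trans (+-congˡ (conv-last (tail f) g n))
          (lemma (f 0 * g (suc (suc n))) (f (suc (suc n)) * g 0) (conv (tail f) (tail g) n))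
    where
    lemma : ∀ a b c → a + (b + c) ≈ b + (a + c)
    lemma = solve 3 (λ a b c → a :+ (b :+ c) := b :+ (a :+ c)) refl

  conv-comm : ∀ f g n → conv f g n ≈ conv g f n
  conv-comm f g zero    = *-comm (f 0) (g 0)
  conv-comm f g (suc n) =
    trans (+-cong (*-comm _ _) (conv-comm (tail f) g n)) (sym (conv-last g f n))

  conv-constˡ : ∀ a f n → conv (const a) f n ≈ a * f n
  conv-constˡ a f zero    = refl
  conv-constˡ a f (suc n) =
    trans (+-congˡ (conv-zeroˡ f (pointwise (λ _ → refl)) n)) (+-identityʳ _)

  seqRing : CommutativeRing 0ℓ 0ℓ
  seqRing = record
    { Carrier = Seq
    ; _≈_ = _≋_
    ; _+_ = _⊕_
    ; _*_ = conv
    ; -_ = λ f i → - f i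
    ; 0# = 0ₛ
    ; 1# = const 1#
    ; isCommutativeRing = record
      { isRing = record
        { +-isAbelianGroup = record
          { isGroup = record
            { isMonoid = record
              { isSemigroup = record
                { isMagma = record
                  { isEquivalence = record
                    { refl = pointwise (λ _ → refl)
                    ; sym = λ e → pointwise (λ i → sym (at e i))
                    ; trans = λ e e′ → pointwise (λ i → trans (at e i) (at e′ i))
                    }
                  ; ∙-cong = λ e e′ → pointwise (λ i → +-cong (at e i) (at e′ i))
                  }
                ; assoc = λ f g h → pointwise (λ i → +-assoc _ _ _)
                }
              ; identity = (λ f → pointwise (λ i → +-identityˡ _)) , (λ f → pointwise (λ i → +-identityʳ _))
              }
            ; inverse = (λ f → pointwise (λ i → -‿inverseˡ _)) , (λ f → pointwise (λ i → -‿inverseʳ _))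
            ; ⁻¹-cong = λ e → pointwise (λ i → -‿cong (at e i))
            }
          ; comm = λ f g → pointwise (λ i → +-comm _ _)
          }
        ; *-cong = conv-cong
        ; *-assoc = λ f g h → pointwise (conv-assoc f g h)
        ; *-identity = (λ f → pointwise (identityˡ f))
                     , (λ f → pointwise (λ n → trans (conv-comm f (const 1#) n) (identityˡ f n)))
        ; distrib = (λ f g h → pointwise (λ n → distribˡ′ f g h n)) , (λ f g h → pointwise (conv-⊕ˡ g h f))
        }
      ; *-comm = λ f g → pointwise (conv-comm f g)
      }
    }
    where
    identityˡ : ∀ f n → conv (const 1#) f n ≈ f n
    identityˡ f n = trans (conv-constˡ 1# f n) (*-identityˡ (f n))

    distribˡ′ : ∀ f g h n → conv f (g ⊕ h) n ≈ conv f g n + conv f h n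
    distribˡ′ f g h n = begin
      conv f (g ⊕ h) n         ≈⟨ conv-comm f (g ⊕ h) n ⟩
      conv (g ⊕ h) f n         ≈⟨ conv-⊕ˡ g h f n ⟩
      conv g f n + conv h f n  ≈⟨ +-cong (conv-comm g f n) (conv-comm h f n) ⟩
      conv f g n + conv f h n  ∎

-- `index q r i` is r + i * q, arranged so that successive indices differ definitionally by q.
index : ℕ → ℕ → ℕ → ℕ
index q r zero    = r
index q r (suc i) = q ℕ.+ index q r i

index≡ : ∀ q r i → index q r i ≡ r ℕ.+ i ℕ.* q
index≡ q r zero    = ≡.sym (ℕₚ.+-identityʳ r)
index≡ q r (suc i) = ≡.trans (≡.cong (q ℕ.+_) (index≡ q r i)) (lemma q r (i ℕ.* q))
  where
  lemma : ∀ q r s → q ℕ.+ (r ℕ.+ s) ≡ r ℕ.+ (q ℕ.+ s)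
  lemma q r s = ≡.trans (≡.sym (ℕₚ.+-assoc q r s)) (≡.trans (≡.cong (ℕ._+ s) (ℕₚ.+-comm q r)) (ℕₚ.+-assoc r q s))

index-≥ : ∀ q r i → i ℕ.* q ≤ index q r i
index-≥ q r i = ≡.subst (i ℕ.* q ≤_) (≡.sym (index≡ q r i)) (ℕₚ.m≤n+m (i ℕ.* q) r)

-- Polynomials: evaluation, division by a linear factor, derivative

module Polynomials (R : CommutativeRing 0ℓ 0ℓ) where
  open CommutativeRing R hiding (zero)
  open PowerSeries R public
  open import Relation.Binary.Reasoning.Setoid setoid
  open import Algebra.Properties.Semiring.Exp semiring using (_^_; ^-congˡ)
  open import Algebra.Properties.Semiring.Mult semiring using () renaming (_×_ to _×ᵣ_)
  open import Algebra.Properties.Semiring.Exp (CommutativeRing.semiring seqRing) public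
    using () renaming (_^_ to _^ₛ_; ^-congˡ to ^ₛ-congˡ; ^-congʳ to ^ₛ-congʳ; ^-homo-* to ^ₛ-homo-*)
  open import Algebra.Solver.Ring.NaturalCoefficients.Default commutativeSemiring
    using (solve; _:=_; _:+_; _:*_)
  module 𝕊 = CommutativeRing seqRing

  infixr 2 _≋⟨_⟩_
  infix 3 _≋∎

  _≋⟨_⟩_ : ∀ F {G H} → F ≋ G → G ≋ H → F ≋ H
  F ≋⟨ e ⟩ e′ = 𝕊.trans e e′

  _≋∎ : ∀ F → F ≋ F
  F ≋∎ = 𝕊.refl

  DegLe : ℕ → Seq → Set
  DegLe m F = ∀ i → m < i → F i ≈ 0#

  degLe-mono : ∀ {m n F} → m ≤ n → DegLe m F → DegLe n F
  degLe-mono m≤n deg i n<i = deg i (ℕₚ.≤-<-trans m≤n n<i)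

  degLe-tail : ∀ {m F} → DegLe (suc m) F → DegLe m (tail F)
  degLe-tail deg i m<i = deg (suc i) (s≤s m<i)

  degLe-const : ∀ a → DegLe 0 (const a)
  degLe-const a (suc i) _ = refl

  degLe-⊕ : ∀ {m F G} → DegLe m F → DegLe m G → DegLe m (F ⊕ G)
  degLe-⊕ degF degG i m<i = trans (+-cong (degF i m<i) (degG i m<i)) (+-identityˡ 0#)

  degLe-conv : ∀ {a b F G} → DegLe a F → DegLe b G → DegLe (a ℕ.+ b) (conv F G)
  degLe-conv {zero} {b} {F} {G} degF degG (suc n) b<n =
    trans (+-cong (trans (*-congˡ (degG (suc n) b<n)) (zeroʳ _))
                  (conv-zeroˡ G (pointwise (λ i → degF (suc i) (s≤s z≤n))) n))
          (+-identityˡ 0#)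
  degLe-conv {suc a} {b} {F} {G} degF degG (suc n) (s≤s a+b<n) =
    trans (+-cong (trans (*-congˡ (degG (suc n) (s≤s (ℕₚ.≤-trans (ℕₚ.m≤n+m b a) (ℕₚ.<⇒≤ a+b<n)))))
                         (zeroʳ _))
                  (degLe-conv (degLe-tail degF) degG n a+b<n))
          (+-identityˡ 0#)

  degLe-^ : ∀ {a F} k → DegLe a F → DegLe (k ℕ.* a) (F ^ₛ k)
  degLe-^ zero    degF = degLe-const 1#
  degLe-^ (suc k) degF = degLe-conv degF (degLe-^ k degF)

  X : Seq
  X = 0# ◂ const 1#

  degLe-X : DegLe 1 X
  degLe-X (suc zero)    (s≤s ())
  degLe-X (suc (suc i)) _ = refl

  X-conv : ∀ G → conv X G ≋ (0# ◂ G)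
  X-conv G .at zero    = zeroˡ _
  X-conv G .at (suc n) = trans (+-cong (zeroˡ _) (trans (conv-constˡ 1# G n) (*-identityˡ _))) (+-identityˡ _)

  ◂-tail : ∀ F → F ≋ const (F 0) ⊕ conv X (tail F)
  ◂-tail F .at zero    = sym (trans (+-congˡ (at (X-conv (tail F)) 0)) (+-identityʳ _))
  ◂-tail F .at (suc i) = sym (trans (+-congˡ (at (X-conv (tail F)) (suc i))) (+-identityˡ _))

  X^-conv-≥ : ∀ k G n → conv (X ^ₛ k) G (k ℕ.+ n) ≈ G n
  X^-conv-≥ zero    G n = at (𝕊.*-identityˡ G) n
  X^-conv-≥ (suc k) G n =
    trans (at (𝕊.trans (𝕊.*-assoc X (X ^ₛ k) G) (X-conv _)) (suc (k ℕ.+ n))) (X^-conv-≥ k G n)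

  X^-conv-< : ∀ k G n → n < k → conv (X ^ₛ k) G n ≈ 0#
  X^-conv-< (suc k) G zero    _         = at (𝕊.trans (𝕊.*-assoc X (X ^ₛ k) G) (X-conv _)) 0
  X^-conv-< (suc k) G (suc n) (s≤s n<k) =
    trans (at (𝕊.trans (𝕊.*-assoc X (X ^ₛ k) G) (X-conv _)) (suc n)) (X^-conv-< k G n n<k)

  const-⊕ : ∀ a b → const (a + b) ≋ const a ⊕ const b
  const-⊕ a b .at zero    = refl
  const-⊕ a b .at (suc i) = sym (+-identityˡ 0#)

  const-conv : ∀ a b → conv (const a) (const b) ≋ const (a * b)
  const-conv a b .at zero    = refl
  const-conv a b .at (suc i) = trans (conv-constˡ a (const b) (suc i)) (zeroʳ a)

  const-cong : ∀ {a b} → a ≈ b → const a ≋ const b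
  const-cong e .at zero    = e
  const-cong e .at (suc i) = refl

  const-^ : ∀ a k → const a ^ₛ k ≋ const (a ^ k)
  const-^ a zero    = 𝕊.refl
  const-^ a (suc k) = 𝕊.trans (conv-cong 𝕊.refl (const-^ a k)) (const-conv a (a ^ k))

  -- Horner's scheme, cut off after the coefficient m. A polynomial is a bare sequence, so the
  -- cut-off has to be supplied; by `ev-extend` every cut-off above the degree gives the same value.
  ev : ℕ → Seq → Carrier → Carrier
  ev zero    F g = F 0
  ev (suc m) F g = F 0 + g * ev m (tail F) g

  ev-cong′ : ∀ m {F G g h} → (∀ i → i ≤ m → F i ≈ G i) → g ≈ h → ev m F g ≈ ev m G h
  ev-cong′ zero    F≈G g≈h = F≈G 0 z≤n
  ev-cong′ (suc m) F≈G g≈h =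
    +-cong (F≈G 0 z≤n) (*-cong g≈h (ev-cong′ m (λ i i≤m → F≈G (suc i) (s≤s i≤m)) g≈h))

  ev-cong : ∀ m {F G} g → F ≋ G → ev m F g ≈ ev m G g
  ev-cong m g e = ev-cong′ m (λ i _ → at e i) refl

  ev-zero : ∀ m {F} g → (∀ i → i ≤ m → F i ≈ 0#) → ev m F g ≈ 0#
  ev-zero zero    g F≈0 = F≈0 0 z≤n
  ev-zero (suc m) g F≈0 =
    trans (+-cong (F≈0 0 z≤n) (trans (*-congˡ (ev-zero m g (λ i i≤m → F≈0 (suc i) (s≤s i≤m)))) (zeroʳ g)))
          (+-identityˡ 0#)

  ev-⊕ : ∀ m F G g → ev m (F ⊕ G) g ≈ ev m F g + ev m G g
  ev-⊕ zero    F G g = refl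
  ev-⊕ (suc m) F G g =
    trans (+-congˡ (*-congˡ (ev-⊕ m (tail F) (tail G) g)))
          (lemma (F 0) (G 0) g (ev m (tail F) g) (ev m (tail G) g))
    where
    lemma : ∀ a b g x y → a + b + g * (x + y) ≈ a + g * x + (b + g * y)
    lemma = solve 5 (λ a b g x y → a :+ b :+ g :* (x :+ y) := a :+ g :* x :+ (b :+ g :* y)) refl

  ev-· : ∀ m a F g → ev m (a · F) g ≈ a * ev m F g
  ev-· zero    a F g = refl
  ev-· (suc m) a F g =
    trans (+-congˡ (*-congˡ (ev-· m a (tail F) g))) (lemma a (F 0) g (ev m (tail F) g))
    where
    lemma : ∀ a b g x → a * b + g * (a * x) ≈ a * (b + g * x)
    lemma = solve 4 (λ a b g x → a :* b :+ g :* (a :* x) := a :* (b :+ g :* x)) refl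

  ev-top : ∀ m F g → F (suc m) ≈ 0# → ev (suc m) F g ≈ ev m F g
  ev-top zero    F g F≈0 = trans (+-congˡ (trans (*-congˡ F≈0) (zeroʳ g))) (+-identityʳ _)
  ev-top (suc m) F g F≈0 = +-congˡ (*-congˡ (ev-top m (tail F) g F≈0))

  ev-last : ∀ m F g → ev (suc m) F g ≈ ev m F g + F (suc m) * g ^ suc m
  ev-last zero    F g = +-congˡ (trans (*-comm g (F 1)) (*-congˡ (sym (*-identityʳ g))))
  ev-last (suc m) F g = trans (+-congˡ (*-congˡ (ev-last m (tail F) g)))
      (lemma (F 0) g (ev m (tail F) g) (F (suc (suc m))) (g ^ suc m))
    where
    lemma : ∀ a g x b y → a + g * (x + b * y) ≈ a + g * x + b * (g * y)
    lemma = solve 5 (λ a g x b y → a :+ g :* (x :+ b :* y) := a :+ g :* x :+ b :* (g :* y)) refl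

  ev-extend : ∀ {m} n F g → DegLe m F → ev (n ℕ.+ m) F g ≈ ev m F g
  ev-extend zero    F g degF = refl
  ev-extend {m} (suc n) F g degF =
    trans (ev-top (n ℕ.+ m) F g (degF _ (s≤s (ℕₚ.m≤n+m m n)))) (ev-extend n F g degF)

  ev-extend-≤ : ∀ {m n} F g → DegLe m F → m ≤ n → ev n F g ≈ ev m F g
  ev-extend-≤ {m} {n} F g degF m≤n =
    trans (reflexive (≡.cong (λ k → ev k F g) (≡.sym (ℕₚ.m∸n+n≡m m≤n)))) (ev-extend (n ℕ.∸ m) F g degF)

  ev-const : ∀ m a g → ev m (const a) g ≈ a
  ev-const m a g = ev-extend-≤ {n = m} (const a) g (degLe-const a) z≤n

  ev-conv : ∀ {a b} F G g → DegLe a F → DegLe b G → ev (a ℕ.+ b) (conv F G) g ≈ ev a F g * ev b G g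
  ev-conv {zero} {b} F G g degF degG = trans (ev-cong b g (pointwise lemma)) (ev-· b (F 0) G g)
    where
    lemma : ∀ i → conv F G i ≈ F 0 * G i
    lemma zero    = refl
    lemma (suc i) =
      trans (+-congˡ (conv-zeroˡ G (pointwise (λ j → degF (suc j) (s≤s z≤n))) i)) (+-identityʳ _)
  ev-conv {suc a} {b} F G g degF degG = begin
    F 0 * G 0 + g * ev (a ℕ.+ b) ((F 0 · tail G) ⊕ conv (tail F) G) g
      ≈⟨ +-congˡ (*-congˡ (trans (ev-⊕ (a ℕ.+ b) (F 0 · tail G) (conv (tail F) G) g)
           (+-cong (ev-· (a ℕ.+ b) (F 0) (tail G) g) (ev-conv (tail F) G g (degLe-tail degF) degG)))) ⟩
    F 0 * G 0 + g * (F 0 * ev (a ℕ.+ b) (tail G) g + ev a (tail F) g * ev b G g)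
      ≈⟨ lemma (F 0) (G 0) g (ev (a ℕ.+ b) (tail G) g) (ev a (tail F) g * ev b G g) ⟩
    F 0 * ev (suc a ℕ.+ b) G g + g * (ev a (tail F) g * ev b G g)
      ≈⟨ +-congʳ (*-congˡ (ev-extend (suc a) G g degG)) ⟩
    F 0 * ev b G g + g * (ev a (tail F) g * ev b G g)
      ≈⟨ lemma′ (F 0) g (ev a (tail F) g) (ev b G g) ⟩
    (F 0 + g * ev a (tail F) g) * ev b G g ∎
    where
    lemma : ∀ f h g x y → f * h + g * (f * x + y) ≈ f * (h + g * x) + g * y
    lemma = solve 5 (λ f h g x y → f :* h :+ g :* (f :* x :+ y) := f :* (h :+ g :* x) :+ g :* y) refl
    lemma′ : ∀ f g x y → f * y + g * (x * y) ≈ (f + g * x) * y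
    lemma′ = solve 4 (λ f g x y → f :* y :+ g :* (x :* y) := (f :+ g :* x) :* y) refl

  ev-^ : ∀ {a} F g k → DegLe a F → ev (k ℕ.* a) (F ^ₛ k) g ≈ ev a F g ^ k
  ev-^ F g zero    degF = refl
  ev-^ F g (suc k) degF =
    trans (ev-conv F (F ^ₛ k) g degF (degLe-^ k degF)) (*-congˡ (ev-^ F g k degF))

  ev-X : ∀ g → ev 1 X g ≈ g
  ev-X g = trans (+-identityˡ _) (*-identityʳ g)

  -- Synthetic division by X - g.
  quot : ℕ → Seq → Carrier → Seq
  quot zero    F g = 0ₛ
  quot (suc m) F g = ev m (tail F) g ◂ quot m (tail F) g

  degLe-quot : ∀ m F g → DegLe (ℕ.pred m) (quot m F g)
  degLe-quot zero          F g i       _         = refl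
  degLe-quot (suc zero)    F g (suc i) _         = refl
  degLe-quot (suc (suc m)) F g (suc i) (s≤s m<i) = degLe-quot (suc m) (tail F) g i m<i

  X-_ : Carrier → Seq
  X- g = X ⊕ const (- g)

  -- Division with remainder in a form free of subtraction, which follows the recursion of `quot`
  -- coefficient by coefficient.
  quot-spec⁺ : ∀ m F g → DegLe m F → F ⊕ (g · quot m F g) ≋ const (ev m F g) ⊕ (0# ◂ quot m F g)
  quot-spec⁺ zero    F g degF .at zero    = trans (+-congˡ (zeroʳ g)) refl
  quot-spec⁺ zero    F g degF .at (suc i) = +-cong (degF (suc i) (s≤s z≤n)) (zeroʳ g)
  quot-spec⁺ (suc m) F g degF .at zero    = sym (+-identityʳ _)
  quot-spec⁺ (suc m) F g degF .at (suc i) =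
    trans (at (quot-spec⁺ m (tail F) g (degLe-tail degF)) i) (lemma i)
    where
    lemma : ∀ i → (const (ev m (tail F) g) ⊕ (0# ◂ quot m (tail F) g)) i ≈ 0# + (ev m (tail F) g ◂ quot m (tail F) g) i
    lemma zero    = +-comm _ _
    lemma (suc i) = refl

  quot-spec : ∀ m F g → DegLe m F → F ≋ const (ev m F g) ⊕ conv (X- g) (quot m F g)
  quot-spec m F g degF .at i = begin
    F i                                                ≈⟨ +-identityʳ _ ⟨
    F i + 0#                                           ≈⟨ +-congˡ (trans (sym (distribʳ _ g (- g))) (trans (*-congʳ (-‿inverseʳ g)) (zeroˡ _))) ⟨
    F i + (g * Q i + - g * Q i)                        ≈⟨ +-assoc _ _ _ ⟨
    F i + g * Q i + - g * Q i                          ≈⟨ +-congʳ (at (quot-spec⁺ m F g degF) i) ⟩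
    const (ev m F g) i + (0# ◂ Q) i + - g * Q i        ≈⟨ +-assoc _ _ _ ⟩
    const (ev m F g) i + ((0# ◂ Q) i + - g * Q i)      ≈⟨ +-congˡ (trans (conv-⊕ˡ X (const (- g)) Q i) (+-cong (at (X-conv Q) i) (conv-constˡ (- g) Q i))) ⟨
    const (ev m F g) i + conv (X- g) Q i               ∎
    where Q = quot m F g

  -- From F = F(0) + X T the product rule gives F′ = T + X T′. This recursion on the tail runs in
  -- parallel with that of `quot`.
  deriv : Seq → Seq
  deriv F zero    = F 1
  deriv F (suc i) = F (suc (suc i)) + deriv (tail F) i

  deriv-coeff : ∀ F i → deriv F i ≈ suc i ×ᵣ F (suc i)
  deriv-coeff F zero    = sym (+-identityʳ _)
  deriv-coeff F (suc i) = +-congˡ (deriv-coeff (tail F) i)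

  degLe-deriv : ∀ {m F} → DegLe (suc m) F → DegLe m (deriv F)
  degLe-deriv {m} {F} degF i m<i = trans (deriv-coeff F i) (lemma (suc i))
    where
    lemma : ∀ k → k ×ᵣ F (suc i) ≈ 0#
    lemma zero    = refl
    lemma (suc k) = trans (+-cong (degF (suc i) (s≤s m<i)) (lemma k)) (+-identityˡ 0#)

  -- Differentiating F = F(g) + (X - g) S and putting X = g gives S(g) = F′(g).
  ev-quot : ∀ m F g → DegLe (suc m) F → ev m (quot (suc m) F g) g ≈ ev m (deriv F) g
  ev-quot zero    F g degF = refl
  ev-quot (suc m) F g degF = begin
    ev (suc m) (tail F) g + g * ev m (quot (suc m) (tail F) g) g
      ≈⟨ +-congˡ (*-congˡ (ev-quot m (tail F) g (degLe-tail degF))) ⟩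
    F 1 + g * ev m (tail (tail F)) g + g * ev m (deriv (tail F)) g
      ≈⟨ lemma (F 1) g _ _ ⟩
    F 1 + g * (ev m (tail (tail F)) g + ev m (deriv (tail F)) g)
      ≈⟨ +-congˡ (*-congˡ (ev-⊕ m (tail (tail F)) (deriv (tail F)) g)) ⟨
    F 1 + g * ev m (tail (deriv F)) g ∎
    where
    lemma : ∀ a g x y → a + g * x + g * y ≈ a + g * (x + y)
    lemma = solve 4 (λ a g x y → a :+ g :* x :+ g :* y := a :+ g :* (x :+ y)) refl

  ev-0◂ : ∀ m F g → F m ≈ 0# → ev m (0# ◂ F) g ≈ g * ev m F g
  ev-0◂ zero    F g F≈0 = sym (trans (*-congˡ F≈0) (zeroʳ g))
  ev-0◂ (suc m) F g F≈0 = trans (+-identityˡ _) (*-congˡ (sym (ev-top m F g F≈0)))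

  ev-drop : ∀ k n F g → (∀ j → j < k → F j ≈ 0#) → ev (k ℕ.+ n) F g ≈ g ^ k * ev n (λ j → F (k ℕ.+ j)) g
  ev-drop zero    n F g F≈0 = sym (*-identityˡ _)
  ev-drop (suc k) n F g F≈0 =
    trans (+-cong (F≈0 0 (s≤s z≤n)) (*-congˡ (ev-drop k n (tail F) g (λ j j<k → F≈0 (suc j) (s≤s j<k)))))
          (trans (+-identityˡ _) (sym (*-assoc g (g ^ k) _)))

  -- F is a polynomial in X^q. The r further coefficients after the last multiple of q are zero, so
  -- any cut-off with r < q is allowed.
  ev-sparse : ∀ {q r} → r < q → ∀ b F g → (∀ j → q ∤ j → F j ≈ 0#) →
              ev (index q r b) F g ≈ ev b (λ i → F (index q 0 i)) (g ^ q)
  ev-sparse {q} {r} r<q zero F g F≈0 = trans (ev-cong′ r constant refl) (ev-const r (F 0) g)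
    where
    constant : ∀ i → i ≤ r → F i ≈ const (F 0) i
    constant zero    i≤r = refl
    constant (suc i) i≤r = F≈0 (suc i) (λ q∣i → ℕₚ.<⇒≱ (ℕₚ.≤-<-trans i≤r r<q) (∣⇒≤ q∣i))
  ev-sparse {suc q} {r} r<q (suc b) F g F≈0 =
    +-congˡ (trans (*-congˡ (ev-drop q (index (suc q) r b) (tail F) g
                      (λ j j<q → F≈0 (suc j) (λ q∣j → ℕₚ.<⇒≱ (s≤s j<q) (∣⇒≤ q∣j)))))
            (trans (sym (*-assoc g (g ^ q) _))
                   (*-congˡ (ev-sparse r<q b (λ j → F (suc q ℕ.+ j)) g
                      (λ j q∤j → F≈0 (suc q ℕ.+ j) (λ q∣ → q∤j (∣m+n∣m⇒∣n q∣ ∣-refl)))))))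

-- Positive characteristic

module _ {p : ℕ} (p-prime : Prime p) where

  prime∤! : ∀ {k} → k < p → ¬ p ∣ k !
  prime∤! {zero}  k<p p∣1 = ¬prime[1] (≡.subst Prime (∣1⇒≡1 p∣1) p-prime)
  prime∤! {suc k} k<p p∣k! with euclidsLemma (suc k) (k !) p-prime p∣k!
  ... | inj₁ p∣k = ℕₚ.<⇒≱ k<p (∣⇒≤ p∣k)
  ... | inj₂ p∣  = prime∤! (ℕₚ.<-trans (ℕₚ.n<1+n k) k<p) p∣

  prime∣C : ∀ {k} → 0 < k → k < p → p ∣ p C k
  prime∣C {suc k′} 0<k k<p with euclidsLemma (p C k) (k ! ℕ.* (p ℕ.∸ k) !) p-prime p∣C*
    where
    k : ℕ
    k = suc k′
    instance
      !≢0 : NonZero (k ! ℕ.* (p ℕ.∸ k) !)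
      !≢0 = ℕₚ.m*n≢0 (k !) ((p ℕ.∸ k) !) {{ℕₚ._!≢0 k}} {{ℕₚ._!≢0 (p ℕ.∸ k)}}
    p∣p! : ∀ {q} → 0 < q → q ∣ q !
    p∣p! {suc q} _ = m∣m*n (q !)
    p∣C* : p ∣ (p C k) ℕ.* (k ! ℕ.* (p ℕ.∸ k) !)
    p∣C* = ≡.subst (p ∣_)
      (≡.sym (≡.trans (≡.cong (ℕ._* (k ! ℕ.* (p ℕ.∸ k) !)) (nCk≡n!/k![n-k]! (ℕₚ.<⇒≤ k<p)))
                      (m/n*n≡m (k![n∸k]!∣n! (ℕₚ.<⇒≤ k<p)))))
      (p∣p! (ℕₚ.≤-<-trans z≤n k<p))
  ... | inj₁ p∣C = p∣C
  ... | inj₂ p∣! with euclidsLemma (suc k′ !) ((p ℕ.∸ suc k′) !) p-prime p∣!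
  ...   | inj₁ p∣k! = ⊥-elim (prime∤! k<p p∣k!)
  ...   | inj₂ p∣k! = ⊥-elim (prime∤! (ℕₚ.∸-monoʳ-< {p} {suc k′} {0} (s≤s z≤n) (ℕₚ.<⇒≤ k<p)) p∣k!)

  p>0 : 0 < p
  p>0 = ℕ.>-nonZero⁻¹ p {{prime⇒nonZero p-prime}}

module _ (R : CommutativeRing 0ℓ 0ℓ) where
  open CommutativeRing R hiding (zero)
  open import Algebra.Properties.Semiring.Mult semiring using () renaming (_×_ to _×ᵣ_)

  HasChar : ℕ → Set
  HasChar p = ∀ x → p ×ᵣ x ≈ 0#

module Frobenius (R : CommutativeRing 0ℓ 0ℓ) {p : ℕ} (p-prime : Prime p) (char : HasChar R p) where
  open CommutativeRing R hiding (zero)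
  open import Relation.Binary.Reasoning.Setoid setoid
  open import Algebra.Properties.Semiring.Mult semiring using (×-congˡ; ×-assocˡ) renaming (_×_ to _×ᵣ_)
  open import Algebra.Properties.Semiring.Exp semiring using (_^_; ^-congˡ; ^-congʳ; ^-assocʳ)
  open import Algebra.Properties.Semiring.Sum semiring using (sum; sum-init-last; sum-cong-≋; sum-replicate-zero)
  open import Algebra.Properties.CommutativeSemiring.Binomial commutativeSemiring using (theorem; binomialTerm)

  multiple×≈0 : ∀ {c} z → p ∣ c → c ×ᵣ z ≈ 0#
  multiple×≈0 z (divides k ≡.refl) =
    trans (×-congˡ (ℕₚ.*-comm k p)) (trans (sym (×-assocˡ z p k)) (char (k ×ᵣ z)))

  nC0≡1 : ∀ n → n C 0 ≡ 1
  nC0≡1 n = ≡.trans (nCk≡nC[n∸k] {0} {n} z≤n) (nCn≡1 n)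

  frobenius : ∀ x y → (x + y) ^ p ≈ x ^ p + y ^ p
  frobenius x y = lemma p ≡.refl
    where
    term : ℕ → ℕ → Carrier
    term n j = (n C j) ×ᵣ (x ^ j * y ^ (n ℕ.∸ j))
    term-top : ∀ n → term n n ≈ x ^ n
    term-top n = trans (×-congˡ (nCn≡1 n)) (trans (+-identityʳ _)
      (trans (*-congˡ (^-congʳ y (ℕₚ.n∸n≡0 n))) (*-identityʳ _)))
    -- The exponent becomes a variable so that it can be matched as a successor, which separates the
    -- two extreme binomial terms from the middle ones.
    lemma : ∀ n → n ≡ p → (x + y) ^ n ≈ x ^ n + y ^ n
    lemma zero    n≡p = ⊥-elim (¬prime[0] (≡.subst Prime (≡.sym n≡p) p-prime))
    lemma n@(suc m) n≡p = begin
      (x + y) ^ n                                          ≈⟨ theorem n x y ⟩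
      sum t                                                ≈⟨ sum-init-last t ⟩
      t zero + sum (λ k → t (inject₁ (suc k))) + t (fromℕ n) ≈⟨ +-congʳ (+-congˡ (trans (sum-cong-≋ middle) (sum-replicate-zero m))) ⟩
      t zero + 0# + t (fromℕ n)                            ≈⟨ +-cong (trans (+-identityʳ _) first) last ⟩
      y ^ n + x ^ n                                        ≈⟨ +-comm _ _ ⟩
      x ^ n + y ^ n                                        ∎
      where
      t : Fin (suc n) → Carrier
      t = binomialTerm x y n
      first : t zero ≈ y ^ n
      first = trans (×-congˡ (nC0≡1 n)) (trans (+-identityʳ _) (*-identityˡ _))
      last : t (fromℕ n) ≈ x ^ n
      last = trans (reflexive (≡.cong (term n) (toℕ-fromℕ n))) (term-top n)
      middle : ∀ k → t (inject₁ (suc k)) ≈ 0#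
      middle k = trans (reflexive (≡.cong (term n) (≡.cong suc (toℕ-inject₁ k))))
        (multiple×≈0 _ (≡.subst (λ n′ → p ∣ (n′ C suc (toℕ k))) (≡.sym n≡p)
          (prime∣C p-prime (s≤s z≤n) (≡.subst (suc (toℕ k) <_) n≡p (s≤s (toℕ<n k))))))

  frobenius-^ : ∀ k x y → (x + y) ^ (p ℕ.^ k) ≈ x ^ (p ℕ.^ k) + y ^ (p ℕ.^ k)
  frobenius-^ zero    x y = distribʳ 1# x y
  frobenius-^ (suc k) x y = begin
    (x + y) ^ (p ℕ.* p ℕ.^ k)                       ≈⟨ ^-assocʳ (x + y) p (p ℕ.^ k) ⟨
    ((x + y) ^ p) ^ (p ℕ.^ k)                       ≈⟨ ^-congˡ (p ℕ.^ k) (frobenius x y) ⟩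
    (x ^ p + y ^ p) ^ (p ℕ.^ k)                     ≈⟨ frobenius-^ k (x ^ p) (y ^ p) ⟩
    (x ^ p) ^ (p ℕ.^ k) + (y ^ p) ^ (p ℕ.^ k)       ≈⟨ +-cong (^-assocʳ x p (p ℕ.^ k)) (^-assocʳ y p (p ℕ.^ k)) ⟩
    x ^ (p ℕ.* p ℕ.^ k) + y ^ (p ℕ.* p ℕ.^ k)       ∎

module PositiveCharacteristic (R : CommutativeRing 0ℓ 0ℓ) {p : ℕ} (p-prime : Prime p) (char : HasChar R p) where
  open CommutativeRing R hiding (zero)
  open Polynomials R
  open Frobenius R p-prime char public
  open import Relation.Binary.Reasoning.Setoid setoid
  open import Algebra.Properties.Semiring.Mult semiring using () renaming (_×_ to _×ᵣ_)
  open import Algebra.Properties.Semiring.Exp semiring using (_^_; ^-congˡ; ^-congʳ)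
  open import Algebra.Properties.Semiring.Mult 𝕊.semiring using () renaming (_×_ to _×ₛ_)
  open import Algebra.Properties.CommutativeSemiring.Exp 𝕊.commutativeSemiring using ()
    renaming (^-distrib-* to ^ₛ-distrib-*)
  open import Algebra.Properties.AbelianGroup +-abelianGroup using (identityˡ-unique)
  open import Algebra.Solver.Ring.NaturalCoefficients.Default 𝕊.commutativeSemiring
    using (_:=_; _:*_) renaming (solve to solveₛ)

  charₛ : HasChar seqRing p
  charₛ F .at i = trans (reflexive (lemma p)) (char (F i))
    where
    lemma : ∀ n → (n ×ₛ F) i ≡ n ×ᵣ F i
    lemma zero    = ≡.refl
    lemma (suc n) = ≡.cong (λ x → F i + x) (lemma n)

  open Frobenius seqRing p-prime charₛ using () renaming (frobenius-^ to frobeniusₛ-^)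

  const-pos : ∀ a {j} → 0 < j → const a j ≈ 0#
  const-pos a {suc j} _ = refl

  module Power (k : ℕ) where
    q : ℕ
    q = p ℕ.^ k

    q>0 : 0 < q
    q>0 = ℕₚ.m^n>0 p {{ℕ.>-nonZero (p>0 p-prime)}} k

    -- Frobenius applied to F = F(0) + X T. The shift by X^q is the step of `index q r`, so
    -- coefficients of q-th powers are found by induction along that index.
    ^q-tail : ∀ F → F ^ₛ q ≋ const (F 0 ^ q) ⊕ conv (X ^ₛ q) (tail F ^ₛ q)
    ^q-tail F =
      𝕊.trans (^ₛ-congˡ q (◂-tail F))
      (𝕊.trans (frobeniusₛ-^ k (const (F 0)) (conv X (tail F)))
               (𝕊.+-cong (const-^ (F 0) q) (^ₛ-distrib-* X (tail F) q)))

    ^q-coeff-index : ∀ F i → (F ^ₛ q) (index q 0 i) ≈ F i ^ q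
    ^q-coeff-index F zero    = trans (at (^q-tail F) 0)
      (trans (+-congˡ (X^-conv-< q (tail F ^ₛ q) 0 q>0)) (+-identityʳ _))
    ^q-coeff-index F (suc i) = trans (at (^q-tail F) (q ℕ.+ index q 0 i))
      (trans (+-cong (const-pos _ (ℕₚ.≤-trans q>0 (ℕₚ.m≤m+n q _))) (X^-conv-≥ q _ (index q 0 i)))
      (trans (+-identityˡ _) (^q-coeff-index (tail F) i)))

    ^q-coeff-off : ∀ F i {r} → 0 < r → r < q → (F ^ₛ q) (index q r i) ≈ 0#
    ^q-coeff-off F zero    {r} 0<r r<q = trans (at (^q-tail F) r)
      (trans (+-cong (const-pos _ 0<r) (X^-conv-< q _ r r<q)) (+-identityˡ _))
    ^q-coeff-off F (suc i) {r} 0<r r<q = trans (at (^q-tail F) (q ℕ.+ index q r i))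
      (trans (+-cong (const-pos _ (ℕₚ.≤-trans q>0 (ℕₚ.m≤m+n q _))) (X^-conv-≥ q _ (index q r i)))
      (trans (+-identityˡ _) (^q-coeff-off (tail F) i 0<r r<q)))

    conv-^q-expand : ∀ F G n → conv F (G ^ₛ q) n ≈ F n * G 0 ^ q + conv (X ^ₛ q) (conv F (tail G ^ₛ q)) n
    conv-^q-expand F G n = begin
      conv F (G ^ₛ q) n                                            ≈⟨ at (𝕊.*-congˡ {F} (^q-tail G)) n ⟩
      conv F (const (G 0 ^ q) ⊕ conv (X ^ₛ q) (tail G ^ₛ q)) n     ≈⟨ at (𝕊.distribˡ F _ _) n ⟩
      conv F (const (G 0 ^ q)) n + conv F (conv (X ^ₛ q) (tail G ^ₛ q)) n
        ≈⟨ +-cong (trans (conv-comm F _ n) (trans (conv-constˡ _ F n) (*-comm _ _)))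
                  (at (𝕊.trans (𝕊.sym (𝕊.*-assoc F (X ^ₛ q) _))
                       (𝕊.trans (𝕊.*-congʳ (𝕊.*-comm F (X ^ₛ q))) (𝕊.*-assoc (X ^ₛ q) F _))) n) ⟩
      F n * G 0 ^ q + conv (X ^ₛ q) (conv F (tail G ^ₛ q)) n       ∎

    -- G^q has exponents divisible by q only, so the residue class r of the product involves only
    -- the residue class r of F.
    conv-^q : ∀ F G {r} → r < q → ∀ i →
              conv F (G ^ₛ q) (index q r i) ≈ conv (λ j → F (index q r j)) (λ j → G j ^ q) i
    conv-^q F G {r} r<q zero    =
      trans (conv-^q-expand F G r) (trans (+-congˡ (X^-conv-< q _ r r<q)) (+-identityʳ _))
    conv-^q F G {r} r<q (suc i) = begin
      conv F (G ^ₛ q) (q ℕ.+ index q r i)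
        ≈⟨ conv-^q-expand F G (q ℕ.+ index q r i) ⟩
      F (q ℕ.+ index q r i) * G 0 ^ q + conv (X ^ₛ q) (conv F (tail G ^ₛ q)) (q ℕ.+ index q r i)
        ≈⟨ +-congˡ (trans (X^-conv-≥ q _ (index q r i)) (conv-^q F (tail G) r<q i)) ⟩
      F (q ℕ.+ index q r i) * G 0 ^ q + conv (λ j → F (index q r j)) (λ j → tail G j ^ q) i
        ≈⟨ conv-last (λ j → F (index q r j)) (λ j → G j ^ q) i ⟨
      conv (λ j → F (index q r j)) (λ j → G j ^ q) (suc i) ∎

    X-^q : ∀ g → (X- g) ^ₛ q ⊕ const (g ^ q) ≋ X ^ₛ q
    X-^q g =
      𝕊.trans (𝕊.+-congˡ (𝕊.sym (const-^ g q)))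
      (𝕊.trans (𝕊.sym (frobeniusₛ-^ k (X- g) (const g)))
               (^ₛ-congˡ q (pointwise lemma)))
      where
      lemma : ∀ i → X i + const (- g) i + const g i ≈ X i
      lemma i = trans (+-assoc _ _ _) (trans (+-congˡ (trans (sym (at (const-⊕ (- g) g) i)) (at (const-cong (-‿inverseˡ g)) i)))
                  (trans (+-congˡ (0s i)) (+-identityʳ _)))
        where
        0s : ∀ i → const 0# i ≈ 0#
        0s zero    = refl
        0s (suc i) = refl

    -- Since F = X^q G - g^q G, its section is Y w - g^q w with w the section of G, and this is zero
    -- at Y = g^q. The last hypothesis says that w has no coefficient d, which the factor Y would
    -- push past the cut-off of `ev d`.
    ev-vanish : ∀ d F G g {r} → r < q → F ≋ conv ((X- g) ^ₛ q) G → G (index q r d) ≈ 0# →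
                ev d (λ b → F (index q r b)) (g ^ q) ≈ 0#
    ev-vanish d F G g {r} r<q F≋ Gd≈0 = identityˡ-unique _ _ (begin
      ev d (λ b → F (index q r b)) (g ^ q) + g ^ q * ev d w (g ^ q)
        ≈⟨ +-congˡ (ev-· d (g ^ q) w (g ^ q)) ⟨
      ev d (λ b → F (index q r b)) (g ^ q) + ev d (g ^ q · w) (g ^ q)
        ≈⟨ ev-⊕ d _ _ _ ⟨
      ev d (λ b → F (index q r b) + g ^ q * w b) (g ^ q)
        ≈⟨ ev-cong d (g ^ q) (pointwise shifted) ⟩
      ev d (0# ◂ w) (g ^ q)
        ≈⟨ ev-0◂ d w (g ^ q) Gd≈0 ⟩
      g ^ q * ev d w (g ^ q) ∎)
      where
      w : Seq
      w b = G (index q r b)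
      X^qG : ∀ i → F i + g ^ q * G i ≈ conv (X ^ₛ q) G i
      X^qG i = trans (+-cong (at F≋ i) (sym (conv-constˡ (g ^ q) G i)))
               (trans (sym (conv-⊕ˡ ((X- g) ^ₛ q) (const (g ^ q)) G i))
                      (at (𝕊.*-congʳ {G} (X-^q g)) i))
      shifted : ∀ b → F (index q r b) + g ^ q * w b ≈ (0# ◂ w) b
      shifted zero    = trans (X^qG r) (X^-conv-< q G r r<q)
      shifted (suc b) = trans (X^qG (q ℕ.+ index q r b)) (X^-conv-≥ q G (index q r b))

    degLe-X-^ : ∀ g k → DegLe k ((X- g) ^ₛ k)
    degLe-X-^ g k = degLe-mono (ℕₚ.≤-reflexive (ℕₚ.*-identityʳ k))
      (degLe-^ k (degLe-⊕ degLe-X (degLe-mono z≤n (degLe-const (- g)))))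

    X-^-monic : ∀ g k → ((X- g) ^ₛ k) k ≈ 1#
    X-^-monic g zero    = refl
    X-^-monic g (suc k) = trans (+-cong (trans (*-congˡ (degLe-X-^ g k (suc k) ℕₚ.≤-refl)) (zeroʳ _))
      (trans (at (conv-cong (pointwise leading) (𝕊.refl {(X- g) ^ₛ k})) k)
             (trans (conv-constˡ 1# ((X- g) ^ₛ k) k) (*-identityˡ _))))
      (trans (+-identityˡ _) (X-^-monic g k))
      where
      leading : ∀ i → (X- g) (suc i) ≈ const 1# i
      leading i = +-identityʳ _

    root-factor : ∀ {m F g} → DegLe m F → ev m F g ≈ 0# → F ≋ conv (X- g) (quot m F g)
    root-factor {m} {F} {g} degF F[g]≈0 =
      𝕊.trans (quot-spec m F g degF) (𝕊.trans (𝕊.+-congʳ (𝕊.trans (const-cong F[g]≈0) (pointwise const0)))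
                                               (𝕊.+-identityˡ _))
      where
      const0 : ∀ i → const 0# i ≈ 0#
      const0 zero    = refl
      const0 (suc i) = refl

    module _ {q′ : ℕ} (q≡ : q ≡ suc q′) where

      mixed-power-vanish : ∀ {a b A B g r d} → r < q →
        DegLe a A → ev a A g ≈ 0# → DegLe b B → ev b B g ≈ 0# →
        q′ ℕ.* ℕ.pred a ℕ.+ ℕ.pred b < d ℕ.* q →
        ev d (λ i → conv (A ^ₛ q′) B (index q r i)) (g ^ q) ≈ 0#
      mixed-power-vanish {a} {b} {A} {B} {g} {r} {d} r<q degA A[g]≈0 degB B[g]≈0 small =
        -- The cofactor of (X - g)^q is A′^(q-1) B′; `small` bounds its degree below d q, hence
        -- below `index q r d`.
        ev-vanish d (conv (A ^ₛ q′) B) (conv (A′ ^ₛ q′) B′) g r<q factored (degLe-conv (degLe-^ q′ (degLe-quot a A g)) (degLe-quot b B g) _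
                                  (ℕₚ.<-≤-trans small (index-≥ q r d)))
        where
        A′ B′ L : Seq
        A′ = quot a A g
        B′ = quot b B g
        L  = X- g
        factored : conv (A ^ₛ q′) B ≋ conv (L ^ₛ q) (conv (A′ ^ₛ q′) B′)
        factored =
          conv (A ^ₛ q′) B                               ≋⟨ 𝕊.*-cong (^ₛ-congˡ q′ (root-factor degA A[g]≈0)) (root-factor degB B[g]≈0) ⟩
          conv (conv L A′ ^ₛ q′) (conv L B′)             ≋⟨ 𝕊.*-congʳ (^ₛ-distrib-* L A′ q′) ⟩
          conv (conv (L ^ₛ q′) (A′ ^ₛ q′)) (conv L B′)   ≋⟨ interchange (L ^ₛ q′) (A′ ^ₛ q′) L B′ ⟩
          conv (conv L (L ^ₛ q′)) (conv (A′ ^ₛ q′) B′)   ≋⟨ 𝕊.*-congʳ (^ₛ-congʳ L (≡.sym q≡)) ⟩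
          conv (L ^ₛ q) (conv (A′ ^ₛ q′) B′)             ≋∎
          where
          interchange : ∀ x y z w → conv (conv x y) (conv z w) ≋ conv (conv z x) (conv y w)
          interchange = solveₛ 4 (λ x y z w → (x :* y) :* (z :* w) := (z :* x) :* (y :* w)) 𝕊.refl

      -- With P = (X - g) S the polynomial is (X - g)^(q-1) E, where E = X P′ S^(q-1). Write E = e +
      -- (X - g) R. The part e (X - g)^(q-1) has degree q - 1 and leading coefficient e, so its
      -- section of residue q - 1 is the constant e; the part (X - g)^q R contributes zero by
      -- `ev-vanish`. Finally S(g) = W gives e = g W W^(q-1).
      simple-root-value : ∀ {m P g} → DegLe (suc m) P → ev (suc m) P g ≈ 0# →
        ev (suc m) (λ i → conv (conv X (deriv P)) (P ^ₛ q′) (index q q′ i)) (g ^ q) ≈ g * ev m (deriv P) g ^ q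
      simple-root-value {m} {P} {g} degP P[g]≈0 = begin
        ev d (λ i → F (index q q′ i)) (g ^ q)
          ≈⟨ ev-cong d (g ^ q) (pointwise (λ i → at split (index q q′ i))) ⟩
        ev d (λ i → F₁ (index q q′ i) + F₂ (index q q′ i)) (g ^ q)
          ≈⟨ ev-⊕ d (λ i → F₁ (index q q′ i)) (λ i → F₂ (index q q′ i)) (g ^ q) ⟩
        ev d (λ i → F₁ (index q q′ i)) (g ^ q) + ev d (λ i → F₂ (index q q′ i)) (g ^ q)
          ≈⟨ +-cong (ev-cong d (g ^ q) (pointwise leading)) (ev-vanish d F₂ (quot M E g) g q′<q 𝕊.refl quotient-small) ⟩
        ev d (const e) (g ^ q) + 0#
          ≈⟨ trans (+-identityʳ _) (ev-const d e (g ^ q)) ⟩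
        e ≈⟨ value ⟩
        g * W ^ q ∎
        where
        d M : ℕ
        d = suc m
        M = suc m ℕ.+ q′ ℕ.* m
        W e : Carrier
        S L Q E F F₁ F₂ : Seq
        W = ev m (deriv P) g
        S = quot d P g
        L = X- g
        Q = conv X (deriv P)
        E = conv Q (S ^ₛ q′)
        e = ev M E g
        F = conv Q (P ^ₛ q′)
        F₁ = conv (L ^ₛ q′) (const e)
        F₂ = conv (L ^ₛ q) (quot M E g)
        q′<q : q′ < q
        q′<q = ℕₚ.≤-reflexive (≡.sym q≡)
        degQ : DegLe d Q
        degQ = degLe-conv degLe-X (degLe-deriv degP)
        degE : DegLe M E
        degE = degLe-conv degQ (degLe-^ q′ (degLe-quot d P g))
        split : F ≋ F₁ ⊕ F₂
        split =
          conv Q (P ^ₛ q′)                       ≋⟨ 𝕊.*-congˡ {Q} (𝕊.trans (^ₛ-congˡ q′ (root-factor degP P[g]≈0)) (^ₛ-distrib-* L S q′)) ⟩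
          conv Q (conv (L ^ₛ q′) (S ^ₛ q′))      ≋⟨ swap Q (L ^ₛ q′) (S ^ₛ q′) ⟩
          conv (L ^ₛ q′) E                       ≋⟨ 𝕊.*-congˡ {L ^ₛ q′} (quot-spec M E g degE) ⟩
          conv (L ^ₛ q′) (const e ⊕ conv L (quot M E g)) ≋⟨ 𝕊.distribˡ (L ^ₛ q′) _ _ ⟩
          F₁ ⊕ conv (L ^ₛ q′) (conv L (quot M E g))
            ≋⟨ 𝕊.+-congˡ (𝕊.trans (swap′ (L ^ₛ q′) L (quot M E g)) (𝕊.*-congʳ (^ₛ-congʳ L (≡.sym q≡)))) ⟩
          F₁ ⊕ F₂ ≋∎
          where
          swap : ∀ x y z → conv x (conv y z) ≋ conv y (conv x z)
          swap = solveₛ 3 (λ x y z → x :* (y :* z) := y :* (x :* z)) 𝕊.refl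
          swap′ : ∀ x y z → conv x (conv y z) ≋ conv (conv y x) z
          swap′ = solveₛ 3 (λ x y z → x :* (y :* z) := (y :* x) :* z) 𝕊.refl
        leading : ∀ i → F₁ (index q q′ i) ≈ const e i
        leading i = trans (conv-comm (L ^ₛ q′) (const e) (index q q′ i))
          (trans (conv-constˡ e (L ^ₛ q′) (index q q′ i)) (lead i))
          where
          lead : ∀ i → e * (L ^ₛ q′) (index q q′ i) ≈ const e i
          lead zero    = trans (*-congˡ (X-^-monic g q′)) (*-identityʳ e)
          lead (suc i) = trans (*-congˡ (degLe-X-^ g q′ _ (ℕₚ.<-≤-trans q′<q (ℕₚ.m≤m+n q _)))) (zeroʳ e)
        quotient-small : quot M E g (index q q′ d) ≈ 0#
        -- The quotient has degree at most M - 1 = q m, which is below d q because d = m + 1.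
        quotient-small = degLe-quot M E g _ (ℕₚ.<-≤-trans small (index-≥ q q′ d))
          where
          small : m ℕ.+ q′ ℕ.* m < d ℕ.* q
          small = ≡.subst (_< d ℕ.* q) (≡.trans (ℕₚ.*-comm m q) (≡.cong (ℕ._* m) q≡))
                    (ℕₚ.*-monoˡ-< q {{ℕ.>-nonZero q>0}} (ℕₚ.n<1+n m))
        value : e ≈ g * W ^ q
        value = begin
          e                                        ≈⟨ ev-conv Q (S ^ₛ q′) g degQ (degLe-^ q′ (degLe-quot d P g)) ⟩
          ev d Q g * ev (q′ ℕ.* m) (S ^ₛ q′) g     ≈⟨ *-cong (trans (ev-conv X (deriv P) g degLe-X (degLe-deriv degP)) (*-congʳ (ev-X g)))
                                                           (trans (ev-^ S g q′ (degLe-quot d P g)) (^-congˡ q′ (ev-quot m P g degP))) ⟩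
          g * W * W ^ q′                           ≈⟨ *-assoc _ _ _ ⟩
          g * W ^ suc q′                           ≈⟨ *-congˡ (^-congʳ W (≡.sym q≡)) ⟩
          g * W ^ q                                ∎

    module _ (Λ : Carrier → Carrier) (Λ-+ : ∀ x y → Λ (x + y) ≈ Λ x + Λ y)
             (Λ-^q : ∀ x y → Λ (x * y ^ q) ≈ Λ x * y) (Λ-cong : ∀ {x y} → x ≈ y → Λ x ≈ Λ y) where

      -- A map that is linear over q-th powers turns a value at g^q into a value at g, acting only
      -- on the coefficients. It will be applied to sections.
      Λ-ev : ∀ d F g → Λ (ev d F (g ^ q)) ≈ ev d (λ i → Λ (F i)) g
      Λ-ev zero    F g = refl
      Λ-ev (suc d) F g = begin
        Λ (F 0 + g ^ q * ev d (tail F) (g ^ q))     ≈⟨ Λ-+ _ _ ⟩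
        Λ (F 0) + Λ (g ^ q * ev d (tail F) (g ^ q)) ≈⟨ +-congˡ (trans (Λ-cong (*-comm _ _)) (Λ-^q _ g)) ⟩
        Λ (F 0) + Λ (ev d (tail F) (g ^ q)) * g     ≈⟨ +-congˡ (trans (*-comm _ _) (*-congˡ (Λ-ev d (tail F) g))) ⟩
        Λ (F 0) + g * ev d (λ i → Λ (F (suc i))) g  ∎

-- Integral domains with stable equality

module Domain (R : CommutativeRing 0ℓ 0ℓ) where
  open CommutativeRing R hiding (zero)

  -- One cannot decide which factor of a vanishing product of power series is zero. Cancellation of
  -- an element that is not zero, together with double-negation elimination for equality, does pass
  -- from R to power series over R.
  record IsDomain : Set where
    field
      stable  : ∀ {x y} → ¬ ¬ (x ≈ y) → x ≈ y
      cancel0 : ∀ {x y} → x * y ≈ 0# → ¬ (x ≈ 0#) → y ≈ 0#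

open Domain using (IsDomain)

module _ (R : CommutativeRing 0ℓ 0ℓ) (domain : IsDomain R) where
  open CommutativeRing R hiding (zero)
  open Polynomials R
  open Domain.IsDomain domain

  seqDomain : IsDomain seqRing
  seqDomain = record
    { stable  = λ ¬¬e → pointwise (λ i → stable (λ ¬e → ¬¬e (λ e → ¬e (at e i))))
    ; cancel0 = λ {F} {G} FG≈0 F≉0 → pointwise (λ j → stable (λ Gj≉0 → F≉0
        (pointwise (λ i → stable (λ Fi≉0 → Gj≉0 (later i F G Fi≉0 FG≈0 j))))))
    }
    where
    leading : ∀ F G → ¬ (F 0 ≈ 0#) → conv F G ≋ 0ₛ → ∀ j → G j ≈ 0#
    leading F G F0≉0 FG≈0 zero    = cancel0 (at FG≈0 0) F0≉0
    leading F G F0≉0 FG≈0 (suc j) = leading F (tail G) F0≉0 (pointwise shifted) j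
      where
      shifted : ∀ n → conv F (tail G) n ≈ 0#
      shifted n = trans (sym (+-identityˡ _)) (trans (+-congʳ (sym (trans (*-congˡ (cancel0 (at FG≈0 0) F0≉0)) (zeroʳ _))))
        (trans (sym (conv-last F G n)) (at FG≈0 (suc n))))
    -- The first nonzero coefficient of F need not be found. Suppose G j is not zero. If F 0 were
    -- zero, then T G = 0 for the tail T of F, whose coefficient i is nonzero, and induction would
    -- give G j = 0. So F 0 is not zero, and `leading` applies.
    later : ∀ i F G → ¬ (F i ≈ 0#) → conv F G ≋ 0ₛ → ∀ j → G j ≈ 0#
    later zero    F G F0≉0 FG≈0 j = leading F G F0≉0 FG≈0 j
    later (suc i) F G Fi≉0 FG≈0 j = stable (λ Gj≉0 → Gj≉0 (leading F G (λ F0≈0 → Gj≉0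
      (later i (tail F) G Fi≉0 (pointwise (λ n →
        trans (sym (+-identityˡ _)) (trans (+-congʳ (sym (trans (*-congʳ F0≈0) (zeroˡ _)))) (at FG≈0 (suc n))))) j))
      FG≈0 j))

-- Homogeneous linear systems

module LinearAlgebra (R : CommutativeRing 0ℓ 0ℓ) (domain : IsDomain R)
  (zero? : ∀ x → Dec (CommutativeRing._≈_ R x (CommutativeRing.0# R)))
  (1≉0 : ¬ CommutativeRing._≈_ R (CommutativeRing.1# R) (CommutativeRing.0# R)) where
  open CommutativeRing R hiding (zero)
  open IsDomain domain
  open import Algebra.Properties.Semiring.Sum semiring
    using (sum; sum-cong-≋; sum-remove; ∑-distrib-+; *-distribʳ-sum; sum-replicate-zero)
  open import Algebra.Properties.Ring (CommutativeRing.ring R) using (-‿distribˡ-*)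
  open import Algebra.Solver.Ring.NaturalCoefficients.Default commutativeSemiring
    using (solve; _:=_; _:+_; _:*_)
  open import Relation.Binary.Reasoning.Setoid setoid

  dot : ∀ {m} → (Fin m → Carrier) → (Fin m → Carrier) → Carrier
  dot c φ = sum (λ j → c j * φ j)

  dot-zeroʳ : ∀ {m} (c : Fin m → Carrier) {φ} → (∀ j → φ j ≈ 0#) → dot c φ ≈ 0#
  dot-zeroʳ {m} c φ≈0 = trans (sum-cong-≋ (λ j → trans (*-congˡ (φ≈0 j)) (zeroʳ (c j)))) (sum-replicate-zero m)

  module _ {m} (φ : Fin (suc m) → Carrier) (i : Fin (suc m)) where

    -- Fraction-free elimination of the unknown i with pivot φ i.
    eliminate : (Fin (suc m) → Carrier) → Fin m → Carrier
    eliminate ψ j = φ i * ψ (punchIn i j) + - φ (punchIn i j) * ψ i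

    -- Back substitution, scaled by the pivot to avoid division. In a domain the scaling keeps a
    -- nonzero coordinate nonzero.
    extend : (Fin m → Carrier) → Fin (suc m) → Carrier
    extend c = insertAt (λ j → c j * φ i) i (dot c (λ j → - φ (punchIn i j)))

    dot-extend : ∀ c ψ → dot (extend c) ψ ≈ dot c (eliminate ψ)
    dot-extend c ψ = begin
      dot (extend c) ψ
        ≈⟨ sum-remove {i = i} (λ j → extend c j * ψ j) ⟩
      extend c i * ψ i + sum (λ j → extend c (punchIn i j) * ψ (punchIn i j))
        ≈⟨ +-cong (*-congʳ (reflexive (insertAt-lookup _ i _)))
                  (sum-cong-≋ (λ j → *-congʳ (reflexive (insertAt-punchIn _ i _ j)))) ⟩
      dot c (λ j → - φ (punchIn i j)) * ψ i + sum (λ j → c j * φ i * ψ (punchIn i j))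
        ≈⟨ +-congʳ (*-distribʳ-sum (ψ i) (λ j → c j * - φ (punchIn i j))) ⟩
      sum (λ j → c j * - φ (punchIn i j) * ψ i) + sum (λ j → c j * φ i * ψ (punchIn i j))
        ≈⟨ ∑-distrib-+ (λ j → c j * - φ (punchIn i j) * ψ i) (λ j → c j * φ i * ψ (punchIn i j)) ⟨
      sum (λ j → c j * - φ (punchIn i j) * ψ i + c j * φ i * ψ (punchIn i j))
        ≈⟨ sum-cong-≋ (λ j → rearrange (c j) (- φ (punchIn i j)) (ψ i) (φ i) (ψ (punchIn i j))) ⟩
      dot c (eliminate ψ) ∎
      where
      rearrange : ∀ c x y z w → c * x * y + c * z * w ≈ c * (z * w + x * y)
      rearrange = solve 5 (λ c x y z w → c :* x :* y :+ c :* z :* w := c :* (z :* w :+ x :* y)) refl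

    eliminate-self : ∀ j → eliminate φ j ≈ 0#
    eliminate-self j = trans (+-cong (*-comm _ _) (sym (-‿distribˡ-* _ _))) (-‿inverseʳ _)

  nontrivial-solution : ∀ {k} m (es : Vec (Fin m → Carrier) k) → k < m →
    Σ (Fin m → Carrier) λ c → (Σ (Fin m) λ j → ¬ (c j ≈ 0#)) × All (λ φ → dot c φ ≈ 0#) es
  nontrivial-solution (suc m) [] _ = (λ _ → 1#) , (zero , 1≉0) , []
  nontrivial-solution (suc m) (φ ∷ es) (s≤s k<m) with Finₚ.any? (λ j → ¬? (zero? (φ j)))
  ... | no none with nontrivial-solution (suc m) es (ℕₚ.m≤n⇒m≤1+n k<m)
  ...   | c , c≉0 , sol =
    c , c≉0 , dot-zeroʳ c (λ j → decidable-stable (zero? (φ j)) (λ φj≉0 → none (j , φj≉0))) ∷ sol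
  nontrivial-solution (suc m) (φ ∷ es) (s≤s k<m) | yes (i , φi≉0)
    with nontrivial-solution m (Vec.map (eliminate φ i) es) k<m
  ... | c , (j , cj≉0) , sol = extend φ i c , (punchIn i j , nonzero) ,
        trans (dot-extend φ i c φ) (dot-zeroʳ c (eliminate-self φ i))
        ∷ All.map (λ {ψ} e → trans (dot-extend φ i c ψ) e) (map⁻ sol)
    where
    nonzero : ¬ (extend φ i c (punchIn i j) ≈ 0#)
    nonzero e = cj≉0 (cancel0 (trans (*-comm _ _) (trans (sym (reflexive (insertAt-punchIn _ i _ j))) e)) φi≉0)

-- Exponent vectors and counting

δ : ℕ → ℕ → ℤ
δ zero    zero    = + 1
δ zero    (suc j) = + 0
δ (suc i) zero    = + 0
δ (suc i) (suc j) = δ i j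

δ-refl : ∀ i → δ i i ≡ + 1
δ-refl zero    = ≡.refl
δ-refl (suc i) = δ-refl i

δ-≢ : ∀ i j → ¬ i ≡ j → δ i j ≡ + 0
δ-≢ zero    zero    i≢j = ⊥-elim (i≢j ≡.refl)
δ-≢ zero    (suc j) i≢j = ≡.refl
δ-≢ (suc i) zero    i≢j = ≡.refl
δ-≢ (suc i) (suc j) i≢j = δ-≢ i j (λ e → i≢j (≡.cong suc e))

δ-+ˡ : ∀ k i j → δ (k ℕ.+ i) (k ℕ.+ j) ≡ δ i j
δ-+ˡ zero    i j = ≡.refl
δ-+ˡ (suc k) i j = δ-+ˡ k i j

δ-+ʳ : ∀ k i j → δ (i ℕ.+ k) (j ℕ.+ k) ≡ δ i j
δ-+ʳ k i j = ≡.trans (≡.cong₂ δ (ℕₚ.+-comm i k) (ℕₚ.+-comm j k)) (δ-+ˡ k i j)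

-- The exponent vector e + q v.
spread : ∀ {n} → ℕ → Vec ℕ n → Vec ℕ n → Vec ℕ n
spread q = Vec.zipWith (index q)

totalDeg-spread : ∀ {n} q (e v : Vec ℕ n) → totalDeg v ℕ.* q ≤ totalDeg (spread q e v)
totalDeg-spread q []      []      = z≤n
totalDeg-spread q (r ∷ e) (i ∷ v) = ≡.subst (_≤ totalDeg (spread q (r ∷ e) (i ∷ v)))
  (≡.sym (ℕₚ.*-distribʳ-+ q i (totalDeg v))) (ℕₚ.+-mono-≤ (index-≥ q r i) (totalDeg-spread q e v))

index-divMod : ∀ q .{{_ : ℕ.NonZero q}} i → index q (i % q) (i / q) ≡ i
index-divMod q i = ≡.trans (index≡ q (i % q) (i / q)) (≡.sym (m≡m%n+[m/n]*n i q))

residue : ∀ {n} q .{{_ : ℕ.NonZero q}} → Vec ℕ n → Vec ℕ n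
residue q = Vec.map (_% q)

residue< : ∀ {n} q .{{_ : ℕ.NonZero q}} (v : Vec ℕ n) → All (_< q) (residue q v)
residue< q []      = []
residue< q (i ∷ v) = m%n<n i q ∷ residue< q v

spread-divMod : ∀ {n} q .{{_ : ℕ.NonZero q}} (v : Vec ℕ n) → spread q (residue q v) (Vec.map (_/ q) v) ≡ v
spread-divMod q []      = ≡.refl
spread-divMod q (i ∷ v) = ≡.cong₂ _∷_ (index-divMod q i) (spread-divMod q v)

-- A cube that contains all exponents of total degree at most h. Its cardinality (h+1)^n is the
-- factor that enters N.
box : ∀ n → ℕ → List (Vec ℕ n)
box zero    h = [] List.∷ List.[]
box (suc n) h = cartesianProductWith _∷_ (upTo (suc h)) (box n h)

∈-box : ∀ {n h} (v : Vec ℕ n) → totalDeg v ≤ h → v ∈ box n h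
∈-box []      _   = here ≡.refl
∈-box (i ∷ v) v≤h = ∈-cartesianProductWith⁺ _∷_ (∈-upTo⁺ (s≤s (ℕₚ.m+n≤o⇒m≤o i v≤h)))
                                                (∈-box v (ℕₚ.m+n≤o⇒n≤o i v≤h))

length-cartesianProductWith : ∀ {A B C : Set} (f : A → B → C) xs ys →
  length (cartesianProductWith f xs ys) ≡ length xs ℕ.* length ys
length-cartesianProductWith f List.[]       ys = ≡.refl
length-cartesianProductWith f (x List.∷ xs) ys =
  ≡.trans (length-++ (List.map (f x) ys))
          (≡.cong₂ ℕ._+_ (length-map (f x) ys) (length-cartesianProductWith f xs ys))

length-box : ∀ n h → length (box n h) ≡ suc h ℕ.^ n
length-box zero    h = ≡.refl
length-box (suc n) h = ≡.trans (length-cartesianProductWith _∷_ (upTo (suc h)) (box n h))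
  (≡.cong₂ ℕ._*_ (length-upTo (suc h)) (length-box n h))

monomials : ∀ n → ℕ → ℕ → List (ℕ × Vec ℕ n)
monomials n d h = cartesianProductWith _,_ (upTo (suc d)) (box n h)

∈-monomials : ∀ {n d h i} {v : Vec ℕ n} → i ≤ d → totalDeg v ≤ h → (i , v) ∈ monomials n d h
∈-monomials {v = v} i≤d v≤h = ∈-cartesianProductWith⁺ _,_ (∈-upTo⁺ (s≤s i≤d)) (∈-box v v≤h)

monomials-≤ : ∀ {n d h i} {v : Vec ℕ n} → (i , v) ∈ monomials n d h → i ≤ d
monomials-≤ {n} {d} {h} m with ∈-cartesianProductWith⁻ _,_ (upTo (suc d)) (box n h) m
... | _ , _ , i∈ , _ , ≡.refl = ℕₚ.≤-pred (∈-upTo⁻ i∈)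

length-monomials : ∀ n d h → length (monomials n d h) ≡ suc d ℕ.* suc h ℕ.^ n
length-monomials n d h = ≡.trans (length-cartesianProductWith _,_ (upTo (suc d)) (box n h))
  (≡.cong₂ ℕ._*_ (length-upTo (suc d)) (length-box n h))

n<m^n : ∀ {m} → 1 < m → ∀ n → n < m ℕ.^ n
n<m^n 1<m zero    = s≤s z≤n
n<m^n {m} 1<m (suc n) = ℕₚ.<-≤-trans (s≤s (n<m^n 1<m n)) (lemma (n<m^n 1<m n))
  where
  lemma : n < m ℕ.^ n → suc (m ℕ.^ n) ≤ m ℕ.* m ℕ.^ n
  lemma n<m^n = ℕₚ.≤-trans (≡.subst (suc (m ℕ.^ n) ≤_) (≡.cong (m ℕ.^ n ℕ.+_) (≡.sym (ℕₚ.+-identityʳ _)))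
      (ℕₚ.m<m+n (m ℕ.^ n) (ℕₚ.≤-<-trans z≤n n<m^n)))
    (ℕₚ.*-monoˡ-≤ (m ℕ.^ n) 1<m)

-- For coefficients of degree at most H there are (N+1)(H+1) unknowns and (H+q) N equations, so the
-- excess is H + N + 1 - q N. The choice H = N q makes it N + 1.
unknowns-exceed : ∀ N q → suc N ℕ.* suc (N ℕ.* q) ≡ (N ℕ.* q ℕ.+ q) ℕ.* N ℕ.+ suc N
unknowns-exceed = solve 2 (λ N q → (con 1 :+ N) :* (con 1 :+ N :* q) := (N :* q :+ q) :* N :+ (con 1 :+ N)) ≡.refl
  where open ℕ-Solver using (solve; _:+_; _:*_; _:=_; con)

regroup : ∀ a c e t b → a ℕ.+ c ℕ.* (e ℕ.+ t ℕ.* b) ≡ a ℕ.+ c ℕ.* e ℕ.+ t ℕ.* (c ℕ.* b)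
regroup = solve 5 (λ a c e t b → a :+ c :* (e :+ t :* b) := a :+ c :* e :+ t :* (c :* b)) ≡.refl
  where open ℕ-Solver using (solve; _:+_; _:*_; _:=_)

-- From rational to modular annihilators

module EvaluationCongruence (R : RawSemiring 0ℓ 0ℓ) where
  open RawSemiring R

  sumTo-cong : ∀ i {f g} → (∀ a → a ≤ i → f a ≡ g a) → sumTo R i f ≡ sumTo R i g
  sumTo-cong zero    f≡g = f≡g 0 z≤n
  sumTo-cong (suc i) f≡g = ≡.cong₂ _+_ (sumTo-cong i (λ a a≤i → f≡g a (ℕₚ.m≤n⇒m≤1+n a≤i))) (f≡g (suc i) ℕₚ.≤-refl)

  sumPairs-cong : ∀ {n} (v : Vec ℕ n) {F G} → (∀ j k → F j k ≡ G j k) → sumPairs R v F ≡ sumPairs R v G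
  sumPairs-cong []      F≡G = F≡G [] []
  sumPairs-cong (i ∷ v) F≡G = sumTo-cong i (λ a _ → sumPairs-cong v (λ j k → F≡G (a ∷ j) ((i ℕ.∸ a) ∷ k)))

  module Scaling (*-assoc : ∀ x y z → (x * y) * z ≡ x * (y * z))
                 (distribˡ : ∀ x y z → x * (y + z) ≡ x * y + x * z) where

    sumTo-scale : ∀ c i f → sumTo R i (λ a → c * f a) ≡ c * sumTo R i f
    sumTo-scale c zero    f = ≡.refl
    sumTo-scale c (suc i) f = ≡.trans (≡.cong (λ x → x + c * f (suc i)) (sumTo-scale c i f))
      (≡.sym (distribˡ c (sumTo R i f) (f (suc i))))

    sumPairs-scale : ∀ {n} c (v : Vec ℕ n) F → sumPairs R v (λ j k → c * F j k) ≡ c * sumPairs R v F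
    sumPairs-scale c []      F = ≡.refl
    sumPairs-scale c (i ∷ v) F = ≡.trans (sumTo-cong i (λ a _ → sumPairs-scale c v (λ j k → F (a ∷ j) ((i ℕ.∸ a) ∷ k))))
      (sumTo-scale c i _)

    mulS-scale : ∀ {n} c f g (v : Vec ℕ n) → mulS R (λ w → c * f w) g v ≡ c * mulS R f g v
    mulS-scale c f g v = ≡.trans (sumPairs-cong v (λ j k → *-assoc c (f j) (g k))) (sumPairs-scale c v _)

    evalP-scale : ∀ {n} c m {A B} g (v : Vec ℕ n) → (∀ i → i ≤ m → ∀ w → B i w ≡ c * A i w) →
                  evalP R m B g v ≡ c * evalP R m A g v
    evalP-scale c m {A} {B} g v B≡cA = ≡.trans
      (sumTo-cong m (λ i i≤m → ≡.trans (sumPairs-cong v (λ j k → ≡.cong (λ x → x * powS R g i k) (B≡cA i i≤m j)))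
                                       (mulS-scale c (A i) (powS R g i) v)))
      (sumTo-scale c m _)

module EvaluationHomomorphism (R S : RawSemiring 0ℓ 0ℓ) (φ : RawSemiring.Carrier R → RawSemiring.Carrier S)
  (φ-+ : ∀ x y → φ (RawSemiring._+_ R x y) ≡ RawSemiring._+_ S (φ x) (φ y))
  (φ-* : ∀ x y → φ (RawSemiring._*_ R x y) ≡ RawSemiring._*_ S (φ x) (φ y))
  (φ-0 : φ (RawSemiring.0# R) ≡ RawSemiring.0# S) (φ-1 : φ (RawSemiring.1# R) ≡ RawSemiring.1# S) where
  open EvaluationCongruence S
  private module S = RawSemiring S

  φ-sumTo : ∀ i f → φ (sumTo R i f) ≡ sumTo S i (λ a → φ (f a))
  φ-sumTo zero    f = ≡.refl
  φ-sumTo (suc i) f = ≡.trans (φ-+ _ _) (≡.cong (λ x → x S.+ φ (f (suc i))) (φ-sumTo i f))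

  φ-sumPairs : ∀ {n} (v : Vec ℕ n) F → φ (sumPairs R v F) ≡ sumPairs S v (λ j k → φ (F j k))
  φ-sumPairs []      F = ≡.refl
  φ-sumPairs (i ∷ v) F = ≡.trans (φ-sumTo i _) (sumTo-cong i (λ a _ → φ-sumPairs v (λ j k → F (a ∷ j) ((i ℕ.∸ a) ∷ k))))

  φ-mulS : ∀ {n} f g {f′ g′} (v : Vec ℕ n) → (∀ w → φ (f w) ≡ f′ w) → (∀ w → φ (g w) ≡ g′ w) → φ (mulS R f g v) ≡ mulS S f′ g′ v
  φ-mulS f g v f≡ g≡ = ≡.trans (φ-sumPairs v _) (sumPairs-cong v (λ j k → ≡.trans (φ-* _ _) (≡.cong₂ S._*_ (f≡ j) (g≡ k))))

  φ-oneS : ∀ {n} (v : Vec ℕ n) → φ (oneS R v) ≡ oneS S v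
  φ-oneS []          = φ-1
  φ-oneS (zero ∷ v)  = φ-oneS v
  φ-oneS (suc i ∷ v) = φ-0

  φ-powS : ∀ {n} g k (v : Vec ℕ n) → φ (powS R g k v) ≡ powS S (λ w → φ (g w)) k v
  φ-powS g zero    v = φ-oneS v
  φ-powS g (suc k) v = φ-mulS g (powS R g k) v (λ w → ≡.refl) (φ-powS g k)

  φ-evalP : ∀ {n} m A g (v : Vec ℕ n) → φ (evalP R m A g v) ≡ evalP S m (λ i w → φ (A i w)) (λ w → φ (g w)) v
  φ-evalP m A g v = ≡.trans (φ-sumTo m _) (sumTo-cong m (λ i _ → φ-mulS (A i) (powS R g i) v (λ w → ≡.refl) (φ-powS g i)))

fromℤ : ℤ → ℚ
fromℤ z = z ℚ./ 1

toℚᵘ-fromℤ : ∀ z → ℚ.toℚᵘ (fromℤ z) ℚᵘ.≃ ℚᵘ.mkℚᵘ z 0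
toℚᵘ-fromℤ z = ℚₚ.toℚᵘ-fromℚᵘ (ℚᵘ.mkℚᵘ z 0)

fromℤ-+ : ∀ a b → fromℤ (a ℤ.+ b) ≡ fromℤ a ℚ.+ fromℤ b
fromℤ-+ a b = ℚₚ.toℚᵘ-injective (ℚᵘₚ.≃-trans (toℚᵘ-fromℤ (a ℤ.+ b)) (ℚᵘₚ.≃-sym (ℚᵘₚ.≃-trans (ℚₚ.toℚᵘ-homo-+ (fromℤ a) (fromℤ b))
  (ℚᵘₚ.≃-trans (ℚᵘₚ.+-cong (toℚᵘ-fromℤ a) (toℚᵘ-fromℤ b))
    (ℚᵘ.*≡* (≡.cong (ℤ._* + 1) (≡.cong₂ ℤ._+_ (ℤₚ.*-identityʳ a) (ℤₚ.*-identityʳ b))))))))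

fromℤ-* : ∀ a b → fromℤ (a ℤ.* b) ≡ fromℤ a ℚ.* fromℤ b
fromℤ-* a b = ℚₚ.toℚᵘ-injective (ℚᵘₚ.≃-trans (toℚᵘ-fromℤ (a ℤ.* b)) (ℚᵘₚ.≃-sym (ℚᵘₚ.≃-trans (ℚₚ.toℚᵘ-homo-* (fromℤ a) (fromℤ b))
  (ℚᵘₚ.*-cong (toℚᵘ-fromℤ a) (toℚᵘ-fromℤ b)))))

fromℤ-injective : ∀ {a b} → fromℤ a ≡ fromℤ b → a ≡ b
fromℤ-injective {a} {b} e with ℚₚ.fromℚᵘ-injective {ℚᵘ.mkℚᵘ a 0} {ℚᵘ.mkℚᵘ b 0} e
... | ℚᵘ.*≡* a1≡b1 = ≡.trans (≡.sym (ℤₚ.*-identityʳ a)) (≡.trans a1≡b1 (ℤₚ.*-identityʳ b))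

denominator-* : ∀ x → fromℤ (ℚ.↧ x) ℚ.* x ≡ fromℤ (ℚ.↥ x)
denominator-* x@record{} = ℚₚ.toℚᵘ-injective (ℚᵘₚ.≃-trans (ℚₚ.toℚᵘ-homo-* (fromℤ (ℚ.↧ x)) x)
  (ℚᵘₚ.≃-trans (ℚᵘₚ.*-congʳ {ℚ.toℚᵘ x} (toℚᵘ-fromℤ (ℚ.↧ x))) (ℚᵘₚ.≃-trans (ℚᵘ.*≡* cross) (ℚᵘₚ.≃-sym (toℚᵘ-fromℤ (ℚ.↥ x))))))
  where
  cross : ℚ.↧ x ℤ.* ℚ.↥ x ℤ.* + 1 ≡ ℚ.↥ x ℤ.* + (1 ℕ.* ℚ.↧ₙ x)
  cross = ≡.trans (ℤₚ.*-identityʳ _) (≡.trans (ℤₚ.*-comm (ℚ.↧ x) (ℚ.↥ x))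
    (≡.cong (λ d → ℚ.↥ x ℤ.* + d) (≡.sym (ℕₚ.*-identityˡ (ℚ.↧ₙ x)))))

common-denominator : (xs : List ℚ) → Σ ℤ λ D → ¬ D ≡ + 0 × (∀ {x} → x ∈ xs → Σ ℤ λ z → fromℤ z ≡ fromℤ D ℚ.* x)
common-denominator List.[]       = + 1 , (λ ()) , λ ()
common-denominator (x List.∷ xs) = extend (common-denominator xs)
  where
  extend : (Σ ℤ λ D → ¬ D ≡ + 0 × (∀ {y} → y ∈ xs → Σ ℤ λ z → fromℤ z ≡ fromℤ D ℚ.* y)) →
           Σ ℤ λ D → ¬ D ≡ + 0 × (∀ {y} → y ∈ x List.∷ xs → Σ ℤ λ z → fromℤ z ≡ fromℤ D ℚ.* y)
  extend (D , D≢0 , clears) = D ℤ.* ℚ.↧ x , nonzero , clears′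
    where
    nonzero : ¬ D ℤ.* ℚ.↧ x ≡ + 0
    nonzero e with ℤₚ.i*j≡0⇒i≡0∨j≡0 D e
    ... | inj₁ D≡0 = D≢0 D≡0
    clears′ : ∀ {y} → y ∈ x List.∷ xs → Σ ℤ λ z → fromℤ z ≡ fromℤ (D ℤ.* ℚ.↧ x) ℚ.* y
    clears′ (here ≡.refl) = D ℤ.* ℚ.↥ x , ≡.trans (fromℤ-* D (ℚ.↥ x)) (≡.trans (≡.cong (fromℤ D ℚ.*_) (≡.sym (denominator-* x)))
      (≡.trans (≡.sym (ℚₚ.*-assoc (fromℤ D) (fromℤ (ℚ.↧ x)) x)) (≡.cong (ℚ._* x) (≡.sym (fromℤ-* D (ℚ.↧ x))))))
    clears′ {y} (there y∈) with clears y∈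
    ... | z , z≡ = ℚ.↧ x ℤ.* z , ≡.trans (fromℤ-* (ℚ.↧ x) z) (≡.trans (≡.cong (fromℤ (ℚ.↧ x) ℚ.*_) z≡)
      (≡.trans (≡.sym (ℚₚ.*-assoc (fromℤ (ℚ.↧ x)) (fromℤ D) y)) (≡.cong (ℚ._* y)
        (≡.trans (≡.sym (fromℤ-* (ℚ.↧ x) D)) (≡.cong fromℤ (ℤₚ.*-comm (ℚ.↧ x) D))))))

module ReductionModulo {p : ℕ} (p-prime : Prime p) {n : ℕ} (f : Vec ℕ n → ℤ) (m k : ℕ) where

  -- `𝔽-raw p` computes with integers and refers to p only in its equality, so `vanishes` is exact
  -- vanishing over ℤ. The two other fields confine the nonzero coefficients to a finite list, in
  -- which divisibility by p can be tested.
  record IntegralAnnihilator (Z : ℕ → Vec ℕ n → ℤ) : Set where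
    field
      beyond-degree : ∀ i v → m < i → Z i v ≡ + 0
      beyond-height : ∀ i v → k < totalDeg v → Z i v ≡ + 0
      vanishes      : ∀ v → evalP (𝔽-raw p) m Z f v ≡ + 0
  open IntegralAnnihilator

  integral-annihilator : ∀ A → Annihilates ℚ-raw (toℚSeries f) m k A →
    Σ (ℕ → Vec ℕ n → ℤ) λ Z → IntegralAnnihilator Z × Σ ℕ λ i → Σ (Vec ℕ n) λ v → ¬ Z i v ≡ + 0
  integral-annihilator A (bounded , (i₀ , i₀≤m , v₀ , A≢0) , A[f]≡0) =
    clear (common-denominator (List.map (λ (i , v) → A i v) (monomials n m k)))
    where
    Result : Set
    Result = Σ (ℕ → Vec ℕ n → ℤ) λ Z → IntegralAnnihilator Z × Σ ℕ λ i → Σ (Vec ℕ n) λ v → ¬ Z i v ≡ + 0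
    clear : (Σ ℤ λ D → ¬ D ≡ + 0 × (∀ {x} → x ∈ List.map (λ (i , v) → A i v) (monomials n m k) → Σ ℤ λ z → fromℤ z ≡ fromℤ D ℚ.* x)) → Result
    clear (D , D≢0 , clears) = Z , record { beyond-degree = degree₀ ; beyond-height = height₀ ; vanishes = vanish } , i₀ , v₀ , Z≢0
      where
      -- Outside the bounds the value is set to 0, since the `A i` with i > m are arbitrary; inside,
      -- the clearing of denominators needs a proof of membership in the list.
      numerator : ∀ i v → Dec (i ≤ m) → Dec (totalDeg v ≤ k) → ℤ
      numerator i v (yes i≤m) (yes v≤k) = proj₁ (clears (∈-map⁺ (λ (i , v) → A i v) (∈-monomials {v = v} i≤m v≤k)))
      numerator i v (yes _)   (no _)    = + 0
      numerator i v (no _)    _         = + 0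
      Z : ℕ → Vec ℕ n → ℤ
      Z i v = numerator i v (i ℕ.≤? m) (totalDeg v ℕ.≤? k)
      degree₀ : ∀ i v → m < i → Z i v ≡ + 0
      degree₀ i v m<i with i ℕ.≤? m
      ... | yes i≤m = ⊥-elim (ℕₚ.<⇒≱ m<i i≤m)
      ... | no _    = ≡.refl
      height₀ : ∀ i v → k < totalDeg v → Z i v ≡ + 0
      height₀ i v k<v with i ℕ.≤? m | totalDeg v ℕ.≤? k
      ... | yes _ | yes v≤k = ⊥-elim (ℕₚ.<⇒≱ k<v v≤k)
      ... | yes _ | no _    = ≡.refl
      ... | no _  | _       = ≡.refl
      scaled : ∀ i → i ≤ m → ∀ v → fromℤ (Z i v) ≡ fromℤ D ℚ.* A i v
      scaled i i≤m v with i ℕ.≤? m | totalDeg v ℕ.≤? k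
      ... | yes i≤m′ | yes v≤k = proj₂ (clears (∈-map⁺ (λ (i , v) → A i v) (∈-monomials {v = v} i≤m′ v≤k)))
      ... | yes _ | no v≰k = ≡.sym (≡.trans (≡.cong (fromℤ D ℚ.*_) (bounded i i≤m v (ℕₚ.≰⇒> v≰k))) (ℚₚ.*-zeroʳ (fromℤ D)))
      ... | no i≰m | _ = ⊥-elim (i≰m i≤m)
      open EvaluationHomomorphism (𝔽-raw p) ℚ-raw fromℤ fromℤ-+ fromℤ-* ≡.refl ≡.refl
      open EvaluationCongruence.Scaling ℚ-raw ℚₚ.*-assoc ℚₚ.*-distribˡ-+
      vanish : ∀ v → evalP (𝔽-raw p) m Z f v ≡ + 0
      vanish v = fromℤ-injective (≡.trans (φ-evalP m Z f v)
        (≡.trans (evalP-scale (fromℤ D) m {A} (toℚSeries f) v scaled)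
          (≡.trans (≡.cong (fromℤ D ℚ.*_) (A[f]≡0 v)) (ℚₚ.*-zeroʳ (fromℤ D)))))
      Z≢0 : ¬ Z i₀ v₀ ≡ + 0
      Z≢0 Z≡0 = A≢0 (cancel (≡.trans (≡.sym (scaled i₀ i₀≤m v₀)) (≡.cong fromℤ Z≡0)))
        where
        cancel : fromℤ D ℚ.* A i₀ v₀ ≡ ℚ.0ℚ → A i₀ v₀ ≡ ℚ.0ℚ
        cancel e = ≡.trans (≡.sym (ℚₚ.*-identityˡ (A i₀ v₀))) (≡.trans (≡.cong (ℚ._* A i₀ v₀) (≡.sym (ℚₚ.*-inverseˡ (fromℤ D))))
          (≡.trans (ℚₚ.*-assoc (ℚ.1/ fromℤ D) (fromℤ D) (A i₀ v₀)) (≡.trans (≡.cong (ℚ.1/ fromℤ D ℚ.*_) e) (ℚₚ.*-zeroʳ (ℚ.1/ fromℤ D)))))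
          where
          instance
            D≢0′ : ℚ.NonZero (fromℤ D)
            D≢0′ = ℚ.≢-nonZero (λ e → D≢0 (fromℤ-injective e))

  -- If p divides all coefficients, then Z / p is still an integral annihilator. The descent ends
  -- because division by p decreases the absolute value, bounded by t, of one fixed nonzero
  -- coefficient.
  primitive-annihilator : ∀ t Z → IntegralAnnihilator Z → ∀ i v → ¬ Z i v ≡ + 0 → ℤ.∣ Z i v ∣ ≤ t →
    Σ (ℕ → Vec ℕ n → ℤ) (Annihilates (𝔽-raw p) f m k)
  primitive-annihilator zero    Z ann i v Z≢0 Z≤0 = ⊥-elim (Z≢0 (ℤₚ.∣i∣≡0⇒i≡0 (ℕₚ.n≤0⇒n≡0 Z≤0)))
  primitive-annihilator (suc t) Z ann i₀ v₀ Z≢0 Z≤t = cases (any? (λ (i , v) → ¬? (p ∣? ℤ.∣ Z i v ∣)) (monomials n m k))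
    where
    Result : Set
    Result = Σ (ℕ → Vec ℕ n → ℤ) (Annihilates (𝔽-raw p) f m k)
    zero-mod : ∀ {a} → a ≡ + 0 → (+ p) ℤDiv.∣ (a ℤ.- + 0)
    zero-mod ≡.refl = p ℕDiv.∣0
    undivided : ∀ {i v} → (i , v) ∈ monomials n m k → ¬ p ∣ ℤ.∣ Z i v ∣ → Result
    undivided {i} {v} iv∈ p∤Z = Z , (λ i _ v k<v → zero-mod (beyond-height ann i v k<v))
      , (i , monomials-≤ iv∈ , v , λ p∣Z → p∤Z (≡.subst (λ a → p ∣ ℤ.∣ a ∣) (ℤₚ.+-identityʳ (Z i v)) p∣Z))
      , λ v → zero-mod (vanishes ann v)
    divide : (∀ i v → p ∣ ℤ.∣ Z i v ∣) → Result
    divide p∣Z = primitive-annihilator t Z′ record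
      { beyond-degree = λ i v m<i → quotient-zero i v (beyond-degree ann i v m<i)
      ; beyond-height = λ i v k<v → quotient-zero i v (beyond-height ann i v k<v)
      ; vanishes = λ v → cancel _ (≡.trans (≡.sym (evalP-scale (+ p) m f v (λ i _ w → Z≡ i w))) (vanishes ann v))
      } i₀ v₀ Z′≢0 (ℕₚ.≤-pred (ℕₚ.<-≤-trans smaller Z≤t))
      where
      open EvaluationCongruence.Scaling (𝔽-raw p) ℤₚ.*-assoc ℤₚ.*-distribˡ-+
      Z′ : ℕ → Vec ℕ n → ℤ
      Z′ i v = Signed._∣_.quotient (∣ᵤ⇒∣ {+ p} {Z i v} (p∣Z i v))
      Z≡ : ∀ i v → Z i v ≡ + p ℤ.* Z′ i v
      Z≡ i v = ≡.trans (Signed._∣_.equality (∣ᵤ⇒∣ {+ p} {Z i v} (p∣Z i v))) (ℤₚ.*-comm (Z′ i v) (+ p))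
      cancel : ∀ a → + p ℤ.* a ≡ + 0 → a ≡ + 0
      cancel a e with ℤₚ.i*j≡0⇒i≡0∨j≡0 (+ p) e
      ... | inj₁ p≡0 = ⊥-elim (ℕₚ.<⇒≢ (p>0 p-prime) (≡.sym (ℤₚ.+-injective p≡0)))
      ... | inj₂ a≡0 = a≡0
      quotient-zero : ∀ i v → Z i v ≡ + 0 → Z′ i v ≡ + 0
      quotient-zero i v Z≡0 = cancel (Z′ i v) (≡.trans (≡.sym (Z≡ i v)) Z≡0)
      Z′≢0 : ¬ Z′ i₀ v₀ ≡ + 0
      Z′≢0 e = Z≢0 (≡.trans (Z≡ i₀ v₀) (≡.trans (≡.cong (λ x → + p ℤ.* x) e) (ℤₚ.*-zeroʳ (+ p))))
      smaller : ℤ.∣ Z′ i₀ v₀ ∣ < ℤ.∣ Z i₀ v₀ ∣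
      smaller = ≡.subst (ℤ.∣ Z′ i₀ v₀ ∣ <_)
        (≡.sym (≡.trans (≡.cong ℤ.∣_∣ (Z≡ i₀ v₀)) (≡.trans (ℤₚ.abs-* (+ p) (Z′ i₀ v₀)) (ℕₚ.*-comm p ℤ.∣ Z′ i₀ v₀ ∣))))
        (ℕₚ.m<m*n ℤ.∣ Z′ i₀ v₀ ∣ p {{ℕ.≢-nonZero (λ e → Z′≢0 (ℤₚ.∣i∣≡0⇒i≡0 e))}} (ℕ.nonTrivial⇒n>1 p {{prime⇒nonTrivial p-prime}}))
    cases : Dec (Any (λ (i , v) → ¬ p ∣ ℤ.∣ Z i v ∣) (monomials n m k)) → Result
    cases (yes found) = undivided (proj₁ (proj₂ (find found))) (proj₂ (proj₂ (find found)))
    cases (no none)   = divide divisible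
      where
      divisible : ∀ i v → p ∣ ℤ.∣ Z i v ∣
      divisible i v with m ℕ.<? i | k ℕ.<? totalDeg v
      ... | yes m<i | _       = ≡.subst (λ a → p ∣ ℤ.∣ a ∣) (≡.sym (beyond-degree ann i v m<i)) (p ℕDiv.∣0)
      ... | no _    | yes k<v = ≡.subst (λ a → p ∣ ℤ.∣ a ∣) (≡.sym (beyond-height ann i v k<v)) (p ℕDiv.∣0)
      ... | no m≮i  | no k≮v  = decidable-stable (p ∣? ℤ.∣ Z i v ∣)
        (λ p∤Z → none (lose (∈-monomials (ℕₚ.≮⇒≥ m≮i) (ℕₚ.≮⇒≥ k≮v)) p∤Z))

  annihilator-modulo : ∀ A → Annihilates ℚ-raw (toℚSeries f) m k A → Σ (ℕ → Vec ℕ n → ℤ) (Annihilates (𝔽-raw p) f m k)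
  annihilator-modulo A annA = reduce (integral-annihilator A annA)
    where
    reduce : (Σ (ℕ → Vec ℕ n → ℤ) λ Z → IntegralAnnihilator Z × Σ ℕ λ i → Σ (Vec ℕ n) λ v → ¬ Z i v ≡ + 0) →
             Σ (ℕ → Vec ℕ n → ℤ) (Annihilates (𝔽-raw p) f m k)
    reduce (Z , ann , i , v , Z≢0) = primitive-annihilator ℤ.∣ Z i v ∣ Z ann i v Z≢0 ℕₚ.≤-refl

-- Multivariate power series over the field with p elements

module CharacteristicP {p : ℕ} (p-prime : Prime p) where
  -- A record, so that the compared elements can be inferred from a proof.
  infix 4 _≈ₚ_
  record _≈ₚ_ (a b : ℤ) : Set where
    constructor modulo
    field difference : (+ p) ℤDiv.∣ (a ℤ.- b)
  open _≈ₚ_ public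

  private
    signed : ∀ {a b} → a ≈ₚ b → (+ p) Signed.∣ (a ℤ.- b)
    signed e = ∣ᵤ⇒∣ (difference e)

    unsigned : ∀ {a b c} → (+ p) Signed.∣ c → c ≡ a ℤ.- b → a ≈ₚ b
    unsigned p∣c ≡.refl = modulo (∣⇒∣ᵤ p∣c)

  open +-*-Solver using (solve; _:=_; _:+_; _:*_; _:-_; :-_)

  ≡⇒≈ₚ : ∀ {a b} → a ≡ b → a ≈ₚ b
  ≡⇒≈ₚ {a} ≡.refl = unsigned (Signed.divides (+ 0) ≡.refl) (≡.sym (ℤₚ.+-inverseʳ a))

  -- Residue classes are represented by integers, so that an integral series is literally its own
  -- reduction.
  𝔽 : CommutativeRing 0ℓ 0ℓ
  𝔽 = record
    { Carrier = ℤ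
    ; _≈_ = _≈ₚ_
    ; _+_ = ℤ._+_
    ; _*_ = ℤ._*_
    ; -_ = ℤ.-_
    ; 0# = + 0
    ; 1# = + 1
    ; isCommutativeRing = record
      { isRing = record
        { +-isAbelianGroup = record
          { isGroup = record
            { isMonoid = record
              { isSemigroup = record
                { isMagma = record
                  { isEquivalence = record
                    { refl = ≡⇒≈ₚ ≡.refl
                    ; sym = λ {a} {b} e → unsigned (∣m⇒∣-m (signed e)) (solve 2 (λ a b → :- (a :- b) := b :- a) ≡.refl a b)
                    ; trans = λ {a} {b} {c} e e′ → unsigned (∣m∣n⇒∣m+n (signed e) (signed e′))
                        (solve 3 (λ a b c → (a :- b) :+ (b :- c) := a :- c) ≡.refl a b c)
                    }
                  ; ∙-cong = λ {a} {b} {c} {d} e e′ → unsigned (∣m∣n⇒∣m+n (signed e) (signed e′))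
                      (solve 4 (λ a b c d → (a :- b) :+ (c :- d) := (a :+ c) :- (b :+ d)) ≡.refl a b c d)
                  }
                ; assoc = λ a b c → ≡⇒≈ₚ (ℤₚ.+-assoc a b c)
                }
              ; identity = (λ a → ≡⇒≈ₚ (ℤₚ.+-identityˡ a)) , (λ a → ≡⇒≈ₚ (ℤₚ.+-identityʳ a))
              }
            ; inverse = (λ a → ≡⇒≈ₚ (ℤₚ.+-inverseˡ a)) , (λ a → ≡⇒≈ₚ (ℤₚ.+-inverseʳ a))
            ; ⁻¹-cong = λ {a} {b} e → unsigned (∣m⇒∣-m (signed e))
                (solve 2 (λ a b → :- (a :- b) := (:- a) :- (:- b)) ≡.refl a b)
            }
          ; comm = λ a b → ≡⇒≈ₚ (ℤₚ.+-comm a b)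
          }
        ; *-cong = λ {a} {b} {c} {d} e e′ → unsigned (∣m∣n⇒∣m+n (∣m⇒∣m*n c (signed e)) (∣n⇒∣m*n b (signed e′)))
            (solve 4 (λ a b c d → (a :- b) :* c :+ b :* (c :- d) := (a :* c) :- (b :* d)) ≡.refl a b c d)
        ; *-assoc = λ a b c → ≡⇒≈ₚ (ℤₚ.*-assoc a b c)
        ; *-identity = (λ a → ≡⇒≈ₚ (ℤₚ.*-identityˡ a)) , (λ a → ≡⇒≈ₚ (ℤₚ.*-identityʳ a))
        ; distrib = (λ a b c → ≡⇒≈ₚ (ℤₚ.*-distribˡ-+ a b c)) , (λ a b c → ≡⇒≈ₚ (ℤₚ.*-distribʳ-+ a b c))
        }
      ; *-comm = λ a b → ≡⇒≈ₚ (ℤₚ.*-comm a b)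
      }
    }

  open CommutativeRing 𝔽 using (_≈_; refl; sym; trans; reflexive; +-cong; *-cong)
  open import Algebra.Properties.Semiring.Exp (CommutativeRing.semiring 𝔽) using (^-congˡ) renaming (_^_ to _^ₖ_)
  open import Algebra.Properties.Semiring.Mult (CommutativeRing.semiring 𝔽) using () renaming (_×_ to _×ₖ_)

  infix 4 _≈ₚ?_
  _≈ₚ?_ : ∀ a b → Dec (a ≈ₚ b)
  a ≈ₚ? b = map′ modulo difference (p ℕDiv.∣? ℤ.∣ a ℤ.- b ∣)

  ≈0⇒∣ : ∀ {a} → a ≈ₚ + 0 → (+ p) ℤDiv.∣ a
  ≈0⇒∣ {a} e = ≡.subst ((+ p) ℤDiv.∣_) (ℤₚ.+-identityʳ a) (difference e)

  ∣⇒≈0 : ∀ {a} → (+ p) ℤDiv.∣ a → a ≈ₚ + 0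
  ∣⇒≈0 {a} d = modulo (≡.subst ((+ p) ℤDiv.∣_) (≡.sym (ℤₚ.+-identityʳ a)) d)

  ×≡* : ∀ n a → n ×ₖ a ≡ + n ℤ.* a
  ×≡* zero    a = ≡.refl
  ×≡* (suc n) a = ≡.trans (≡.cong (λ x → a ℤ.+ x) (×≡* n a)) (≡.sym (ℤₚ.suc-* (+ n) a))

  𝔽-char : HasChar 𝔽 p
  𝔽-char a = ∣⇒≈0 (∣⇒∣ᵤ (Signed.divides a (≡.trans (×≡* p a) (ℤₚ.*-comm (+ p) a))))

  𝔽-domain : IsDomain 𝔽
  𝔽-domain = record
    { stable  = λ {a} {b} → decidable-stable (a ≈ₚ? b)
    ; cancel0 = λ {a} {b} ab≈0 a≉0 → cases a b a≉0
        (euclidsLemma ℤ.∣ a ∣ ℤ.∣ b ∣ p-prime (≡.subst (p ℕDiv.∣_) (ℤₚ.abs-* a b) (≈0⇒∣ ab≈0)))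
    }
    where
    cases : ∀ a b → ¬ (a ≈ₚ + 0) → p ℕDiv.∣ ℤ.∣ a ∣ ⊎ p ℕDiv.∣ ℤ.∣ b ∣ → b ≈ₚ + 0
    cases a b a≉0 (inj₁ p∣a) = ⊥-elim (a≉0 (∣⇒≈0 p∣a))
    cases a b a≉0 (inj₂ p∣b) = ∣⇒≈0 p∣b

  open Frobenius 𝔽 p-prime 𝔽-char using (frobenius)
  open import Algebra.Properties.AbelianGroup (CommutativeRing.+-abelianGroup 𝔽) using (inverseˡ-unique)

  open CommutativeRing 𝔽 using (+-congˡ; -‿cong; zeroˡ)

  0^ : ∀ n → 0 < n → (+ 0) ^ₖ n ≈ + 0
  0^ (suc n) _ = zeroˡ ((+ 0) ^ₖ n)

  1^ : ∀ n → (+ 1) ^ₖ n ≡ + 1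
  1^ zero    = ≡.refl
  1^ (suc n) = ≡.trans (ℤₚ.*-identityˡ _) (1^ n)

  -- Fermat's little theorem by induction, as the p-th power is additive.
  fermat-ℕ : ∀ n → (+ n) ^ₖ p ≈ + n
  fermat-ℕ zero    = 0^ p (p>0 p-prime)
  fermat-ℕ (suc n) = trans (frobenius (+ 1) (+ n)) (+-cong (≡⇒≈ₚ (1^ p)) (fermat-ℕ n))

  fermat : ∀ a → a ^ₖ p ≈ a
  fermat (+ n)        = fermat-ℕ n
  fermat (ℤ.-[1+ n ]) = trans (inverseˡ-unique _ _ (trans (sym (frobenius ℤ.-[1+ n ] (+ suc n)))
    (trans (^-congˡ p (≡⇒≈ₚ (ℤₚ.+-inverseˡ (+ suc n)))) (0^ p (p>0 p-prime)))))
    (-‿cong (fermat-ℕ (suc n)))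

  open import Algebra.Properties.Semiring.Exp (CommutativeRing.semiring 𝔽) using (^-assocʳ)

  -- Thanks to this, sections need no q-th roots of coefficients.
  fermat-^ : ∀ k a → a ^ₖ (p ℕ.^ k) ≈ a
  fermat-^ zero    a = ≡⇒≈ₚ (ℤₚ.*-identityʳ a)
  fermat-^ (suc k) a = trans (sym (^-assocʳ a p (p ℕ.^ k))) (trans (^-congˡ (p ℕ.^ k) (fermat a)) (fermat-^ k a))

  infix 4 _≈ₛ_
  record _≈ₛ_ {n} (f g : Vec ℕ n → ℤ) : Set where
    constructor coeffwise
    field coeff : ∀ v → f v ≈ₚ g v
  open _≈ₛ_ public

  infixl 7 _⋆_
  _⋆_ : ∀ {n} → (Vec ℕ n → ℤ) → (Vec ℕ n → ℤ) → Vec ℕ n → ℤ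
  _⋆_ = mulS (𝔽-raw p)

  curry : ∀ {n} → (Vec ℕ (suc n) → ℤ) → ℕ → Vec ℕ n → ℤ
  curry f i v = f (i ∷ v)

  sumTo-front : ∀ i h → sumTo (𝔽-raw p) (suc i) h ≡ h 0 ℤ.+ sumTo (𝔽-raw p) i (λ a → h (suc a))
  sumTo-front zero    h = ≡.refl
  sumTo-front (suc i) h = ≡.trans (≡.cong (ℤ._+ h (suc (suc i))) (sumTo-front i h)) (ℤₚ.+-assoc (h 0) _ _)

  -- Declared before its laws are proved: the laws in n + 1 variables are transported along `curry`
  -- from sequences over the ring in n variables, a recursion on n.
  series : ℕ → CommutativeRing 0ℓ 0ℓ
  series-isCommutativeRing : ∀ n → IsCommutativeRing {A = Vec ℕ n → ℤ} _≈ₛ_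
    (λ f g v → f v ℤ.+ g v) _⋆_ (λ f v → ℤ.- f v) (λ _ → + 0) (oneS (𝔽-raw p))

  module P (n : ℕ) = Polynomials (series n)

  series n = record { isCommutativeRing = series-isCommutativeRing n }

  ⋆-conv : ∀ {n} (f g : Vec ℕ (suc n) → ℤ) i v → (f ⋆ g) (i ∷ v) ≡ P.conv n (curry f) (curry g) i v
  ⋆-conv f g zero    v = ≡.refl
  ⋆-conv {n} f g (suc i) v =
    ≡.trans (sumTo-front i (λ a → (curry f a ⋆ curry g (suc i ℕ.∸ a)) v))
            (≡.cong (λ x → (curry f 0 ⋆ curry g (suc i)) v ℤ.+ x) (⋆-conv (λ w → f (suc (Vec.head w) ∷ Vec.tail w)) g i v))

  curry-⋆ : ∀ {n} (f g : Vec ℕ (suc n) → ℤ) → PowerSeries._≋_ (series n) (curry (f ⋆ g)) (P.conv n (curry f) (curry g))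
  curry-⋆ f g = PowerSeries.pointwise (λ i → coeffwise (λ v → ≡⇒≈ₚ (⋆-conv f g i v)))

  curry-cong : ∀ {n} {f g : Vec ℕ (suc n) → ℤ} → f ≈ₛ g → PowerSeries._≋_ (series n) (curry f) (curry g)
  curry-cong e = PowerSeries.pointwise (λ i → coeffwise (λ v → coeff e (i ∷ v)))

  curry-one : ∀ {n} → PowerSeries._≋_ (series n) (curry (oneS (𝔽-raw p))) (P.const n (oneS (𝔽-raw p)))
  curry-one = PowerSeries.pointwise lemma
    where
    lemma : ∀ {n} i → CommutativeRing._≈_ (series n) (curry (oneS (𝔽-raw p)) i) (P.const n (oneS (𝔽-raw p)) i)
    lemma zero    = coeffwise (λ v → refl)
    lemma (suc i) = coeffwise (λ v → refl)

  uncurried : ∀ {n} {f g : Vec ℕ (suc n) → ℤ} → PowerSeries._≋_ (series n) (curry f) (curry g) → f ≈ₛ g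
  uncurried e = coeffwise lemma
    where
    lemma : ∀ v → _
    lemma (i ∷ v) = coeff (PowerSeries.at e i) v

  series-isCommutativeRing n = record
    { isRing = record
      { +-isAbelianGroup = record
        { isGroup = record
          { isMonoid = record
            { isSemigroup = record
              { isMagma = record
                { isEquivalence = record
                  { refl = coeffwise (λ v → refl)
                  ; sym = λ e → coeffwise (λ v → sym (coeff e v))
                  ; trans = λ e e′ → coeffwise (λ v → trans (coeff e v) (coeff e′ v))
                  }
                ; ∙-cong = λ e e′ → coeffwise (λ v → +-cong (coeff e v) (coeff e′ v))
                }
              ; assoc = λ f g h → coeffwise (λ v → ≡⇒≈ₚ (ℤₚ.+-assoc (f v) (g v) (h v)))
              }
            ; identity = (λ f → coeffwise (λ v → ≡⇒≈ₚ (ℤₚ.+-identityˡ (f v)))) , (λ f → coeffwise (λ v → ≡⇒≈ₚ (ℤₚ.+-identityʳ (f v))))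
            }
          ; inverse = (λ f → coeffwise (λ v → ≡⇒≈ₚ (ℤₚ.+-inverseˡ (f v)))) , (λ f → coeffwise (λ v → ≡⇒≈ₚ (ℤₚ.+-inverseʳ (f v))))
          ; ⁻¹-cong = λ e → coeffwise (λ v → CommutativeRing.-‿cong 𝔽 (coeff e v))
          }
        ; comm = λ f g → coeffwise (λ v → ≡⇒≈ₚ (ℤₚ.+-comm (f v) (g v)))
        }
      ; *-cong = cong n
      ; *-assoc = assoc n
      ; *-identity = identityˡ n , λ f → ≈ₛ-trans (comm n f _) (identityˡ n f)
      ; distrib = (λ f g h → ≈ₛ-trans (comm n f _) (≈ₛ-trans (distribʳ n f g h)
                               (coeffwise (λ v → +-cong (coeff (comm n g f) v) (coeff (comm n h f) v)))))
                , distribʳ n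
      }
    ; *-comm = comm n
    }
    where
    ≈ₛ-trans : ∀ {f g h : Vec ℕ n → ℤ} → f ≈ₛ g → g ≈ₛ h → f ≈ₛ h
    ≈ₛ-trans e e′ = coeffwise (λ v → trans (coeff e v) (coeff e′ v))

    cong : ∀ n {f g h k : Vec ℕ n → ℤ} → f ≈ₛ g → h ≈ₛ k → f ⋆ h ≈ₛ g ⋆ k
    cong zero    e e′ = coeffwise λ { [] → *-cong (coeff e []) (coeff e′ []) }
    cong (suc n) {f} {g} {h} {k} e e′ = uncurried (S.trans (curry-⋆ f h)
      (S.trans (P.conv-cong n (curry-cong e) (curry-cong e′)) (S.sym (curry-⋆ g k))))
      where module S = CommutativeRing (P.seqRing n)

    assoc : ∀ n (f g h : Vec ℕ n → ℤ) → (f ⋆ g) ⋆ h ≈ₛ f ⋆ (g ⋆ h)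
    assoc zero    f g h = coeffwise λ { [] → ≡⇒≈ₚ (ℤₚ.*-assoc (f []) (g []) (h [])) }
    assoc (suc n) f g h = uncurried (S.trans (curry-⋆ (f ⋆ g) h) (S.trans (S.*-congʳ (curry-⋆ f g))
      (S.trans (S.*-assoc (curry f) (curry g) (curry h))
        (S.sym (S.trans (curry-⋆ f (g ⋆ h)) (S.*-congˡ {curry f} (curry-⋆ g h)))))))
      where module S = CommutativeRing (P.seqRing n)

    identityˡ : ∀ n (f : Vec ℕ n → ℤ) → oneS (𝔽-raw p) ⋆ f ≈ₛ f
    identityˡ zero    f = coeffwise λ { [] → ≡⇒≈ₚ (ℤₚ.*-identityˡ (f [])) }
    identityˡ (suc n) f = uncurried (S.trans (curry-⋆ (oneS (𝔽-raw p)) f)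
      (S.trans (S.*-congʳ curry-one) (S.*-identityˡ (curry f))))
      where module S = CommutativeRing (P.seqRing n)

    distribʳ : ∀ n (f g h : Vec ℕ n → ℤ) → (λ v → g v ℤ.+ h v) ⋆ f ≈ₛ (λ v → (g ⋆ f) v ℤ.+ (h ⋆ f) v)
    distribʳ zero    f g h = coeffwise λ { [] → ≡⇒≈ₚ (ℤₚ.*-distribʳ-+ (f []) (g []) (h [])) }
    distribʳ (suc n) f g h = uncurried (S.trans (curry-⋆ (λ v → g v ℤ.+ h v) f)
      (S.trans (S.distribʳ (curry f) (curry g) (curry h)) (S.sym (S.+-cong (curry-⋆ g f) (curry-⋆ h f)))))
      where module S = CommutativeRing (P.seqRing n)

    comm : ∀ n (f g : Vec ℕ n → ℤ) → f ⋆ g ≈ₛ g ⋆ f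
    comm zero    f g = coeffwise λ { [] → ≡⇒≈ₚ (ℤₚ.*-comm (f []) (g [])) }
    comm (suc n) f g = uncurried (S.trans (curry-⋆ f g) (S.trans (S.*-comm (curry f) (curry g)) (S.sym (curry-⋆ g f))))
      where module S = CommutativeRing (P.seqRing n)

  module K = CommutativeRing 𝔽
  module S n = CommutativeRing (series n)

  seriesDomain : ∀ n → IsDomain (series n)
  seriesDomain n = record
    { stable  = λ ¬¬e → coeffwise (λ v → stable (λ ¬e → ¬¬e (λ e → ¬e (coeff e v))))
    ; cancel0 = cancel n
    }
    where
    open IsDomain 𝔽-domain
    cancel : ∀ n {f g : Vec ℕ n → ℤ} → f ⋆ g ≈ₛ (λ _ → + 0) → ¬ (f ≈ₛ (λ _ → + 0)) → g ≈ₛ (λ _ → + 0)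
    cancel zero    fg≈0 f≉0 = coeffwise λ { [] → cancel0 (coeff fg≈0 []) (λ f≈0 → f≉0 (coeffwise λ { [] → f≈0 })) }
    cancel (suc n) {f} {g} fg≈0 f≉0 = uncurried (IsDomain.cancel0 (seqDomain (series n) (seriesDomain n))
      (P.𝕊.trans n (P.𝕊.sym n (curry-⋆ f g)) (curry-cong fg≈0)) (λ f≈0 → f≉0 (uncurried f≈0)))

  seriesChar : ∀ n → HasChar (series n) p
  seriesChar n f = coeffwise (λ v → K.trans (≡⇒≈ₚ (lemma p v)) (𝔽-char (f v)))
    where
    open import Algebra.Properties.Semiring.Mult (CommutativeRing.semiring (series n)) using () renaming (_×_ to _×ₛ_)
    lemma : ∀ k v → (k ×ₛ f) v ≡ k ×ₖ f v
    lemma zero    v = ≡.refl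
    lemma (suc k) v = ≡.cong (λ x → f v ℤ.+ x) (lemma k v)

  module C n = PositiveCharacteristic (series n) p-prime (seriesChar n)

  infixr 8 _^^_
  _^^_ : ∀ {n} → (Vec ℕ n → ℤ) → ℕ → Vec ℕ n → ℤ
  _^^_ {n} f k = f ^ k
    where open import Algebra.Properties.Semiring.Exp (CommutativeRing.semiring (series n)) using (_^_)

  curry-^ : ∀ {n} (f : Vec ℕ (suc n) → ℤ) k → PowerSeries._≋_ (series n) (curry (f ^^ k)) (P._^ₛ_ n (curry f) k)
  curry-^ {n} f zero    = curry-one
  curry-^ {n} f (suc k) = P.𝕊.trans n (curry-⋆ f (f ^^ k)) (P.𝕊.*-congˡ n {curry f} (curry-^ f k))

  -- Sections (Cartier operators)

  section : ∀ {n} → ℕ → Vec ℕ n → (Vec ℕ n → ℤ) → Vec ℕ n → ℤ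
  section q e f v = f (spread q e v)

  section-cong : ∀ {n} q e {f g : Vec ℕ n → ℤ} → f ≈ₛ g → section q e f ≈ₛ section q e g
  section-cong q e f≈g = coeffwise (λ v → coeff f≈g (spread q e v))

  ^-constant : ∀ (g : Vec ℕ 0 → ℤ) k → (g ^^ k) [] ≡ g [] ^ₖ k
  ^-constant g zero    = ≡.refl
  ^-constant g (suc k) = ≡.cong (g [] ℤ.*_) (^-constant g k)

  module _ (k : ℕ) where
    private
      q : ℕ
      q = p ℕ.^ k

    -- Induction on the number of variables: `conv-^q` treats the outermost variable and leaves q-th
    -- powers of series in the others. With no variables left the claim is Fermat's theorem.
    section-^q : ∀ {n} (e : Vec ℕ n) → All (_< q) e → ∀ f g → section q e (f ⋆ g ^^ q) ≈ₛ section q e f ⋆ g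
    section-^q []      _           f g = coeffwise λ { [] →
      K.*-congˡ {f []} (K.trans (≡⇒≈ₚ (^-constant g q)) (fermat-^ k (g []))) }
    section-^q {suc n} (r ∷ e) (r<q ∷ e<q) f g = coeffwise λ { (i ∷ v) → begin
      (f ⋆ g ^^ q) (index q r i ∷ spread q e v)
        ≈⟨ ≡⇒≈ₚ (⋆-conv f (g ^^ q) (index q r i) (spread q e v)) ⟩
      conv (curry f) (curry (g ^^ q)) (index q r i) (spread q e v)
        ≈⟨ coeff (at (𝕊.*-congˡ {curry f} (curry-^ g q)) (index q r i)) (spread q e v) ⟩
      conv (curry f) (curry g ^ₛ q) (index q r i) (spread q e v)
        ≈⟨ coeff (C.Power.conv-^q n k (curry f) (curry g) r<q i) (spread q e v) ⟩
      conv (λ j → curry f (index q r j)) (λ j → curry g j ^^ q) i (spread q e v)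
        ≈⟨ section-conv (λ j → curry f (index q r j)) (curry g) i v ⟩
      conv (λ j → section q e (curry f (index q r j))) (curry g) i v
        ≈⟨ ≡⇒≈ₚ (⋆-conv (section q (r ∷ e) f) g i v) ⟨
      (section q (r ∷ e) f ⋆ g) (i ∷ v) ∎ }
      where
      open P n
      open import Relation.Binary.Reasoning.Setoid K.setoid
      section-conv : ∀ F G i v → conv F (λ j → G j ^^ q) i (spread q e v) ≈ₚ conv (λ j → section q e (F j)) G i v
      section-conv F G zero    v = coeff (section-^q e e<q (F 0) (G 0)) v
      section-conv F G (suc i) v = K.+-cong (coeff (section-^q e e<q (F 0) (G (suc i))) v) (section-conv (tail F) G i v)

    section-ev : ∀ {n} (e : Vec ℕ n) → All (_< q) e → ∀ d F g →
      section q e (P.ev n d F (g ^^ q)) ≈ₛ P.ev n d (λ i → section q e (F i)) g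
    section-ev {n} e e<q = C.Power.Λ-ev n k (section q e) (λ f g → S.refl n) (section-^q e e<q) (section-cong q e)

  -- Degree and height bounds

  TotLe : ∀ {n} → ℕ → (Vec ℕ n → ℤ) → Set
  TotLe h f = ∀ v → h < totalDeg v → f v ≈ₚ + 0

  totLe-mono : ∀ {n h k} {f : Vec ℕ n → ℤ} → h ≤ k → TotLe h f → TotLe k f
  totLe-mono h≤k le v k<v = le v (ℕₚ.≤-<-trans h≤k k<v)

  totLe-+ : ∀ {n h} {f g : Vec ℕ n → ℤ} → TotLe h f → TotLe h g → TotLe h (λ v → f v ℤ.+ g v)
  totLe-+ le le′ v h<v = K.trans (K.+-cong (le v h<v) (le′ v h<v)) (K.+-identityˡ (+ 0))

  sumTo-zero : ∀ i {f} → (∀ a → a ≤ i → f a ≈ₚ + 0) → sumTo (𝔽-raw p) i f ≈ₚ + 0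
  sumTo-zero zero    f≈0 = f≈0 0 z≤n
  sumTo-zero (suc i) f≈0 = K.trans (K.+-cong (sumTo-zero i (λ a a≤i → f≈0 a (ℕₚ.m≤n⇒m≤1+n a≤i))) (f≈0 (suc i) ℕₚ.≤-refl))
    (K.+-identityˡ (+ 0))

  sumPairs-zero : ∀ {n} (v : Vec ℕ n) F →
    (∀ j k → totalDeg j ℕ.+ totalDeg k ≡ totalDeg v → F j k ≈ₚ + 0) → sumPairs (𝔽-raw p) v F ≈ₚ + 0
  sumPairs-zero []      F F≈0 = F≈0 [] [] ≡.refl
  sumPairs-zero (i ∷ v) F F≈0 = sumTo-zero i (λ a a≤i → sumPairs-zero v _ (λ j k j+k≡v →
    F≈0 (a ∷ j) ((i ℕ.∸ a) ∷ k) (≡.trans (interchange a (totalDeg j) (i ℕ.∸ a) (totalDeg k))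
      (≡.cong₂ ℕ._+_ (ℕₚ.m+[n∸m]≡n a≤i) j+k≡v))))
    where
    open import Algebra.Properties.CommutativeSemigroup ℕₚ.+-commutativeSemigroup using (interchange)

  totLe-⋆ : ∀ {n h k} {f g : Vec ℕ n → ℤ} → TotLe h f → TotLe k g → TotLe (h ℕ.+ k) (f ⋆ g)
  totLe-⋆ {n} {h} {k} {f} {g} lef leg v h+k<v = sumPairs-zero v _ term
    where
    term : ∀ i j → totalDeg i ℕ.+ totalDeg j ≡ totalDeg v → f i ℤ.* g j ≈ₚ + 0
    term i j i+j≡v with h ℕ.<? totalDeg i
    ... | yes h<i = K.trans (K.*-congʳ {g j} (lef i h<i)) (K.zeroˡ (g j))
    ... | no  h≮i = K.trans (K.*-congˡ {f i} (leg j (ℕₚ.+-cancelˡ-< h _ _ (ℕₚ.<-≤-trans h+k<v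
      (≡.subst (_≤ h ℕ.+ totalDeg j) i+j≡v (ℕₚ.+-monoˡ-≤ (totalDeg j) (ℕₚ.≮⇒≥ h≮i))))))) (K.zeroʳ (f i))

  totLe-one : ∀ {n} → TotLe {n} 0 (oneS (𝔽-raw p))
  totLe-one (zero ∷ v)  0<v = totLe-one v 0<v
  totLe-one (suc i ∷ v) 0<v = K.refl

  1≉0 : ¬ (+ 1 ≈ₚ + 0)
  1≉0 e = ¬prime[1] (≡.subst Prime (∣1⇒≡1 (≈0⇒∣ e)) p-prime)

  record PolyLe {n} (d h : ℕ) (F : ℕ → Vec ℕ n → ℤ) : Set where
    constructor bounds
    field
      degree : P.DegLe n d F
      height : ∀ i → TotLe h (F i)
  open PolyLe public

  Nonzero : ∀ {n} → (ℕ → Vec ℕ n → ℤ) → Set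
  Nonzero {n} F = ¬ (PowerSeries._≋_ (series n) F (PowerSeries.0ₛ (series n)))

  module _ {n : ℕ} where
    open P n

    polyLe-mono : ∀ {d d′ h h′ F} → d ≤ d′ → h ≤ h′ → PolyLe d h F → PolyLe d′ h′ F
    polyLe-mono d≤d′ h≤h′ le .degree = degLe-mono d≤d′ (degree le)
    polyLe-mono d≤d′ h≤h′ le .height i = totLe-mono h≤h′ (height le i)

    polyLe-conv : ∀ {d d′ h h′ F G} → PolyLe d h F → PolyLe d′ h′ G → PolyLe (d ℕ.+ d′) (h ℕ.+ h′) (conv F G)
    polyLe-conv le le′ .degree = degLe-conv (degree le) (degree le′)
    polyLe-conv {h = h} {h′} {F} {G} le le′ .height = heights F (height le)
      where
      heights : ∀ F → (∀ i → TotLe h (F i)) → ∀ i → TotLe (h ℕ.+ h′) (conv F G i)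
      heights F le zero    = totLe-⋆ (le 0) (height le′ 0)
      heights F le (suc i) = totLe-+ (totLe-⋆ (le 0) (height le′ (suc i))) (heights (tail F) (λ j → le (suc j)) i)

    polyLe-one : PolyLe 0 0 (const (oneS (𝔽-raw p)))
    polyLe-one .degree = degLe-const _
    polyLe-one .height zero    = totLe-one
    polyLe-one .height (suc i) v _ = K.refl

    polyLe-X : PolyLe 1 0 X
    polyLe-X .degree = degLe-X
    polyLe-X .height zero    v _ = K.refl
    polyLe-X .height (suc i) = height polyLe-one i

    polyLe-^ : ∀ {d h F} k → PolyLe d h F → PolyLe (k ℕ.* d) (k ℕ.* h) (F ^ₛ k)
    polyLe-^ zero    le = polyLe-one
    polyLe-^ (suc k) le = polyLe-conv le (polyLe-^ k le)

    polyLe-deriv : ∀ {d h F} → PolyLe (suc d) h F → PolyLe d h (deriv F)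
    polyLe-deriv le .degree = degLe-deriv (degree le)
    polyLe-deriv {h = h} {F} le .height = heights F (height le)
      where
      heights : ∀ F → (∀ i → TotLe h (F i)) → ∀ i → TotLe h (deriv F i)
      heights F le zero    = le 1
      heights F le (suc i) = totLe-+ (le (suc (suc i))) (heights (tail F) (λ j → le (suc j)) i)

    -- A coefficient of index i, or of total degree t, comes from one of index at least i q, or of
    -- total degree at least t q. Thus bounds are divided by q and rounded down, and d′ < (d+1) q is
    -- what is needed for the quotient to be at most d.
    polyLe-section : ∀ {d h d′ h′} {F : Seq} q r (e : Vec ℕ n) → d′ < suc d ℕ.* q → h′ < suc h ℕ.* q → PolyLe d′ h′ F →
                     PolyLe d h (λ i → section q e (F (index q r i)))
    polyLe-section {d} {h} {d′} {h′} {F} q r e d′< h′< le .degree i d<i = coeffwise (λ v → coeff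
      (degree le (index q r i) (ℕₚ.<-≤-trans d′< (ℕₚ.≤-trans (ℕₚ.*-monoˡ-≤ q d<i) (index-≥ q r i)))) (spread q e v))
    polyLe-section q r e d′< h′< le .height i v h<v = height le (index q r i) (spread q e v)
      (ℕₚ.<-≤-trans h′< (ℕₚ.≤-trans (ℕₚ.*-monoˡ-≤ q h<v) (totalDeg-spread q e v)))

    Coefficient : ℕ → Seq → Set
    Coefficient d F = Σ ℕ λ i → Σ (Vec ℕ n) λ v → i ≤ d × ¬ (F i v ≈ₚ + 0)

    -- Decidable because the bounds leave finitely many coefficients to test; this is what
    -- distinguishes polynomials from series here.
    zero-or-coefficient : ∀ {d h F} → PolyLe d h F → F ≋ 0ₛ ⊎ Coefficient d F
    zero-or-coefficient {d} {h} {F} le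
      with any? (λ (i , v) → ¬? (F i v ≈ₚ? + 0)) (monomials n d h)
    ... | yes found with find found
    ...   | (i , v) , iv∈ , Fiv≉0 = inj₂ (i , v , monomials-≤ iv∈ , Fiv≉0)
    zero-or-coefficient {d} {h} {F} le | no none = inj₁ (pointwise (λ i → coeffwise (vanish i)))
      where
      vanish : ∀ i v → F i v ≈ₚ + 0
      vanish i v with d ℕ.<? i | h ℕ.<? totalDeg v
      ... | yes d<i | _       = coeff (degree le i d<i) v
      ... | no  _   | yes h<v = height le i v h<v
      ... | no  d≮i | no  h≮v = decidable-stable (F i v ≈ₚ? + 0)
        (λ Fiv≉0 → none (lose (∈-monomials (ℕₚ.≮⇒≥ d≮i) (ℕₚ.≮⇒≥ h≮v)) Fiv≉0))

    nonzero-coefficient : ∀ {d h F} → PolyLe d h F → Nonzero F → Coefficient d F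
    nonzero-coefficient le F≉0 with zero-or-coefficient le
    ... | inj₁ F≈0 = ⊥-elim (F≉0 F≈0)
    ... | inj₂ c   = c

    nonzero : ∀ {F} i v → ¬ (F i v ≈ₚ + 0) → Nonzero F
    nonzero i v Fiv≉0 F≈0 = Fiv≉0 (coeff (at F≈0 i) v)

    nonzero-conv : ∀ {F G} → Nonzero F → Nonzero G → Nonzero (conv F G)
    nonzero-conv F≉0 G≉0 FG≈0 = G≉0 (IsDomain.cancel0 (seqDomain (series n) (seriesDomain n)) FG≈0 F≉0)

    nonzero-one : Nonzero (const (oneS (𝔽-raw p)))
    nonzero-one = nonzero 0 (Vec.replicate n 0) (≡.subst (λ a → ¬ (a ≈ₚ + 0)) (≡.sym (one n)) 1≉0)
      where
      one : ∀ n → oneS (𝔽-raw p) (Vec.replicate n 0) ≡ + 1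
      one zero    = ≡.refl
      one (suc n) = one n

    nonzero-^ : ∀ {F} k → Nonzero F → Nonzero (F ^ₛ k)
    nonzero-^ zero    F≉0 = nonzero-one
    nonzero-^ (suc k) F≉0 = nonzero-conv F≉0 (nonzero-^ k F≉0)

  p>1 : 1 < p
  p>1 = ℕ.nonTrivial⇒n>1 p {{prime⇒nonTrivial p-prime}}

  -- An annihilator of small degree and small height

  module _ {n : ℕ} where
    open P n

    Vanishes : (d : ℕ) (F : ℕ → Vec ℕ n → ℤ) (g : Vec ℕ n → ℤ) → Set
    Vanishes d F g = ev d F g ≈ₛ (λ _ → + 0)

    section-vanishes : ∀ k (e : Vec ℕ n) → All (_< p ℕ.^ k) e → ∀ d F g →
      Vanishes d F (g ^^ (p ℕ.^ k)) → Vanishes d (λ i → section (p ℕ.^ k) e (F i)) g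
    section-vanishes k e e<q d F g F≈0 = coeffwise (λ v →
      K.trans (K.sym (coeff (section-ev k e e<q d F g) v)) (coeff F≈0 (spread (p ℕ.^ k) e v)))

    module _ (g : Vec ℕ n → ℤ) where

      -- With q a large power of p, A^(q-1) B is divisible by (X - g)^q = X^q - g^q, so each of its sections kills g;
      -- the bounds of a section are the bounds of A^(q-1) B divided by q.
      lower-height : ∀ {d m h k A B} → h ≤ k →
        PolyLe (suc d) (suc k) A → Nonzero A → Vanishes (suc d) A g →
        PolyLe m h B → Nonzero B → Vanishes m B g →
        Σ (ℕ → Vec ℕ n → ℤ) λ A′ → PolyLe (suc d) k A′ × Nonzero A′ × Vanishes (suc d) A′ g
      lower-height {d} {m} {h} {k} {A} {B} h≤k leA A≉0 A[g]≈0 leB B≉0 B[g]≈0 =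
        A′ , polyLe-section q r e d-small h-small leF , A′≉0 , A′[g]≈0
        where
        q q′ : ℕ
        -- The exponent m, the degree bound of B, makes q exceed m, which is the largeness required
        -- by `d-small` and `small`.
        q = p ℕ.^ m
        q′ = ℕ.pred q
        m<q : m < q
        m<q = n<m^n p>1 m
        instance
          q≢0 : ℕ.NonZero q
          q≢0 = ℕ.>-nonZero (ℕₚ.≤-<-trans z≤n m<q)
        q≡ : q ≡ suc q′
        q≡ = ≡.sym (ℕₚ.suc-pred q)
        F : ℕ → Vec ℕ n → ℤ
        F = conv (A ^ₛ q′) B
        leF : PolyLe (q′ ℕ.* suc d ℕ.+ m) (q′ ℕ.* suc k ℕ.+ h) F
        leF = polyLe-conv (polyLe-^ q′ leA) leB
        d-small : q′ ℕ.* suc d ℕ.+ m < suc (suc d) ℕ.* q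
        d-small = begin-strict
          q′ ℕ.* suc d ℕ.+ m  <⟨ ℕₚ.+-mono-≤-< (ℕₚ.*-monoˡ-≤ (suc d) (ℕₚ.pred[n]≤n {q})) m<q ⟩
          q ℕ.* suc d ℕ.+ q   ≡⟨ ≡.trans (ℕₚ.+-comm _ q) (≡.cong (q ℕ.+_) (ℕₚ.*-comm q (suc d))) ⟩
          suc (suc d) ℕ.* q   ∎
          where open ℕₚ.≤-Reasoning
        -- Here h ≤ k enters: replacing one of q factors of height k + 1 by B takes the total below
        -- q (k+1), so that the section has height at most k.
        h-small : q′ ℕ.* suc k ℕ.+ h < suc k ℕ.* q
        h-small = begin-strict
          q′ ℕ.* suc k ℕ.+ h      <⟨ ℕₚ.+-monoʳ-< (q′ ℕ.* suc k) (s≤s h≤k) ⟩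
          q′ ℕ.* suc k ℕ.+ suc k  ≡⟨ ℕₚ.+-comm _ (suc k) ⟩
          suc q′ ℕ.* suc k        ≡⟨ ≡.cong (ℕ._* suc k) q≡ ⟨
          q ℕ.* suc k             ≡⟨ ℕₚ.*-comm q (suc k) ⟩
          suc k ℕ.* q             ∎
          where open ℕₚ.≤-Reasoning
        -- A^(q-1) B is not zero; the residues of one of its nonzero coefficients select a section
        -- that is not zero.
        witness : Coefficient (q′ ℕ.* suc d ℕ.+ m) F
        witness = nonzero-coefficient leF (nonzero-conv (nonzero-^ q′ A≉0) B≉0)
        i r : ℕ
        i = proj₁ witness
        r = i % q
        v e : Vec ℕ n
        v = proj₁ (proj₂ witness)
        e = residue q v
        A′ : ℕ → Vec ℕ n → ℤ
        A′ b = section q e (F (index q r b))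
        A′≉0 : Nonzero A′
        A′≉0 = nonzero (i / q) (Vec.map (_/ q) v)
          (≡.subst₂ (λ j w → ¬ (F j w ≈ₚ + 0)) (≡.sym (index-divMod q i)) (≡.sym (spread-divMod q v)) (proj₂ (proj₂ (proj₂ witness))))
        small : q′ ℕ.* d ℕ.+ ℕ.pred m < suc d ℕ.* q
        small = begin-strict
          q′ ℕ.* d ℕ.+ ℕ.pred m  <⟨ ℕₚ.+-mono-≤-< (ℕₚ.*-monoˡ-≤ d (ℕₚ.pred[n]≤n {q})) (ℕₚ.≤-<-trans ℕₚ.pred[n]≤n m<q) ⟩
          q ℕ.* d ℕ.+ q          ≡⟨ ≡.trans (ℕₚ.+-comm _ q) (≡.cong (q ℕ.+_) (ℕₚ.*-comm q d)) ⟩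
          suc d ℕ.* q            ∎
          where open ℕₚ.≤-Reasoning
        A′[g]≈0 : Vanishes (suc d) A′ g
        A′[g]≈0 = section-vanishes m e (residue< q v) (suc d) (λ b → F (index q r b)) g
          (C.Power.mixed-power-vanish n m q≡ {d = suc d} (m%n<n i q) (degree leA) A[g]≈0 (degree leB) B[g]≈0 small)

      reduce-height : ∀ k {d m h A B} →
        PolyLe (suc d) k A → Nonzero A → Vanishes (suc d) A g →
        PolyLe m h B → Nonzero B → Vanishes m B g →
        Σ (ℕ → Vec ℕ n → ℤ) λ P → PolyLe (suc d) h P × Nonzero P × Vanishes (suc d) P g
      reduce-height zero    {A = A} leA A≉0 A[g]≈0 leB B≉0 B[g]≈0 = A , polyLe-mono ℕₚ.≤-refl z≤n leA , A≉0 , A[g]≈0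
      reduce-height (suc k) {d} {m} {h} {A} {B} leA A≉0 A[g]≈0 leB B≉0 B[g]≈0 = cases (h ℕ.≤? k)
        where
        Reduced : ℕ → Set
        Reduced h = Σ (ℕ → Vec ℕ n → ℤ) λ P → PolyLe (suc d) h P × Nonzero P × Vanishes (suc d) P g
        continue : Reduced k → Reduced h
        continue (A′ , leA′ , A′≉0 , A′[g]≈0) = reduce-height k leA′ A′≉0 A′[g]≈0 leB B≉0 B[g]≈0
        cases : Dec (h ≤ k) → Reduced h
        cases (no h≰k)  = A , polyLe-mono ℕₚ.≤-refl (ℕₚ.≰⇒> h≰k) leA , A≉0 , A[g]≈0
        cases (yes h≤k) = continue (lower-height h≤k leA A≉0 A[g]≈0 leB B≉0 B[g]≈0)

  -- Candidates of smaller degree for a multiple root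

  module _ {n : ℕ} where
    open P n
    open import Algebra.Properties.Semiring.Mult (S.semiring n) using () renaming (_×_ to _×ₛ_)

    deriv-zero⇒sparse : ∀ {F} → deriv F ≋ 0ₛ → ∀ j → p ∤ j → F j ≈ₛ (λ _ → + 0)
    deriv-zero⇒sparse          F′≈0 zero    p∤j = ⊥-elim (p∤j (divides 0 ≡.refl))
    deriv-zero⇒sparse {F} F′≈0 (suc j) p∤j = coeffwise (λ v → IsDomain.cancel0 𝔽-domain {+ suc j}
      (K.trans (≡⇒≈ₚ (≡.trans (≡.sym (×≡* (suc j) (F (suc j) v))) (≡.sym (pull (suc j) v))))
        (coeff (S.trans n (S.sym n (deriv-coeff F j)) (at F′≈0 j)) v))
      (λ j≈0 → p∤j (≈0⇒∣ j≈0)))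
      where
      pull : ∀ k v → (k ×ₛ F (suc j)) v ≡ k ×ₖ F (suc j) v
      pull zero    v = ≡.refl
      pull (suc k) v = ≡.cong (λ x → F (suc j) v ℤ.+ x) (pull k v)

    module _ (g : Vec ℕ n → ℤ) {d h : ℕ} {P : Seq} (leP : PolyLe (suc d) h P) where

      -- The candidate is chosen by looking at P alone; that g is a multiple root of P appears only
      -- as a hypothesis of its last component.
      NextCandidate : Set
      NextCandidate = Σ (ℕ → Vec ℕ n → ℤ) λ P′ → PolyLe d h P′ × Nonzero P′ ×
        (Vanishes (suc d) P g → Vanishes d (deriv P) g → Vanishes d P′ g)

      -- P is a polynomial in X^p, so P(g) is a sum of monomials times p-th powers of the values of sections of P.
      sparse-candidate : deriv P ≋ 0ₛ → ∀ {i b} v → i ≡ b ℕ.* p ℕ.^ 1 → ¬ (P i v ≈ₚ + 0) → NextCandidate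
      sparse-candidate P′≈0 {i} {b} v i≡ Piv≉0 = R , polyLe-section q 0 e d-small h-small leP , R≉0 , λ P[g]≈0 _ → R[g]≈0 P[g]≈0
        where
        q q′ : ℕ
        -- Written as a power so that the results on sections modulo `p ^ k` apply with k = 1.
        q = p ℕ.^ 1
        q′ = ℕ.pred q
        q>1 : 1 < q
        q>1 = ≡.subst (1 <_) (≡.sym (ℕₚ.^-identityʳ p)) p>1
        instance
          q≢0 : ℕ.NonZero q
          q≢0 = ℕ.>-nonZero (ℕₚ.<-trans (s≤s z≤n) q>1)
        e : Vec ℕ n
        e = residue q v
        R : ℕ → Vec ℕ n → ℤ
        R j = section q e (P (index q 0 j))
        -- As q > 1, degree d + 1 divided by q is at most d, so the degree drops.
        d-small : suc d < suc d ℕ.* q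
        d-small = ℕₚ.m<m*n (suc d) q q>1
        h-small : h < suc h ℕ.* q
        h-small = ℕₚ.<-trans (ℕₚ.n<1+n h) (ℕₚ.m<m*n (suc h) q q>1)
        R≉0 : Nonzero R
        R≉0 = nonzero b (Vec.map (_/ q) v)
          (≡.subst₂ (λ j w → ¬ (P j w ≈ₚ + 0)) (≡.trans i≡ (≡.sym (index≡ q 0 b))) (≡.sym (spread-divMod q v)) Piv≉0)
        sparse : ∀ j → q ∤ j → P j ≈ₛ (λ _ → + 0)
        sparse j q∤j = deriv-zero⇒sparse P′≈0 j (λ p∣j → q∤j (≡.subst (_∣ j) (≡.sym (ℕₚ.^-identityʳ p)) p∣j))
        -- The largest residue q - 1 is taken in `ev-sparse` so that its cut-off d q + q - 1 reaches
        -- d + 1 even when d = 0.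
        enough : suc d ≤ index q q′ d
        enough = ≡.subst (suc d ≤_) (≡.sym (index≡ q q′ d)) (ℕₚ.+-mono-≤ (ℕₚ.≤-pred (≡.subst (2 ≤_) (≡.sym (ℕₚ.suc-pred q)) q>1))
          (ℕₚ.m≤m*n d q))
        R[g]≈0 : Vanishes (suc d) P g → Vanishes d R g
        R[g]≈0 P[g]≈0 = section-vanishes 1 e (residue< q v) d (λ j → P (index q 0 j)) g
          (S.trans n (S.sym n (ev-sparse {q} {q′} (ℕₚ.≤-reflexive (ℕₚ.suc-pred q)) d P g sparse))
                     (S.trans n (ev-extend-≤ {suc d} {index q q′ d} P g (degree leP) enough) P[g]≈0))

      next-candidate : Nonzero P → NextCandidate
      next-candidate P≉0 = by-derivative (zero-or-coefficient (polyLe-deriv leP))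
        where
        by-divisibility : deriv P ≋ 0ₛ → ∀ i v → ¬ (P i v ≈ₚ + 0) → Dec (p ℕ.^ 1 ∣ i) → NextCandidate
        by-divisibility P′≈0 i v Piv≉0 (yes (divides b i≡)) = sparse-candidate P′≈0 {b = b} v i≡ Piv≉0
        by-divisibility P′≈0 i v Piv≉0 (no q∤i) = ⊥-elim (Piv≉0 (coeff (deriv-zero⇒sparse P′≈0 i
          (λ p∣i → q∤i (≡.subst (_∣ i) (≡.sym (ℕₚ.^-identityʳ p)) p∣i))) v))
        by-derivative : deriv P ≋ 0ₛ ⊎ Coefficient d (deriv P) → NextCandidate
        by-derivative (inj₂ (i , v , _ , P′iv≉0)) =
          deriv P , polyLe-deriv leP , nonzero i v P′iv≉0 , λ _ P′[g]≈0 → P′[g]≈0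
        by-derivative (inj₁ P′≈0) = by-coefficient (nonzero-coefficient leP P≉0)
          where
          by-coefficient : Coefficient (suc d) P → NextCandidate
          by-coefficient (i , v , _ , Piv≉0) = by-divisibility P′≈0 i v Piv≉0 (p ℕ.^ 1 ∣? i)

  -- Finite sums and linear combinations over the prime field

  open import Algebra.Properties.Semiring.Sum K.semiring public
    using (sum; sum-cong-≋; sum-remove; ∑-distrib-+; ∑-comm; *-distribˡ-sum; *-distribʳ-sum; sum-replicate-zero)
  open LinearAlgebra 𝔽 (𝔽-domain) (λ a → a ≈ₚ? + 0) 1≉0 public using (dot; dot-zeroʳ; nontrivial-solution)

  sum-zero : ∀ {m} {t : Fin m → ℤ} → (∀ j → t j ≈ₚ + 0) → sum t ≈ₚ + 0
  sum-zero {m} t≈0 = K.trans (sum-cong-≋ t≈0) (sum-replicate-zero m)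

  sum-single : ∀ {m} (t : Fin m → ℤ) i → (∀ j → ¬ j ≡ i → t j ≈ₚ + 0) → sum t ≈ₚ t i
  sum-single {suc m} t i t≈0 = K.trans (sum-remove {i = i} t)
    (K.trans (K.+-congˡ {t i} (sum-zero {m} (λ j → t≈0 (punchIn i j) (Finₚ.punchInᵢ≢i i j)))) (K.+-identityʳ (t i)))

  dot-single : ∀ {m} (c φ : Fin m → ℤ) i → φ i ≡ + 1 → (∀ j → ¬ j ≡ i → φ j ≡ + 0) → dot c φ ≈ₚ c i
  dot-single c φ i φi≡1 φj≡0 = K.trans (sum-single (λ j → c j ℤ.* φ j) i
      (λ j j≢i → ≡⇒≈ₚ (≡.trans (≡.cong (λ a → c j ℤ.* a) (φj≡0 j j≢i)) (ℤₚ.*-zeroʳ (c j)))))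
    (≡⇒≈ₚ (≡.trans (≡.cong (λ a → c i ℤ.* a) φi≡1) (ℤₚ.*-identityʳ (c i))))

  sum-split : ∀ b r (f : ℕ → ℤ) →
    sum {b ℕ.+ r} (λ i → f (toℕ i)) ≈ₚ sum {b} (λ i → f (toℕ i)) ℤ.+ sum {r} (λ i → f (b ℕ.+ toℕ i))
  sum-split zero    r f = K.sym (K.+-identityˡ _)
  sum-split (suc b) r f = K.trans (K.+-congˡ {f 0} (sum-split b r (λ i → f (suc i)))) (K.sym (K.+-assoc (f 0) _ _))

  sum-blocks : ∀ b t (f : ℕ → ℤ) →
    sum {t ℕ.* b} (λ l → f (toℕ l)) ≈ₚ sum {t} (λ i → sum {b} (λ e → f (index b (toℕ e) (toℕ i))))
  sum-blocks b zero    f = K.refl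
  sum-blocks b (suc t) f = K.trans (sum-split b (t ℕ.* b) f)
    (K.+-congˡ {sum {b} (λ i → f (toℕ i))} (sum-blocks b t (λ l → f (b ℕ.+ l))))

  module _ {n : ℕ} where
    open P n

    comb : ∀ {m} → (Fin m → ℤ) → (Fin m → Vec ℕ n → ℤ) → Vec ℕ n → ℤ
    comb c σ v = dot c (λ u → σ u v)

    comb-cong : ∀ {m} (c : Fin m → ℤ) {σ τ} → (∀ u → σ u ≈ₛ τ u) → comb c σ ≈ₛ comb c τ
    comb-cong c σ≈τ = coeffwise (λ v → sum-cong-≋ (λ u → K.*-congˡ {c u} (coeff (σ≈τ u) v)))

    comb-+ : ∀ {m} (c : Fin m → ℤ) σ τ v → comb c (λ u w → σ u w ℤ.+ τ u w) v ≈ₚ comb c σ v ℤ.+ comb c τ v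
    comb-+ c σ τ v = K.trans (sum-cong-≋ (λ u → K.distribˡ (c u) (σ u v) (τ u v)))
      (∑-distrib-+ (λ u → c u ℤ.* σ u v) (λ u → c u ℤ.* τ u v))

    open EvaluationCongruence.Scaling (𝔽-raw p) ℤₚ.*-assoc ℤₚ.*-distribˡ-+ using (mulS-scale)

    comb-⋆ : ∀ {m} (c : Fin m → ℤ) σ f → comb c σ ⋆ f ≈ₛ comb c (λ u → σ u ⋆ f)
    comb-⋆ {zero}  c σ f = S.zeroˡ n f
    comb-⋆ {suc m} c σ f = S.trans n
      (S.distribʳ n f (λ v → c Fin.zero ℤ.* σ Fin.zero v) (comb (λ u → c (Fin.suc u)) (λ u → σ (Fin.suc u))))
      (coeffwise (λ v → K.+-cong {((λ w → c Fin.zero ℤ.* σ Fin.zero w) ⋆ f) v} {c Fin.zero ℤ.* (σ Fin.zero ⋆ f) v} (≡⇒≈ₚ (mulS-scale (c Fin.zero) (σ Fin.zero) f v))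
        (coeff (comb-⋆ (λ u → c (Fin.suc u)) (λ u → σ (Fin.suc u)) f) v)))

    ⋆-comb : ∀ {m} (c : Fin m → ℤ) σ f → f ⋆ comb c σ ≈ₛ comb c (λ u → f ⋆ σ u)
    ⋆-comb c σ f = S.trans n (S.*-comm n f (comb c σ))
      (S.trans n (comb-⋆ c σ f) (comb-cong c (λ u → S.*-comm n (σ u) f)))

    ev-comb : ∀ {m} (c : Fin m → ℤ) d (F : Fin m → Seq) g →
      ev d (λ i → comb c (λ u → F u i)) g ≈ₛ comb c (λ u → ev d (F u) g)
    ev-comb c zero    F g = S.refl n
    ev-comb c (suc d) F g = coeffwise (λ v → K.trans
      (K.+-congˡ {comb c (λ u → F u 0) v} (coeff (S.trans n (S.*-congˡ n {g} (ev-comb c d (λ u → tail (F u)) g))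
                                                            (⋆-comb c (λ u → ev d (tail (F u)) g) g)) v))
      (K.sym (comb-+ c (λ u → F u 0) (λ u → g ⋆ ev d (tail (F u)) g) v)))

    comb-zero : ∀ {m} (c : Fin m → ℤ) σ v → (∀ u → σ u v ≈ₚ + 0) → comb c σ v ≈ₚ + 0
    comb-zero c σ v σ≈0 = dot-zeroʳ c σ≈0

    -- The polynomial f Y^k.
    single : ℕ → (Vec ℕ n → ℤ) → Seq
    single zero    f = const f
    single (suc k) f = 0ₛ 0 ◂ single k f

    single-diagonal : ∀ k f → single k f k ≡ f
    single-diagonal zero    f = ≡.refl
    single-diagonal (suc k) f = single-diagonal k f

    single-off : ∀ k f i → ¬ i ≡ k → single k f i ≡ (λ _ → + 0)
    single-off zero    f zero    i≢k = ⊥-elim (i≢k ≡.refl)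
    single-off zero    f (suc i) i≢k = ≡.refl
    single-off (suc k) f zero    i≢k = ≡.refl
    single-off (suc k) f (suc i) i≢k = single-off k f i (λ e → i≢k (≡.cong suc e))

    ev-single : ∀ {k m} f g → k ≤ m → ev m (single k f) g ≈ₛ f ⋆ g ^^ k
    ev-single {zero}  {m} f g _         = S.trans n (ev-const m f g) (S.sym n (S.*-identityʳ n f))
    ev-single {suc k} {suc m} f g (s≤s k≤m) = S.trans n (S.+-identityˡ n _)
      (S.trans n (S.*-congˡ n {g} (ev-single f g k≤m)) (swap g f (g ^^ k)))
      where
      swap : ∀ x y z → x ⋆ (y ⋆ z) ≈ₛ y ⋆ (x ⋆ z)
      swap x y z = S.trans n (S.sym n (S.*-assoc n x y z)) (S.trans n (S.*-congʳ n {z} (S.*-comm n x y)) (S.*-assoc n y x z))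

    conv-single-≥ : ∀ k f G i → conv (single k f) G (k ℕ.+ i) ≈ₛ f ⋆ G i
    conv-single-≥ zero    f G i = conv-constˡ f G i
    conv-single-≥ (suc k) f G i = S.trans n (S.+-congʳ n (S.zeroˡ n (G (suc (k ℕ.+ i)))))
      (S.trans n (S.+-identityˡ n _) (conv-single-≥ k f G i))

    conv-single-< : ∀ k f G i → i < k → conv (single k f) G i ≈ₛ (λ _ → + 0)
    conv-single-< (suc k) f G zero    _         = S.zeroˡ n (G 0)
    conv-single-< (suc k) f G (suc i) (s≤s i<k) = S.trans n (S.+-congʳ n (S.zeroˡ n (G (suc i))))
      (S.trans n (S.+-identityˡ n _) (conv-single-< k f G i i<k))

  monomial : ℕ → Vec ℕ 1 → ℤ
  monomial a (i ∷ v) = single {0} a (oneS (𝔽-raw p)) i v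

  monomial-⋆-≥ : ∀ a f i → (monomial a ⋆ f) ((a ℕ.+ i) ∷ []) ≈ₚ f (i ∷ [])
  monomial-⋆-≥ a f i = K.trans (≡⇒≈ₚ (⋆-conv (monomial a) f (a ℕ.+ i) []))
    (coeff (S.trans 0 (conv-single-≥ a (oneS (𝔽-raw p)) (curry f) i) (S.*-identityˡ 0 (curry f i))) [])

  monomial-⋆-< : ∀ a f i → i < a → (monomial a ⋆ f) (i ∷ []) ≈ₚ + 0
  monomial-⋆-< a f i i<a = K.trans (≡⇒≈ₚ (⋆-conv (monomial a) f i []))
    (coeff (conv-single-< a (oneS (𝔽-raw p)) (curry f) i i<a) [])

  δ-term-zero : ∀ i j a → ¬ i ≡ j → δ i j ℤ.* a ≈ₚ + 0
  δ-term-zero i j a i≢j = ≡⇒≈ₚ (≡.trans (≡.cong (ℤ._* a) (δ-≢ i j i≢j)) (ℤₚ.*-zeroˡ a))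

  -- By Frobenius and Fermat f^q = f(x^q). Every l with a + q l = M is at most M, so any range B > M
  -- catches it.
  monomial-power : ∀ k a f {M B} → M < B →
    (monomial a ⋆ f ^^ (p ℕ.^ k)) (M ∷ []) ≈ₚ sum {B} (λ l → δ M (a ℕ.+ p ℕ.^ k ℕ.* toℕ l) ℤ.* f (toℕ l ∷ []))
  monomial-power k a f {M} {B} M<B with a ℕ.≤? M
  ... | no a≰M = K.trans (monomial-⋆-< a (f ^^ (p ℕ.^ k)) M (ℕₚ.≰⇒> a≰M)) (K.sym (sum-zero {B} (λ l →
        δ-term-zero M (a ℕ.+ p ℕ.^ k ℕ.* toℕ l) (f (toℕ l ∷ [])) (λ e → a≰M (≡.subst (a ≤_) (≡.sym e) (ℕₚ.m≤m+n a _))))))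
  -- Write M - a = r + l q. For r = 0 only the summand l survives; for r > 0 both sides are zero.
  ... | yes a≤M = ≡.subst (λ M → M < B → (monomial a ⋆ f ^^ q) (M ∷ []) ≈ₚ RHS M)
        (≡.trans (≡.cong (a ℕ.+_) (index-divMod q M′)) (ℕₚ.m+[n∸m]≡n a≤M)) (shifted (M′ % q) (m%n<n M′ q) (M′ / q)) M<B
    where
    q M′ : ℕ
    q = p ℕ.^ k
    M′ = M ℕ.∸ a
    instance
      q≢0 : ℕ.NonZero q
      q≢0 = ℕ.>-nonZero (C.Power.q>0 0 k)
    RHS : ℕ → ℤ
    RHS M = sum {B} (λ l → δ M (a ℕ.+ q ℕ.* toℕ l) ℤ.* f (toℕ l ∷ []))
    term-zero : ∀ M (l : Fin B) → ¬ M ≡ a ℕ.+ q ℕ.* toℕ l → δ M (a ℕ.+ q ℕ.* toℕ l) ℤ.* f (toℕ l ∷ []) ≈ₚ + 0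
    term-zero M l = δ-term-zero M (a ℕ.+ q ℕ.* toℕ l) (f (toℕ l ∷ []))
    index≡* : ∀ l → index q 0 l ≡ q ℕ.* l
    index≡* l = ≡.trans (index≡ q 0 l) (ℕₚ.*-comm l q)
    shifted : ∀ r → r < q → ∀ l → (a ℕ.+ index q r l) < B →
              (monomial a ⋆ f ^^ q) ((a ℕ.+ index q r l) ∷ []) ≈ₚ RHS (a ℕ.+ index q r l)
    shifted zero r<q l l<B = K.trans (monomial-⋆-≥ a (f ^^ q) (index q 0 l))
      (K.trans (coeff (PowerSeries.at (curry-^ f q) (index q 0 l)) [])
      (K.trans (coeff (C.Power.^q-coeff-index 0 k (curry f) l) [])
      (K.trans (≡⇒≈ₚ (^-constant (curry f l) q))
      (K.trans (fermat-^ k (f (l ∷ [])))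
      (K.sym (K.trans (sum-single _ l′ (λ j j≢l′ → term-zero _ j (λ e → j≢l′ (Finₚ.toℕ-injective
                 (≡.trans (≡.sym (ℕₚ.*-cancelˡ-≡ l (toℕ j) q (≡.trans (≡.sym (index≡* l)) (ℕₚ.+-cancelˡ-≡ a _ _ e))))
                          (≡.sym (Finₚ.toℕ-fromℕ< l<B′)))))))
        (≡⇒≈ₚ (≡.trans (≡.cong₂ ℤ._*_ one (≡.cong (λ i → f (i ∷ [])) (Finₚ.toℕ-fromℕ< l<B′))) (ℤₚ.*-identityˡ _)))))))))
      where
      l<B′ : l < B
      l<B′ = ℕₚ.≤-<-trans (ℕₚ.≤-trans (ℕₚ.m≤m*n l q) (ℕₚ.≤-trans (index-≥ q 0 l) (ℕₚ.m≤n+m _ a))) l<B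
      l′ : Fin B
      l′ = Fin.fromℕ< l<B′
      one : δ (a ℕ.+ index q 0 l) (a ℕ.+ q ℕ.* toℕ l′) ≡ + 1
      one = ≡.trans (≡.cong (λ i → δ (a ℕ.+ index q 0 l) (a ℕ.+ i))
              (≡.trans (≡.cong (q ℕ.*_) (Finₚ.toℕ-fromℕ< l<B′)) (≡.sym (index≡* l)))) (δ-refl (a ℕ.+ index q 0 l))
    shifted (suc r) r<q l l<B = K.trans (monomial-⋆-≥ a (f ^^ q) (index q (suc r) l))
      (K.trans (coeff (PowerSeries.at (curry-^ f q) (index q (suc r) l)) [])
      (K.trans (coeff (C.Power.^q-coeff-off 0 k (curry f) l (s≤s z≤n) r<q) [])
      (K.sym (sum-zero (λ j → term-zero _ j (λ e → remainder (toℕ j) (ℕₚ.+-cancelˡ-≡ a _ _ e)))))))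
      where
      remainder : ∀ j → ¬ index q (suc r) l ≡ q ℕ.* j
      remainder j e = ℕₚ.1+n≢0 (≡.trans (≡.sym (m<n⇒m%n≡m r<q)) (≡.trans (≡.sym ([m+kn]%n≡m%n (suc r) l q))
        (≡.trans (≡.cong (_% q) (≡.trans (≡.sym (index≡ q (suc r) l)) e)) (≡.trans (≡.cong (_% q) (ℕₚ.*-comm q j)) (m*n%n≡0 j q)))))

  monomial-self : ∀ a → monomial a (a ∷ []) ≡ + 1
  monomial-self a = ≡.cong (λ f → f []) (single-diagonal {0} a (oneS (𝔽-raw p)))

  monomial-off : ∀ a i → ¬ i ≡ a → monomial a (i ∷ []) ≡ + 0
  monomial-off a i i≢a = ≡.cong (λ f → f []) (single-off {0} a (oneS (𝔽-raw p)) i i≢a)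

  p^-injective : ∀ i k → p ℕ.^ i ≡ p ℕ.^ k → i ≡ k
  p^-injective i k e with ℕₚ.<-cmp i k
  ... | tri< i<k _ _ = ⊥-elim (ℕₚ.<⇒≢ (ℕₚ.^-monoʳ-< p p>1 i<k) e)
  ... | tri≈ _ i≡k _ = i≡k
  ... | tri> _ _ i>k = ⊥-elim (ℕₚ.<⇒≢ (ℕₚ.^-monoʳ-< p p>1 i>k) (≡.sym e))

  replicate⁺ : ∀ {q e} n → e < q → All (_< q) (Vec.replicate n e)
  replicate⁺ zero    e<q = []
  replicate⁺ (suc n) e<q = e<q ∷ replicate⁺ n e<q

  -- The relation attached to a simple root

  module _ {n : ℕ} where
    open P n

    section-ev-≈ : ∀ k (e : Vec ℕ n) → All (_< p ℕ.^ k) e → ∀ d F g {r} →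
      ev d F (g ^^ (p ℕ.^ k)) ≈ₛ r → ev d (λ i → section (p ℕ.^ k) e (F i)) g ≈ₛ section (p ℕ.^ k) e r
    section-ev-≈ k e e<q d F g F≈r = coeffwise (λ v →
      K.trans (K.sym (coeff (section-ev k e e<q d F g) v)) (coeff F≈r (spread (p ℕ.^ k) e v)))

    module Relation (g : Vec ℕ n → ℤ) {m h : ℕ} {P : Seq} (leP : PolyLe (suc m) h P)
      (N : ℕ) (N≡ : suc (suc m) ℕ.* suc h ℕ.^ n ≡ N) where

      H B d : ℕ
      d = suc m
      -- H bounds the degrees of the unknown polynomials c_j and is dictated by `unknowns-exceed`; B
      -- exceeds all positions a u + p^(j u) e, so only M < B give proper equations.
      H = N ℕ.* p ℕ.^ N
      B = H ℕ.+ p ℕ.^ N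

      W : Vec ℕ n → ℤ
      W = ev m (deriv P) g

      numerator : ℕ → Seq
      numerator k = conv (conv X (deriv P)) (P ^ₛ ℕ.pred (p ℕ.^ k))

      -- The residue p^k - 1 in Y picks out the coefficient of (Y - g)^(p^k - 1). All variables x_i
      -- get the same residue e, since only such sections meet the diagonal.
      Q : ℕ → ℕ → Seq
      Q k e i = section (p ℕ.^ k) (Vec.replicate n e) (numerator k (index (p ℕ.^ k) (ℕ.pred (p ℕ.^ k)) i))

      s : ℕ → ℕ → Vec ℕ n → ℤ
      s k e = section (p ℕ.^ k) (Vec.replicate n e) g

      p^≡ : ∀ k → p ℕ.^ k ≡ suc (ℕ.pred (p ℕ.^ k))
      p^≡ k = ≡.sym (ℕₚ.suc-pred (p ℕ.^ k) {{ℕ.>-nonZero (C.Power.q>0 0 k)}})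

      -- X P′ P^(q-1) has degree at most d + (q-1) d = q d and height at most q h, and the section
      -- divides both by q.
      polyLe-Q : ∀ k e → PolyLe d h (Q k e)
      polyLe-Q k e = polyLe-section (p ℕ.^ k) (ℕ.pred (p ℕ.^ k)) (Vec.replicate n e) (small d) (small h)
        (polyLe-conv (polyLe-conv polyLe-X (polyLe-deriv leP)) (polyLe-^ (ℕ.pred (p ℕ.^ k)) leP))
        where
        small : ∀ a → a ℕ.+ ℕ.pred (p ℕ.^ k) ℕ.* a < suc a ℕ.* p ℕ.^ k
        small a = ≡.subst (_< suc a ℕ.* p ℕ.^ k) (≡.trans (ℕₚ.*-comm a (p ℕ.^ k)) (≡.cong (ℕ._* a) (p^≡ k)))
          (ℕₚ.*-monoˡ-< (p ℕ.^ k) {{ℕ.>-nonZero (C.Power.q>0 0 k)}} (ℕₚ.n<1+n a))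

      -- The section of g W^q is the section of g times W.
      ev-Q : ∀ k {e} → e < p ℕ.^ k → Vanishes d P g → ev d (Q k e) g ≈ₛ s k e ⋆ W
      ev-Q k {e} e<q P[g]≈0 = S.trans n
        (section-ev-≈ k (Vec.replicate n e) (replicate⁺ n e<q) d
          (λ i → numerator k (index (p ℕ.^ k) (ℕ.pred (p ℕ.^ k)) i)) g
          (C.Power.simple-root-value n k (p^≡ k) (degree leP) P[g]≈0))
        (section-^q k (Vec.replicate n e) (replicate⁺ n e<q) g W)

      -- The unknown u is the coefficient of x^(a u) Y^(p^(j u)) in the relation.  As p^(j u) block u = p^N, the coefficient
      -- of x^(a u) Δ(g)^(p^(j u)) at x^M is the sum over t of those of the diagonals of σ (M - t p^N) u at x^t.
      Unknown : Set
      Unknown = Fin (suc N ℕ.* suc H)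

      j a : Unknown → ℕ
      j u = toℕ (proj₁ (Fin.remQuot {suc N} (suc H) u))
      a u = toℕ (proj₂ (Fin.remQuot {suc N} (suc H) u))

      j≤N : ∀ u → j u ≤ N
      j≤N u = ℕₚ.≤-pred (toℕ<n (proj₁ (Fin.remQuot {suc N} (suc H) u)))

      a≤H : ∀ u → a u ≤ H
      a≤H u = ℕₚ.≤-pred (toℕ<n (proj₂ (Fin.remQuot {suc N} (suc H) u)))

      block : Unknown → ℕ
      block u = p ℕ.^ (N ℕ.∸ j u)

      position : Unknown → ℕ → ℕ
      position u l = a u ℕ.+ p ℕ.^ j u ℕ.* l

      p^j*block : ∀ u → p ℕ.^ j u ℕ.* block u ≡ p ℕ.^ N
      p^j*block u = ≡.trans (≡.sym (ℕₚ.^-distribˡ-+-* p (j u) (N ℕ.∸ j u))) (≡.cong (p ℕ.^_) (ℕₚ.m+[n∸m]≡n (j≤N u)))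

      position<B : ∀ u {e} → e < block u → position u e < B
      position<B u {e} e<b = ℕₚ.+-mono-≤-< (a≤H u) (≡.subst (p ℕ.^ j u ℕ.* e <_) (p^j*block u)
        (ℕₚ.*-monoʳ-< (p ℕ.^ j u) {{ℕ.>-nonZero (C.Power.q>0 0 (j u))}} e<b))

      -- At most one e has position u e = M, so this is a single Q or zero, and `σ` is
      -- correspondingly a single section of g or zero. The sum with deltas avoids the case
      -- distinction.
      θ : ℕ → Unknown → Seq
      θ M u i = comb {m = block u} (λ e → δ M (position u (toℕ e))) (λ e → Q (N ℕ.∸ j u) (toℕ e) i)

      σ : ℕ → Unknown → Vec ℕ n → ℤ
      σ M u = comb {m = block u} (λ e → δ M (position u (toℕ e))) (λ e → s (N ℕ.∸ j u) (toℕ e))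

      -- For each M the polynomial Σ c u θ M u is required to vanish identically, one equation for
      -- each of its at most N coefficients. Its value at g is W times the series `Z M` that has to
      -- vanish.
      equation : ℕ → ℕ × Vec ℕ n → Unknown → ℤ
      equation M (i , v) u = θ M u i v

      equations : List (Unknown → ℤ)
      equations = cartesianProductWith equation (upTo B) (monomials n d h)

      few-equations : length equations < suc N ℕ.* suc H
      few-equations = ≡.subst₂ _<_ (≡.sym length≡) (≡.sym (unknowns-exceed N (p ℕ.^ N))) (ℕₚ.m<m+n (B ℕ.* N) (s≤s z≤n))
        where
        length≡ : length equations ≡ B ℕ.* N
        length≡ = ≡.trans (length-cartesianProductWith equation (upTo B) (monomials n d h))
          (≡.cong₂ ℕ._*_ (length-upTo B) (≡.trans (length-monomials n d h) N≡))

      abstract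
        solution : Σ (Unknown → ℤ) λ c → (Σ Unknown λ u → ¬ (c u ≈ₚ + 0)) × All (λ φ → dot c φ ≈ₚ + 0) (Vec.fromList equations)
        solution = nontrivial-solution (suc N ℕ.* suc H) (Vec.fromList equations) few-equations

      c : Unknown → ℤ
      c = proj₁ solution

      θ-zero : ∀ M u i v → (B ≤ M) ⊎ (∀ e → Q (N ℕ.∸ j u) e i v ≈ₚ + 0) → θ M u i v ≈ₚ + 0
      θ-zero M u i v (inj₁ B≤M) = sum-zero {block u} (λ e → δ-term-zero M (position u (toℕ e)) (Q (N ℕ.∸ j u) (toℕ e) i v)
        (λ M≡ → ℕₚ.<⇒≱ (position<B u (toℕ<n e)) (≡.subst (B ≤_) M≡ B≤M)))
      θ-zero M u i v (inj₂ Q≈0) = comb-zero {m = block u} (λ e → δ M (position u (toℕ e))) (λ e → Q (N ℕ.∸ j u) (toℕ e) i) v (λ e → Q≈0 (toℕ e))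

      -- Conditions outside the finite list hold for every c: no position equals M when M ≥ B, and
      -- all Q are zero beyond the bounds d and h.
      solves : ∀ M i v → comb c (λ u → θ M u i) v ≈ₚ + 0
      solves M i v with M ℕ.<? B | i ℕ.≤? d | totalDeg v ℕ.≤? h
      ... | yes M<B | yes i≤d | yes v≤h = ListAll.lookup (fromList⁻ (proj₂ (proj₂ solution)))
              (∈-cartesianProductWith⁺ equation (∈-upTo⁺ M<B) (∈-monomials i≤d v≤h))
      ... | no M≮B | _ | _ = comb-zero c (λ u → θ M u i) v (λ u → θ-zero M u i v (inj₁ (ℕₚ.≮⇒≥ M≮B)))
      ... | yes _ | no i≰d | _ = comb-zero c (λ u → θ M u i) v (λ u → θ-zero M u i v (inj₂ (λ e → coeff (degree (polyLe-Q (N ℕ.∸ j u) e) i (ℕₚ.≰⇒> i≰d)) v)))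
      ... | yes _ | yes _ | no v≰h = comb-zero c (λ u → θ M u i) v (λ u → θ-zero M u i v (inj₂ (λ e → height (polyLe-Q (N ℕ.∸ j u) e) i v (ℕₚ.≰⇒> v≰h))))

      Z : ℕ → Vec ℕ n → ℤ
      Z M = comb c (σ M)

      σ-⋆ : Vanishes d P g → ∀ M u → σ M u ⋆ W ≈ₛ ev d (θ M u) g
      σ-⋆ P[g]≈0 M u = S.trans n (comb-⋆ δs (λ e → s (N ℕ.∸ j u) (toℕ e)) W)
        (S.trans n (comb-cong δs (λ e → S.sym n (ev-Q (N ℕ.∸ j u) (toℕ<n e) P[g]≈0)))
                   (S.sym n (ev-comb δs d (λ e → Q (N ℕ.∸ j u) (toℕ e)) g)))
        where
        δs : Fin (block u) → ℤ
        δs e = δ M (position u (toℕ e))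

      -- `W ⋆ Z M` is the value at g of a polynomial that is zero by `solves`. As g is a simple
      -- root, W can be cancelled.
      Z≈0 : Vanishes d P g → ¬ Vanishes m (deriv P) g → ∀ M → Z M ≈ₛ (λ _ → + 0)
      Z≈0 P[g]≈0 W≉0 M = IsDomain.cancel0 (seriesDomain n) {W} {Z M}
        (S.trans n (S.*-comm n W (Z M)) (S.trans n (comb-⋆ c (σ M) W)
          (S.trans n (comb-cong c (σ-⋆ P[g]≈0 M)) (S.trans n (S.sym n (ev-comb c d (θ M) g)) vanish)))) W≉0
        where
        vanish : ev d (λ i → comb c (λ u → θ M u i)) g ≈ₛ (λ _ → + 0)
        vanish = ev-zero d g (λ i _ → coeffwise (solves M i))

      D : Vec ℕ 1 → ℤ
      D = diag g

      μ : Unknown → ℕ → Vec ℕ 1 → ℤ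
      μ u = single (p ℕ.^ j u) (monomial (a u))

      relation : ℕ → Vec ℕ 1 → ℤ
      relation i = comb c (λ u → μ u i)

      μ-off : ∀ u i x → ¬ (i ≡ p ℕ.^ j u × x ≡ a u) → μ u i (x ∷ []) ≡ + 0
      μ-off u i x off with i ℕ.≟ p ℕ.^ j u
      ... | no i≢ = ≡.cong (λ f → f (x ∷ [])) (single-off (p ℕ.^ j u) (monomial (a u)) i i≢)
      ... | yes ≡.refl = ≡.trans (≡.cong (λ f → f (x ∷ [])) (single-diagonal (p ℕ.^ j u) (monomial (a u))))
                                 (monomial-off (a u) x (λ x≡a → off (≡.refl , x≡a)))

      μ-self : ∀ u → μ u (p ℕ.^ j u) (a u ∷ []) ≡ + 1
      μ-self u = ≡.trans (≡.cong (λ f → f (a u ∷ [])) (single-diagonal (p ℕ.^ j u) (monomial (a u)))) (monomial-self (a u))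

      p^j≤p^N : ∀ u → p ℕ.^ j u ≤ p ℕ.^ N
      p^j≤p^N u = ℕₚ.^-monoʳ-≤ p {{prime⇒nonZero p-prime}} (j≤N u)

      relation-zero : ∀ i x → (∀ u → ¬ (i ≡ p ℕ.^ j u × x ≡ a u)) → relation i (x ∷ []) ≈ₚ + 0
      relation-zero i x off = comb-zero c (λ u → μ u i) (x ∷ []) (λ u → ≡⇒≈ₚ (μ-off u i x (off u)))

      polyLe-relation : PolyLe (p ℕ.^ N) H relation
      polyLe-relation .degree i p^N<i = coeffwise λ { (x ∷ []) →
        relation-zero i x (λ u (i≡ , _) → ℕₚ.<⇒≱ p^N<i (≡.subst (_≤ p ℕ.^ N) (≡.sym i≡) (p^j≤p^N u))) }
      polyLe-relation .height i (x ∷ []) H<x = relation-zero i x (λ u (_ , x≡) →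
        ℕₚ.<⇒≱ (≡.subst (H <_) (ℕₚ.+-identityʳ x) H<x) (≡.subst (_≤ H) (≡.sym x≡) (a≤H u)))

      unknown-injective : ∀ u u′ → j u ≡ j u′ → a u ≡ a u′ → u ≡ u′
      unknown-injective u u′ j≡ a≡ = ≡.trans (≡.sym (Finₚ.combine-remQuot {suc N} (suc H) u))
        (≡.trans (≡.cong₂ Fin.combine (Finₚ.toℕ-injective j≡) (Finₚ.toℕ-injective a≡)) (Finₚ.combine-remQuot {suc N} (suc H) u′))

      relation-coefficient : ∀ u → relation (p ℕ.^ j u) (a u ∷ []) ≈ₚ c u
      relation-coefficient u = dot-single c (λ u′ → μ u′ (p ℕ.^ j u) (a u ∷ [])) u (μ-self u)
        (λ u′ u′≢u → μ-off u′ (p ℕ.^ j u) (a u) (λ (p^j≡ , a≡) →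
          u′≢u (unknown-injective u′ u (≡.sym (p^-injective (j u) (j u′) p^j≡)) (≡.sym a≡))))

      -- Distinct unknowns belong to distinct monomials x^a Y^(p^j), so no cancellation can hide a
      -- nonzero c u.
      relation≉0 : Nonzero relation
      relation≉0 = at-unknown (proj₁ (proj₁ (proj₂ solution))) (proj₂ (proj₁ (proj₂ solution)))
        where
        at-unknown : ∀ u → ¬ (c u ≈ₚ + 0) → Nonzero relation
        at-unknown u cu≉0 = nonzero {n = 1} {F = relation} (p ℕ.^ j u) (a u ∷ [])
          (λ e → cu≉0 (K.trans (K.sym (relation-coefficient u)) e))

      term : ℕ → Unknown → ℕ → ℤ
      term M u l = δ M (position u l) ℤ.* D (l ∷ [])

      part : ℕ → ℕ → Unknown → ℤ
      part M t u = sum {block u} (λ e → term M u (index (block u) (toℕ e) t))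

      -- The shift t p^N is the same for all u: this is the purpose of cutting Δ(g) into blocks of
      -- length p^(N - j u).
      position-index : ∀ u e t → position u (index (block u) e t) ≡ position u e ℕ.+ t ℕ.* p ℕ.^ N
      position-index u e t = begin
        a u ℕ.+ p ℕ.^ j u ℕ.* index (block u) e t                          ≡⟨ ≡.cong (λ l → a u ℕ.+ p ℕ.^ j u ℕ.* l) (index≡ (block u) e t) ⟩
        a u ℕ.+ p ℕ.^ j u ℕ.* (e ℕ.+ t ℕ.* block u)                        ≡⟨ regroup (a u) (p ℕ.^ j u) e t (block u) ⟩
        position u e ℕ.+ t ℕ.* (p ℕ.^ j u ℕ.* block u)                     ≡⟨ ≡.cong (λ q → position u e ℕ.+ t ℕ.* q) (p^j*block u) ⟩
        position u e ℕ.+ t ℕ.* p ℕ.^ N                                     ∎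
        where open ≡.≡-Reasoning

      -- By the common shift, `part M t u` is the coefficient of σ (M - t p^N) u at (t, ..., t), so
      -- the combination is a coefficient of Z (M - t p^N). For t p^N > M every delta is zero.
      dot-part : (∀ M → Z M ≈ₛ (λ _ → + 0)) → ∀ M t → dot c (part M t) ≈ₚ + 0
      dot-part Z≈0 M t with t ℕ.* p ℕ.^ N ℕ.≤? M
      ... | no large = dot-zeroʳ c (λ u → sum-zero {block u} (λ e → δ-term-zero M (position u (index (block u) (toℕ e) t))
              (D (index (block u) (toℕ e) t ∷ []))
              (λ M≡ → large (≡.subst (t ℕ.* p ℕ.^ N ≤_) (≡.sym (≡.trans M≡ (position-index u (toℕ e) t))) (ℕₚ.m≤n+m _ _)))))
      ... | yes small = K.trans (sum-cong-≋ (λ u → K.*-congˡ {c u} (sum-cong-≋ {block u} (λ e → ≡⇒≈ₚ (shift u (toℕ e))))))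
              (coeff (Z≈0 M′) (Vec.replicate n t))
        where
        M′ : ℕ
        M′ = M ℕ.∸ t ℕ.* p ℕ.^ N
        shift : ∀ u e → term M u (index (block u) e t) ≡ δ M′ (position u e) ℤ.* s (N ℕ.∸ j u) e (Vec.replicate n t)
        shift u e = ≡.cong₂ ℤ._*_
          (≡.trans (≡.cong₂ δ (≡.sym (ℕₚ.m∸n+n≡m small)) (position-index u e t)) (δ-+ʳ (t ℕ.* p ℕ.^ N) M′ (position u e)))
          -- The diagonal of g at e + t b is the diagonal of the section with residues (e, ..., e)
          -- at t.
          (≡.cong g (≡.sym (zipWith-replicate (index (block u)) e t)))

      relation-vanishes : (∀ M → Z M ≈ₛ (λ _ → + 0)) → Vanishes (p ℕ.^ N) relation D
      relation-vanishes Z≈0 = S.trans 1 (ev-comb c (p ℕ.^ N) μ D)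
        (S.trans 1 (comb-cong c (λ u → ev-single {k = p ℕ.^ j u} (monomial (a u)) D (p^j≤p^N u)))
          (coeffwise λ { (M ∷ []) → vanish M }))
        where
        expand : ∀ M u → (monomial (a u) ⋆ D ^^ (p ℕ.^ j u)) (M ∷ []) ≈ₚ sum {suc M} (λ t → part M (toℕ t) u)
        -- The range (M+1) `block u` exceeds M and consists of M + 1 full blocks; this number is the
        -- same for all u, so the sums over t and u can be interchanged.
        expand M u = K.trans (monomial-power (j u) (a u) D {M} {suc M ℕ.* block u}
            (ℕₚ.m≤m*n (suc M) (block u) {{ℕ.>-nonZero (C.Power.q>0 0 (N ℕ.∸ j u))}}))
          (sum-blocks (block u) (suc M) (term M u))
        vanish : ∀ M → comb c (λ u → monomial (a u) ⋆ D ^^ (p ℕ.^ j u)) (M ∷ []) ≈ₚ + 0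
        vanish M = begin
          dot c (λ u → (monomial (a u) ⋆ D ^^ (p ℕ.^ j u)) (M ∷ []))
            ≈⟨ sum-cong-≋ (λ u → K.*-congˡ {c u} (expand M u)) ⟩
          dot c (λ u → sum {suc M} (λ t → part M (toℕ t) u))
            ≈⟨ sum-cong-≋ (λ u → *-distribˡ-sum {suc M} (c u) (λ t → part M (toℕ t) u)) ⟩
          sum (λ u → sum {suc M} (λ t → c u ℤ.* part M (toℕ t) u))
            ≈⟨ ∑-comm {n = suc M} (λ u t → c u ℤ.* part M (toℕ t) u) ⟩
          sum {suc M} (λ t → dot c (part M (toℕ t)))
            ≈⟨ sum-zero {suc M} (λ t → dot-part Z≈0 M (toℕ t)) ⟩
          + 0 ∎
          where open import Relation.Binary.Reasoning.Setoid K.setoid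

  -- Translation to and from the annihilators of the statement

  module _ {n : ℕ} where
    open P n

    evalP-ev : ∀ m F g v → evalP (𝔽-raw p) m F g v ≈ₚ ev m F g v
    evalP-ev zero    F g v = coeff (S.*-identityʳ n (F 0)) v
    evalP-ev (suc m) F g v = K.trans (K.+-cong {evalP (𝔽-raw p) m F g v} {ev m F g v} (evalP-ev m F g v)
        (≡⇒≈ₚ (≡.cong (λ h → (F (suc m) ⋆ h) v) (powS≡ (suc m)))))
      (K.sym (coeff (ev-last m F g) v))
      where
      powS≡ : ∀ k → powS (𝔽-raw p) g k ≡ g ^^ k
      powS≡ zero    = ≡.refl
      powS≡ (suc k) = ≡.cong (g ⋆_) (powS≡ k)

    annihilates : ∀ {m k F g} → PolyLe m k F → Nonzero F → Vanishes m F g → Annihilates (𝔽-raw p) g m k F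
    annihilates {m} {k} {F} {g} leF F≉0 F[g]≈0 =
      (λ i _ v k<v → difference (height leF i v k<v)) ,
      witness (nonzero-coefficient leF F≉0) ,
      λ v → difference (K.trans (evalP-ev m F g v) (coeff F[g]≈0 v))
      where
      witness : Coefficient m F → Σ ℕ λ i → i ≤ m × Σ (Vec ℕ n) λ v → ¬ ((+ p) ℤDiv.∣ (F i v ℤ.- + 0))
      witness (i , v , i≤m , Fiv≉0) = i , i≤m , v , λ e → Fiv≉0 (modulo e)

    -- `Annihilates` leaves the coefficients beyond m arbitrary, whereas `DegLe` wants them to be
    -- zero.
    truncate : ℕ → Seq → Seq
    truncate zero    F zero    = F 0
    truncate zero    F (suc i) = 0ₛ 0
    truncate (suc m) F zero    = F 0
    truncate (suc m) F (suc i) = truncate m (tail F) i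

    truncate-≤ : ∀ {m i} F → i ≤ m → truncate m F i ≡ F i
    truncate-≤ {zero}  {zero}  F i≤m       = ≡.refl
    truncate-≤ {suc m} {zero}  F i≤m       = ≡.refl
    truncate-≤ {suc m} {suc i} F (s≤s i≤m) = truncate-≤ (tail F) i≤m

    truncate-> : ∀ {m i} F → m < i → truncate m F i ≡ 0ₛ 0
    truncate-> {zero}  {suc i} F m<i       = ≡.refl
    truncate-> {suc m} {suc i} F (s≤s m<i) = truncate-> (tail F) m<i

    PolynomialRoot : ℕ → ℕ → (Vec ℕ n → ℤ) → Set
    PolynomialRoot m k g = Σ (ℕ → Vec ℕ n → ℤ) λ F → PolyLe m k F × Nonzero F × Vanishes m F g

    annihilates⁻ : ∀ m k g → Σ Seq (Annihilates (𝔽-raw p) g m k) → PolynomialRoot m k g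
    annihilates⁻ m k g (F , bounded , (i , i≤m , v , Fiv≉0) , F[g]≈0) =
      truncate m F , bounds (λ j m<j → S.reflexive n (truncate-> F m<j)) heights ,
      nonzero i v (λ e → Fiv≉0 (difference (≡.subst (λ f → f v ≈ₚ + 0) (truncate-≤ F i≤m) e))) ,
      S.trans n (ev-cong′ m {truncate m F} {F} {g} {g} (λ j j≤m → S.reflexive n (truncate-≤ F j≤m)) (S.refl n))
        (coeffwise (λ w → K.trans (K.sym (evalP-ev m F g w)) (modulo (F[g]≈0 w))))
      where
      heights : ∀ j → TotLe k (truncate m F j)
      heights j w k<w with j ℕ.≤? m
      ... | yes j≤m = ≡.subst (λ f → f w ≈ₚ + 0) (≡.sym (truncate-≤ F j≤m)) (modulo (bounded j j≤m w k<w))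
      ... | no j≰m  = ≡.subst (λ f → f w ≈ₚ + 0) (≡.sym (truncate-> F (ℕₚ.≰⇒> j≰m))) K.refl

  -- The product of the relations

  module _ {n : ℕ} where
    open P n

    module _ (g : Vec ℕ n → ℤ) (m h N : ℕ) (N≡ : suc (suc m) ℕ.* suc h ℕ.^ n ≡ N) where

      DiagonalRelation : ℕ → Seq → Set
      DiagonalRelation d P = Σ (ℕ → Vec ℕ 1 → ℤ) λ F →
        PolyLe (d ℕ.* p ℕ.^ N) (d ℕ.* (N ℕ.* p ℕ.^ N)) F × Nonzero F ×
        (Vanishes d P g → Vanishes (d ℕ.* p ℕ.^ N) F (diag g))

      -- Whether g is a simple root of P is not decidable, so the relation is the product of those attached to
      -- P and to all its successive candidates; one of these factors vanishes, and equality of series is stable.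
      diagonal-relation : ∀ d {P} → d ≤ suc m → PolyLe d h P → Nonzero P → DiagonalRelation d P
      -- In degree 0 the value P(g) is the constant P, which is not zero. The root condition is
      -- void, and 1 is the neutral last factor.
      diagonal-relation zero {P} _ leP P≉0 = P.const 1 (oneS (𝔽-raw p)) , polyLe-one , nonzero-one ,
        λ P0≈0 → ⊥-elim (P≉0 (pointwise λ { zero → P0≈0 ; (suc i) → degree leP (suc i) (s≤s z≤n) }))
      diagonal-relation (suc d) {P} d<m leP P≉0 = extend (next-candidate g leP P≉0)
        where
        -- The bound suc m is kept for all candidates, so that every factor is built with the same
        -- N.
        lePm : PolyLe (suc m) h P
        lePm = polyLe-mono d<m ℕₚ.≤-refl leP
        module R = Relation g lePm N N≡
        extend : NextCandidate g leP → DiagonalRelation (suc d) P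
        extend (P′ , leP′ , P′≉0 , P′-root) = multiply (diagonal-relation d (ℕₚ.≤-trans (ℕₚ.n≤1+n d) d<m) leP′ P′≉0)
          where
          multiply : DiagonalRelation d P′ → DiagonalRelation (suc d) P
          multiply (F , leF , F≉0 , F-root) = P.conv 1 R.relation F , polyLe-conv R.polyLe-relation leF ,
            nonzero-conv R.relation≉0 F≉0 , λ P[g]≈0 →
              S.trans 1 (P.ev-conv 1 R.relation F (diag g) (degree R.polyLe-relation) (degree leF)) (product P[g]≈0)
            where
            x y : Vec ℕ 1 → ℤ
            x = P.ev 1 (p ℕ.^ N) R.relation (diag g)
            y = P.ev 1 (d ℕ.* p ℕ.^ N) F (diag g)
            product : Vanishes (suc d) P g → x ⋆ y ≈ₛ (λ _ → + 0)
            -- Assume x y is not zero. If P′(g) vanished, the next candidate would make y zero;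
            -- hence P′(g) is not zero, so `R.Z≈0` applies and x is zero.
            product P[g]≈0 = IsDomain.stable (seriesDomain 1) (λ xy≉0 → xy≉0
              (S.trans 1 (S.*-congʳ 1 {y} (R.relation-vanishes (R.Z≈0
                (S.trans n (ev-extend-≤ P g (degree leP) d<m) P[g]≈0)
                (λ W≈0 → xy≉0 (S.trans 1 (S.*-congˡ 1 {x} (F-root (P′-root P[g]≈0
                  (S.trans n (S.sym n (ev-extend-≤ (deriv P) g (degree (polyLe-deriv leP)) (ℕₚ.≤-pred d<m))) W≈0))))
                  (S.zeroʳ 1 x)))))) (S.zeroˡ 1 y)))

    -- The height k₁ of A only sets the length of the descent, and the degree m₂ of B only the power
    -- q used in it. Hence the result is bounded in terms of n, m, h and p.
    diagonal-root : ∀ g {m m₁ k₁ m₂ h} → m₁ ≤ suc m → PolynomialRoot m₁ k₁ g → PolynomialRoot m₂ h g →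
      let N = suc (suc m) ℕ.* suc h ℕ.^ n in
      Σ (ℕ → Vec ℕ 1 → ℤ) λ F → Annihilates (𝔽-raw p) (diag g) (suc m ℕ.* p ℕ.^ N) (suc m ℕ.* (N ℕ.* p ℕ.^ N)) F
    diagonal-root g {m} {m₁} {k₁} {m₂} {h} m₁≤m (A , leA , A≉0 , A[g]≈0) (B , leB , B≉0 , B[g]≈0) =
      finish (reduce-height g k₁ (polyLe-mono m₁≤m ℕₚ.≤-refl leA) A≉0 (S.trans n (ev-extend-≤ A g (degree leA) m₁≤m) A[g]≈0)
        leB B≉0 B[g]≈0)
      where
      N : ℕ
      N = suc (suc m) ℕ.* suc h ℕ.^ n
      finish : PolynomialRoot (suc m) h g →
        Σ (ℕ → Vec ℕ 1 → ℤ) λ F → Annihilates (𝔽-raw p) (diag g) (suc m ℕ.* p ℕ.^ N) (suc m ℕ.* (N ℕ.* p ℕ.^ N)) F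
      finish (P , leP , P≉0 , P[g]≈0) = convert (diagonal-relation g m h N ≡.refl (suc m) ℕₚ.≤-refl leP P≉0)
        where
        convert : DiagonalRelation g m h N ≡.refl (suc m) P →
          Σ (ℕ → Vec ℕ 1 → ℤ) λ F → Annihilates (𝔽-raw p) (diag g) (suc m ℕ.* p ℕ.^ N) (suc m ℕ.* (N ℕ.* p ℕ.^ N)) F
        convert (F , leF , F≉0 , F-root) = F , annihilates leF F≉0 (F-root P[g]≈0)

open import Data.Nat using (_^_; _*_; _+_)

theorem1p2 : (n d h : ℕ) → NonZero n → NonZero d → NonZero h →
    Σ ℕ λ A →
    (f : Vec ℕ n → ℤ) →
    AlgDegLe ℚ-raw (toℚSeries f) d →
    AlgHeightLe ℚ-raw (toℚSeries f) h →
    (p : ℕ) → Prime p →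
    AlgDegLe (𝔽-raw p) (diag f) (p ^ A)
    × AlgHeightLe (𝔽-raw p) (diag f) (A * A * p ^ (A + 1))
theorem1p2 n zero    h _ () _
theorem1p2 n (suc m) h _ _  _ = A , reduce
  where
  N A : ℕ
  N = suc (suc m) * suc h ^ n
  -- The degree needs (m+1) p^N ≤ p^(m+1) p^N, and m + 1 < p^(m+1). The height needs m + 1 ≤ A and N
  -- ≤ A, whence the factor A².
  A = suc m + N

  degree-bound : ∀ {p} → 1 < p → suc m * p ^ N ≤ p ^ A
  degree-bound {p} 1<p = ≡.subst (suc m * p ^ N ≤_) (≡.sym (ℕₚ.^-distribˡ-+-* p (suc m) N))
    (ℕₚ.*-monoˡ-≤ (p ^ N) (ℕₚ.<⇒≤ (n<m^n 1<p (suc m))))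

  height-bound : ∀ {p} → 1 < p → suc m * (N * p ^ N) ≤ A * A * p ^ (A + 1)
  height-bound {p} 1<p = ≡.subst (_≤ A * A * p ^ (A + 1)) (ℕₚ.*-assoc (suc m) N (p ^ N))
    (ℕₚ.*-mono-≤ (ℕₚ.*-mono-≤ (ℕₚ.m≤m+n (suc m) N) (ℕₚ.m≤n+m N (suc m)))
      (ℕₚ.^-monoʳ-≤ p {{ℕ.>-nonZero (ℕₚ.<-trans (s≤s z≤n) 1<p)}} (ℕₚ.≤-trans (ℕₚ.m≤n+m N (suc m)) (ℕₚ.m≤m+n A 1))))

  reduce : (f : Vec ℕ n → ℤ) → AlgDegLe ℚ-raw (toℚSeries f) (suc m) → AlgHeightLe ℚ-raw (toℚSeries f) h →
    (p : ℕ) → Prime p → AlgDegLe (𝔽-raw p) (diag f) (p ^ A) × AlgHeightLe (𝔽-raw p) (diag f) (A * A * p ^ (A + 1))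
  reduce f (m₁ , k₁ , A₁ , m₁≤d , annA₁) (m₂ , A₂ , annA₂) p p-prime =
    bound (diagonal-root f m₁≤d (annihilates⁻ m₁ k₁ f (annihilator-modulo p-prime f m₁ k₁ A₁ annA₁))
                                (annihilates⁻ m₂ h f (annihilator-modulo p-prime f m₂ h A₂ annA₂)))
    where
    open ReductionModulo using (annihilator-modulo)
    open CharacteristicP p-prime using (annihilates⁻; diagonal-root; p>1)
    bound : (Σ (ℕ → Vec ℕ 1 → ℤ) λ F → Annihilates (𝔽-raw p) (diag f) (suc m * p ^ N) (suc m * (N * p ^ N)) F) →
      AlgDegLe (𝔽-raw p) (diag f) (p ^ A) × AlgHeightLe (𝔽-raw p) (diag f) (A * A * p ^ (A + 1))
    bound (F , bounded , nonzero , vanishes) =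
      (suc m * p ^ N , suc m * (N * p ^ N) , F , degree-bound p>1 , bounded , nonzero , vanishes) ,
      (suc m * p ^ N , F , (λ i i≤ v k<v → bounded i i≤ v (ℕₚ.≤-<-trans (height-bound p>1) k<v)) , nonzero , vanishes)
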